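{- For every integer $t\ge 3$, the Strong Ramsey game $\mathcal{R}(K_{\aleph_0}^{(3)}, K^{(3)}_{2,t+1}(t-2))$ is a draw, i.e. $P_1$ has no winning strategy; equivalently, $P_2$ has a strategy guaranteeing that $P_1$ does not win.
   Context: Strong Ramsey game $\mathcal{R}(B,G)$: $B$ (board) and $G$ (target) are $k$-uniform hypergraphs, $G$ finite; players $P_1$, $P_2$ alternately color uncolored edges of $B$ in their own color, $P_1$ first; whoever first completes a monochromatic copy of $G$ in their own color wins; if nobody does in finitely many moves, the game is a draw. The game "is a draw" means neither player has a winning strategy. $K_{\aleph_0}^{(3)}$ is the complete $3$-uniform hypergraph on a countably infinite vertex set. For $s\ge 0$, $t\ge 3$, $K_{2,t}(s)$ is the graph obtained from $K_{2,t}$ by identifying the center of a star with $s$ edges with one of the two vertices of degree $t$ of $K_{2,t}$ (the star otherwise disjoint). For a graph $H$, $H^{(3)}$ is the $3$-uniform hypergraph obtained by adding one fixed new vertex to every edge of $H$. -}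

module Defs where

open import Data.Nat using (ℕ; _<_; _%_)
open import Data.Fin using (Fin)
open import Data.Maybe using (Maybe; just; nothing)
open import Data.Product using (Σ; _×_; _,_)
open import Data.Sum using (_⊎_)
open import Data.List using (List; applyUpTo)
open import Data.List.Relation.Unary.All using (All)
open import Data.List.Relation.Unary.Unique.Propositional using (Unique)
open import Data.List.Membership.Propositional using (_∉_)
open import Relation.Nullary using (¬_)
open import Relation.Binary.PropositionalEquality using (_≡_)

-- Board: the complete 3-uniform hypergraph on ℕ (countably infinite).
-- A board edge {a,b,c} is represented canonically by the sorted
-- triple (a , b , c) with a < b < c.

Triple : Set
Triple = ℕ × ℕ × ℕ

ValidEdge : Triple → Set
ValidEdge (a , b , c) = (a < b) × (b < c)

_∈ₜ_ : ℕ → Triple → Set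
v ∈ₜ (a , b , c) = (v ≡ a) ⊎ (v ≡ b) ⊎ (v ≡ c)

SameSet : Triple → Triple → Set
SameSet t u = ∀ v → ((v ∈ₜ t → v ∈ₜ u) × (v ∈ₜ u → v ∈ₜ t))

-- Finite 3-uniform target hypergraphs: a vertex type and a relation
-- listing (some ordering of) each hyperedge.

record Hypergraph3 : Set₁ where
  field
    Vtx  : Set
    Edge : Vtx → Vtx → Vtx → Set

open Hypergraph3 public

Contains : Hypergraph3 → (Triple → Set) → Set
Contains G S =
  Σ (Vtx G → ℕ) λ φ →
    (∀ x y → φ x ≡ φ y → x ≡ y) ×
    (∀ x y z → Edge G x y z →
       Σ Triple λ e → S e × SameSet e (φ x , φ y , φ z))

-- vertices: the two vertices of degree t (hub1, hub2), the t common
-- neighbours (mid i), and the s extra star leaves attached to hub1.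
data KVtx (t s : ℕ) : Set where
  hub1 hub2 : KVtx t s
  mid  : Fin t → KVtx t s
  leaf : Fin s → KVtx t s

data KEdge (t s : ℕ) : KVtx t s → KVtx t s → Set where
  e1 : (i : Fin t) → KEdge t s hub1 (mid i)
  e2 : (i : Fin t) → KEdge t s hub2 (mid i)
  e3 : (j : Fin s) → KEdge t s hub1 (leaf j)

-- H^(3): add one new vertex (nothing) to every edge of H.
data K3Edge (t s : ℕ) : Maybe (KVtx t s) → Maybe (KVtx t s) → Maybe (KVtx t s) → Set where
  lift : ∀ {x y} → KEdge t s x y → K3Edge t s (just x) (just y) nothing

K2ts3 : ℕ → ℕ → Hypergraph3
K2ts3 t s = record { Vtx = Maybe (KVtx t s) ; Edge = K3Edge t s }

-- The strong Ramsey game R(K_{ℵ0}^(3), G).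
-- A play is the infinite sequence of chosen edges; move n is made by
-- P1 if n is even and by P2 if n is odd.

Play : Set
Play = ℕ → Triple

LegalPlay : Play → Set
LegalPlay p = (∀ n → ValidEdge (p n)) × (∀ i j → p i ≡ p j → i ≡ j)

history : Play → ℕ → List Triple
history p n = applyUpTo p n

Strategy : Set
Strategy = List Triple → Triple

LegalStrategy : Strategy → Set
LegalStrategy σ = ∀ h → All ValidEdge h → Unique h → ValidEdge (σ h) × (σ h ∉ h)

Follows1 : Strategy → Play → Set
Follows1 σ p = ∀ n → n % 2 ≡ 0 → p n ≡ σ (history p n)

Follows2 : Strategy → Play → Set
Follows2 τ p = ∀ n → n % 2 ≡ 1 → p n ≡ τ (history p n)

RedAt : Play → ℕ → Triple → Set
RedAt p n e = Σ ℕ λ i → (i < n) × (i % 2 ≡ 0) × (p i ≡ e)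

BlueAt : Play → ℕ → Triple → Set
BlueAt p n e = Σ ℕ λ i → (i < n) × (i % 2 ≡ 1) × (p i ≡ e)

-- P1 completes a red copy before P2 completes a blue copy
-- (colour sets only grow, so this is "first to complete").
P1Wins : Hypergraph3 → Play → Set
P1Wins G p = Σ ℕ λ n → Contains G (RedAt p n) × ¬ Contains G (BlueAt p n)

P2Wins : Hypergraph3 → Play → Set
P2Wins G p = Σ ℕ λ n → Contains G (BlueAt p n) × ¬ Contains G (RedAt p n)

P1HasWinningStrategy : Hypergraph3 → Set
P1HasWinningStrategy G =
  Σ Strategy λ σ → LegalStrategy σ ×
    (∀ p → LegalPlay p → Follows1 σ p → P1Wins G p)

P2HasWinningStrategy : Hypergraph3 → Set
P2HasWinningStrategy G =
  Σ Strategy λ τ → LegalStrategy τ ×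
    (∀ p → LegalPlay p → Follows2 τ p → P2Wins G p)

IsDraw : Hypergraph3 → Set
IsDraw G = ¬ P1HasWinningStrategy G × ¬ P2HasWinningStrategy G

{-# OPTIONS --safe #-}
module Submission where

-- Whoever moves second on an untouched board can hold the draw, so the first player has no winning
-- strategy, and neither does the second one: the first player makes an arbitrary move and then plays
-- as second player.  Call the drawing player blue.
--
-- Blue first plays 2t - 1 edges {a,b,x} with new vertices x, then takes a new vertex c and claims
-- edges {a,c,x}.  The opponent cannot keep blue from getting t of these; if a further {a,c,x} is then
-- free, it wins, and otherwise blue repeats forever the threat {a,b,y} with a new vertex y, which has
-- to be answered by {a,c,y}.  A pure race would be lost by one tempo.  If the first 2t + 1 edges of
-- the opponent all belong to one pair of hubs h, h′ in the link of a vertex v, blue therefore answers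
-- every further edge at this pair so that h and h′ never get more than t common neighbours; any other
-- K_{2,t+1} costs the opponent t + 1 moves that blue is free to ignore.  Otherwise an edge is wasted
-- and blue need not defend at all.  The t - 1 edges {a,c,x} with which the opponent can stop blue from
-- winning must not help the opponent, which is achieved by choosing which of a, b is the centre and
-- which x is joined to c first.

open import Defs
open import Data.Nat
open import Data.Nat.Properties
open import Data.Nat.Tactic.RingSolver using (solve-∀)
open import Data.Fin using (Fin; zero; suc)
open import Data.Maybe using (just; nothing)
open import Data.Product using (Σ; _×_; _,_; proj₁; proj₂; ∃₂)
open import Data.Product.Properties using (≡-dec)
open import Data.Sum using (_⊎_; inj₁; inj₂; [_,_])
open import Data.Empty using (⊥; ⊥-elim)
open import Data.List using (List; []; _∷_; _++_; _∷ʳ_; map; length; reverse; filter; applyUpTo; tabulate; lookup)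
open import Data.List.Properties using (length-++; length-map; length-tabulate; unfold-reverse; applyUpTo-∷ʳ; ++-assoc; ++-identityʳ)
open import Data.List.Membership.Propositional using (_∈_; _∉_; find; lose)
open import Data.List.Membership.Propositional.Properties
open import Data.List.Relation.Unary.Any using (Any; here; there; any?)
open import Data.List.Relation.Unary.All as All using (All; []; _∷_)
open import Data.List.Relation.Unary.AllPairs using ([]; _∷_)
open import Data.List.Relation.Unary.Unique.Propositional using (Unique)
open import Data.List.Relation.Unary.Unique.Propositional.Properties using (Unique[x∷xs]⇒x∉xs; tabulate⁺) renaming (++⁺ to Unique-++⁺)
open import Data.List.Relation.Binary.Permutation.Propositional using (_↭_; refl; prep; swap; trans; ↭-sym; ↭-reflexive)
open import Data.List.Relation.Binary.Permutation.Propositional.Properties using (All-resp-↭; ∈-resp-↭; ↭-length; ↭-reverse; shift; shifts) renaming (++⁺ˡ to ↭-++⁺ˡ; ++⁺ʳ to ↭-++⁺ʳ)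
open import Relation.Nullary using (Dec; yes; no; ¬_)
open import Relation.Nullary.Decidable using (_⊎-dec_; _×-dec_; ¬¬-excluded-middle)
open import Relation.Binary.Definitions using (tri<; tri≈; tri>)
open import Relation.Binary.PropositionalEquality using (_≡_; _≢_; refl; sym; cong; cong₂; subst; ≢-sym; module ≡-Reasoning) renaming (trans to ≡-trans)

-- The target has 3t edges. If blue never defends, the opponent has exactly 3t edges when the
-- perpetual threats begin; until then a red copy would have to consist of all red edges, and a
-- single wasted one excludes it. Afterwards size excludes nothing, because the answers {a,c,y} grow
-- without bound. But each y is new and lies only in its answer and possibly in the latest red edge,
-- so deleting one common neighbour from a red K_{2,t+1} leaves a K_{2,t} of edges that were red
-- before the threats. The critical case is centre a with c as a hub: the opponent's edges {a,c,x}
-- can be half of such a K_{2,t}, and the choice of the centre and of x₁ keeps the total one edge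
-- short of 2t. The first red edge avoids a, b, c and every x. Leaving it out saves the one edge by
-- which several counts would otherwise fail. Questions such as whether the early red edges share a
-- pair of hubs are decided under a double negation, which suffices because both conclusions are
-- negations.

private
  variable
    A A′ : Set

-- Counting with duplicate-free lists

Unique-resp-↭ : {xs ys : List A} → xs ↭ ys → Unique xs → Unique ys
Unique-resp-↭ refl u = u
Unique-resp-↭ (prep x p) (px ∷ u) = All-resp-↭ p px ∷ Unique-resp-↭ p u
Unique-resp-↭ (swap x y p) ((x≢y ∷ px) ∷ py ∷ u) =
  (≢-sym x≢y ∷ All-resp-↭ p py) ∷ All-resp-↭ p px ∷ Unique-resp-↭ p u
Unique-resp-↭ (trans p q) u = Unique-resp-↭ q (Unique-resp-↭ p u)

∉⇒All≢ : {x : A} {xs : List A} → x ∉ xs → All (x ≢_) xs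
∉⇒All≢ x∉ = All.tabulate λ y∈ x≡y → x∉ (subst (_∈ _) (sym x≡y) y∈)

extract : {x : A} {xs : List A} → x ∈ xs → Σ (List A) λ ys → xs ↭ x ∷ ys
extract {x = x} x∈ with ∈-∃++ x∈
... | ys , zs , refl = ys ++ zs , shift x ys zs

∈-strict : {x y : A} {ys : List A} → y ∈ x ∷ ys → y ≢ x → y ∈ ys
∈-strict (here y≡x) y≢x = ⊥-elim (y≢x y≡x)
∈-strict (there y∈) _ = y∈

Unique-⊆-length : {xs ys : List A} → Unique xs → (∀ {x} → x ∈ xs → x ∈ ys) → length xs ≤ length ys
Unique-⊆-length [] _ = z≤n
Unique-⊆-length {xs = x ∷ xs} {ys} u@(_ ∷ u′) sub with extract (sub (here refl))
... | zs , p = subst (suc (length xs) ≤_) (sym (↭-length p))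
      (s≤s (Unique-⊆-length u′ λ {y} y∈ →
        ∈-strict (∈-resp-↭ p (sub (there y∈))) λ { refl → Unique[x∷xs]⇒x∉xs u y∈ }))

Unique-⊆-tight : {xs ys : List A} → (∀ (y z : A) → Dec (y ≡ z)) → Unique xs →
                 (∀ {x} → x ∈ xs → x ∈ ys) → length ys ≤ length xs → ∀ {y} → y ∈ ys → y ∈ xs
Unique-⊆-tight {xs = xs} _≟′_ u sub le {y} y∈ with any? (y ≟′_) xs
... | yes y∈xs = y∈xs
... | no y∉xs with extract y∈
...   | zs , p = ⊥-elim (1+n≰n (≤-trans (subst (_≤ length xs) (↭-length p) le)
          (Unique-⊆-length u λ x∈ → ∈-strict (∈-resp-↭ p (sub x∈)) λ { refl → y∉xs x∈ })))

InjectiveOn : (A → A′) → List A → Set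
InjectiveOn f xs = ∀ {x y} → x ∈ xs → y ∈ xs → f x ≡ f y → x ≡ y

Unique-map : {f : A → A′} {xs : List A} → InjectiveOn f xs → Unique xs → Unique (map f xs)
Unique-map inj [] = []
Unique-map {f = f} {x ∷ xs} inj u@(_ ∷ u′) =
  ∉⇒All≢ (λ fx∈ → let y , y∈ , eq = ∈-map⁻ f fx∈ in
    Unique[x∷xs]⇒x∉xs u (subst (_∈ xs) (sym (inj (here refl) (there y∈) eq)) y∈))
  ∷ Unique-map (λ p q → inj (there p) (there q)) u′

count-family : {f : A → A′} {xs : List A} {ys : List A′} → Unique xs → InjectiveOn f xs →
               (∀ {x} → x ∈ xs → f x ∈ ys) → length xs ≤ length ys
count-family {f = f} {xs} {ys} u inj sub = subst (_≤ length ys) (length-map f xs)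
  (Unique-⊆-length (Unique-map inj u) λ e∈ → let x , x∈ , eq = ∈-map⁻ f e∈ in subst (_∈ ys) (sym eq) (sub x∈))

-- The edges of a copy at its two hubs form two disjoint families, each indexed injectively by
-- neighbours. Any list of edges covering both is therefore long, and a list of exactly that length
-- contains nothing else.
module _ {f g : A → A′} {xs zs : List A} {ys : List A′}
         (u : Unique xs) (w : Unique zs) (injf : InjectiveOn f xs) (injg : InjectiveOn g zs)
         (disjoint : ∀ {x z} → x ∈ xs → z ∈ zs → f x ≢ g z)
         (subf : ∀ {x} → x ∈ xs → f x ∈ ys) (subg : ∀ {z} → z ∈ zs → g z ∈ ys) where

  private
    uni : Unique (map f xs ++ map g zs)
    uni = Unique-++⁺ (Unique-map injf u) (Unique-map injg w) λ (p , q) →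
      let x , x∈ , eq = ∈-map⁻ f p ; z , z∈ , eq′ = ∈-map⁻ g q in disjoint x∈ z∈ (≡-trans (sym eq) eq′)

    len : length (map f xs ++ map g zs) ≡ length xs + length zs
    len = ≡-trans (length-++ (map f xs)) (cong₂ _+_ (length-map f xs) (length-map g zs))

    sub : ∀ {e} → e ∈ map f xs ++ map g zs → e ∈ ys
    sub e∈ with ∈-++⁻ (map f xs) e∈
    ... | inj₁ p = let x , x∈ , eq = ∈-map⁻ f p in subst (_∈ ys) (sym eq) (subf x∈)
    ... | inj₂ q = let z , z∈ , eq = ∈-map⁻ g q in subst (_∈ ys) (sym eq) (subg z∈)

  count-families : length xs + length zs ≤ length ys
  count-families = subst (_≤ length ys) len (Unique-⊆-length uni sub)

  tight-families : (∀ (y z : A′) → Dec (y ≡ z)) → length ys ≤ length xs + length zs →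
                   ∀ {e} → e ∈ ys → (Σ A λ x → x ∈ xs × e ≡ f x) ⊎ (Σ A λ z → z ∈ zs × e ≡ g z)
  tight-families _≟′_ le e∈
    with ∈-++⁻ (map f xs) (Unique-⊆-tight _≟′_ uni sub (subst (length ys ≤_) (sym len) le) e∈)
  ... | inj₁ p = inj₁ (∈-map⁻ f p)
  ... | inj₂ q = inj₂ (∈-map⁻ g q)

-- Edges as unordered triples

_≟ₜ_ : (e f : Triple) → Dec (e ≡ f)
_≟ₜ_ = ≡-dec _≟_ (≡-dec _≟_ _≟_)

pattern 1st p = inj₁ p
pattern 2nd p = inj₂ (inj₁ p)
pattern 3rd p = inj₂ (inj₂ p)

_∈ₜ?_ : ∀ u e → Dec (u ∈ₜ e)
u ∈ₜ? (p , q , r) with u ≟ p | u ≟ q | u ≟ r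
... | yes u≡p | _ | _ = yes (1st u≡p)
... | no _ | yes u≡q | _ = yes (2nd u≡q)
... | no _ | no _ | yes u≡r = yes (3rd u≡r)
... | no x | no y | no z = no λ { (1st p) → x p ; (2nd p) → y p ; (3rd p) → z p }

abstract
  -- Sorting makes the triple canonical. Being abstract, it is handled later only through membership
  -- and validity, never through the six orderings.
  tri : ℕ → ℕ → ℕ → Triple
  tri p q r with p ≤? q | q ≤? r | p ≤? r
  ... | yes _ | yes _ | _     = p , q , r
  ... | yes _ | no _  | yes _ = p , r , q
  ... | yes _ | no _  | no _  = r , p , q
  ... | no _  | _     | yes _ = q , p , r
  ... | no _  | yes _ | no _  = q , r , p
  ... | no _  | no _  | no _  = r , q , p

  ∈-tri⁻ : ∀ {u} p q r → u ∈ₜ tri p q r → u ∈ₜ (p , q , r)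
  ∈-tri⁻ p q r u∈ with p ≤? q | q ≤? r | p ≤? r
  ∈-tri⁻ p q r u∈      | yes _ | yes _ | _     = u∈
  ∈-tri⁻ p q r (1st e) | yes _ | no _  | yes _ = 1st e
  ∈-tri⁻ p q r (2nd e) | yes _ | no _  | yes _ = 3rd e
  ∈-tri⁻ p q r (3rd e) | yes _ | no _  | yes _ = 2nd e
  ∈-tri⁻ p q r (1st e) | yes _ | no _  | no _  = 3rd e
  ∈-tri⁻ p q r (2nd e) | yes _ | no _  | no _  = 1st e
  ∈-tri⁻ p q r (3rd e) | yes _ | no _  | no _  = 2nd e
  ∈-tri⁻ p q r (1st e) | no _  | _     | yes _ = 2nd e
  ∈-tri⁻ p q r (2nd e) | no _  | _     | yes _ = 1st e
  ∈-tri⁻ p q r (3rd e) | no _  | _     | yes _ = 3rd e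
  ∈-tri⁻ p q r (1st e) | no _  | yes _ | no _  = 2nd e
  ∈-tri⁻ p q r (2nd e) | no _  | yes _ | no _  = 3rd e
  ∈-tri⁻ p q r (3rd e) | no _  | yes _ | no _  = 1st e
  ∈-tri⁻ p q r (1st e) | no _  | no _  | no _  = 3rd e
  ∈-tri⁻ p q r (2nd e) | no _  | no _  | no _  = 2nd e
  ∈-tri⁻ p q r (3rd e) | no _  | no _  | no _  = 1st e

  ∈-tri⁺ : ∀ {u} p q r → u ∈ₜ (p , q , r) → u ∈ₜ tri p q r
  ∈-tri⁺ p q r u∈ with p ≤? q | q ≤? r | p ≤? r
  ∈-tri⁺ p q r u∈      | yes _ | yes _ | _     = u∈
  ∈-tri⁺ p q r (1st e) | yes _ | no _  | yes _ = 1st e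
  ∈-tri⁺ p q r (2nd e) | yes _ | no _  | yes _ = 3rd e
  ∈-tri⁺ p q r (3rd e) | yes _ | no _  | yes _ = 2nd e
  ∈-tri⁺ p q r (1st e) | yes _ | no _  | no _  = 2nd e
  ∈-tri⁺ p q r (2nd e) | yes _ | no _  | no _  = 3rd e
  ∈-tri⁺ p q r (3rd e) | yes _ | no _  | no _  = 1st e
  ∈-tri⁺ p q r (1st e) | no _  | _     | yes _ = 2nd e
  ∈-tri⁺ p q r (2nd e) | no _  | _     | yes _ = 1st e
  ∈-tri⁺ p q r (3rd e) | no _  | _     | yes _ = 3rd e
  ∈-tri⁺ p q r (1st e) | no _  | yes _ | no _  = 3rd e
  ∈-tri⁺ p q r (2nd e) | no _  | yes _ | no _  = 1st e
  ∈-tri⁺ p q r (3rd e) | no _  | yes _ | no _  = 2nd e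
  ∈-tri⁺ p q r (1st e) | no _  | no _  | no _  = 3rd e
  ∈-tri⁺ p q r (2nd e) | no _  | no _  | no _  = 2nd e
  ∈-tri⁺ p q r (3rd e) | no _  | no _  | no _  = 1st e

  tri-valid : ∀ {p q r} → p ≢ q → q ≢ r → p ≢ r → ValidEdge (tri p q r)
  tri-valid {p} {q} {r} p≢q q≢r p≢r with p ≤? q | q ≤? r | p ≤? r
  ... | yes a | yes b | _     = ≤∧≢⇒< a p≢q , ≤∧≢⇒< b q≢r
  ... | yes _ | no b  | yes c = ≤∧≢⇒< c p≢r , ≰⇒> b
  ... | yes a | no _  | no c  = ≰⇒> c , ≤∧≢⇒< a p≢q
  ... | no a  | _     | yes c = ≰⇒> a , ≤∧≢⇒< c p≢r
  ... | no _  | yes b | no c  = ≤∧≢⇒< b q≢r , ≰⇒> c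
  ... | no a  | no b  | no _  = ≰⇒> b , ≰⇒> a

private
  min≤ : ∀ {p q r u} → p < q → q < r → u ∈ₜ (p , q , r) → p ≤ u
  min≤ _ _ (1st refl) = ≤-refl
  min≤ p<q _ (2nd refl) = <⇒≤ p<q
  min≤ p<q q<r (3rd refl) = <⇒≤ (<-trans p<q q<r)

  ≤max : ∀ {p q r u} → p < q → q < r → u ∈ₜ (p , q , r) → u ≤ r
  ≤max p<q q<r (1st refl) = <⇒≤ (<-trans p<q q<r)
  ≤max _ q<r (2nd refl) = <⇒≤ q<r
  ≤max _ _ (3rd refl) = ≤-refl

valid-ext : ∀ {e f} → ValidEdge e → ValidEdge f → (∀ {u} → u ∈ₜ e → u ∈ₜ f) → (∀ {u} → u ∈ₜ f → u ∈ₜ e) → e ≡ f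
valid-ext {p , q , r} {p′ , q′ , r′} (p<q , q<r) (p′<q′ , q′<r′) sub sup
  with ≤-antisym (min≤ p<q q<r (sup (1st refl))) (min≤ p′<q′ q′<r′ (sub (1st refl)))
     | ≤-antisym (≤max p′<q′ q′<r′ (sub (3rd refl))) (≤max p<q q<r (sup (3rd refl)))
     | sub (2nd refl)
... | refl | refl | 1st refl = ⊥-elim (<-irrefl refl p<q)
... | refl | refl | 2nd refl = refl
... | refl | refl | 3rd refl = ⊥-elim (<-irrefl refl q<r)

tri-by-members : ∀ {e u v w} → ValidEdge e → u ≢ v → v ≢ w → u ≢ w →
                 u ∈ₜ e → v ∈ₜ e → w ∈ₜ e → e ≡ tri u v w
tri-by-members {p , q , r} {u} {v} {w} val u≢v v≢w u≢w u∈ v∈ w∈ =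
  valid-ext val (tri-valid u≢v v≢w u≢w)
    (λ s∈ → ∈-tri⁺ u v w (fromList (Unique-⊆-tight _≟_ uni sub ≤-refl (toList s∈))))
    (λ s∈ → fromList (sub (toList (∈-tri⁻ u v w s∈))))
  where
  toList : ∀ {s p q r} → s ∈ₜ (p , q , r) → s ∈ p ∷ q ∷ r ∷ []
  toList (1st e) = here e
  toList (2nd e) = there (here e)
  toList (3rd e) = there (there (here e))
  fromList : ∀ {s p q r} → s ∈ p ∷ q ∷ r ∷ [] → s ∈ₜ (p , q , r)
  fromList (here e) = 1st e
  fromList (there (here e)) = 2nd e
  fromList (there (there (here e))) = 3rd e
  uni : Unique (u ∷ v ∷ w ∷ [])
  uni = (u≢v ∷ u≢w ∷ []) ∷ (v≢w ∷ []) ∷ [] ∷ []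
  sub : ∀ {s} → s ∈ u ∷ v ∷ w ∷ [] → s ∈ p ∷ q ∷ r ∷ []
  sub (here refl) = toList u∈
  sub (there (here refl)) = toList v∈
  sub (there (there (here refl))) = toList w∈

third : ∀ {e u v} → ValidEdge e → u ≢ v → u ∈ₜ e → v ∈ₜ e → Σ ℕ λ w → w ≢ u × w ≢ v × e ≡ tri u v w
third {p , q , r} {u} {v} val@(p<q , q<r) u≢v u∈ v∈ = go u∈ v∈
  where
  Result = Σ ℕ λ w → w ≢ u × w ≢ v × (p , q , r) ≡ tri u v w
  p≢q = <⇒≢ p<q
  q≢r = <⇒≢ q<r
  p≢r = <⇒≢ (<-trans p<q q<r)
  res : ∀ w → w ≢ u → w ≢ v → w ∈ₜ (p , q , r) → Result
  res w w≢u w≢v w∈ = w , w≢u , w≢v , tri-by-members val u≢v (≢-sym w≢v) (≢-sym w≢u) u∈ v∈ w∈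
  go : u ∈ₜ (p , q , r) → v ∈ₜ (p , q , r) → Result
  go (1st refl) (1st refl) = ⊥-elim (u≢v refl)
  go (1st refl) (2nd refl) = res r (≢-sym p≢r) (≢-sym q≢r) (3rd refl)
  go (1st refl) (3rd refl) = res q (≢-sym p≢q) q≢r (2nd refl)
  go (2nd refl) (1st refl) = res r (≢-sym q≢r) (≢-sym p≢r) (3rd refl)
  go (2nd refl) (2nd refl) = ⊥-elim (u≢v refl)
  go (2nd refl) (3rd refl) = res p p≢q p≢r (1st refl)
  go (3rd refl) (1st refl) = res q q≢r (≢-sym p≢q) (2nd refl)
  go (3rd refl) (2nd refl) = res p p≢r p≢q (1st refl)
  go (3rd refl) (3rd refl) = ⊥-elim (u≢v refl)

tri₁ : ∀ p q r → p ∈ₜ tri p q r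
tri₁ p q r = ∈-tri⁺ p q r (1st refl)

tri₂ : ∀ p q r → q ∈ₜ tri p q r
tri₂ p q r = ∈-tri⁺ p q r (2nd refl)

tri₃ : ∀ p q r → r ∈ₜ tri p q r
tri₃ p q r = ∈-tri⁺ p q r (3rd refl)

∉-tri : ∀ {u p q r} → u ≢ p → u ≢ q → u ≢ r → ¬ u ∈ₜ tri p q r
∉-tri {p = p} {q} {r} u≢p u≢q u≢r u∈ with ∈-tri⁻ p q r u∈
... | 1st eq = u≢p eq
... | 2nd eq = u≢q eq
... | 3rd eq = u≢r eq

∈-tri-third : ∀ {u p q r} → u ≢ p → u ≢ q → u ∈ₜ tri p q r → u ≡ r
∈-tri-third {p = p} {q} {r} u≢p u≢q u∈ with ∈-tri⁻ p q r u∈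
... | 1st eq = ⊥-elim (u≢p eq)
... | 2nd eq = ⊥-elim (u≢q eq)
... | 3rd eq = eq

tri-injective : ∀ {p q r p′ q′ r′} → r ≢ p′ → r ≢ q′ → tri p q r ≡ tri p′ q′ r′ → r ≡ r′
tri-injective {p} {q} {r} r≢p′ r≢q′ eq = ∈-tri-third r≢p′ r≢q′ (subst (r ∈ₜ_) eq (tri₃ p q r))

Contains-mono : ∀ {G} {S T : Triple → Set} → (∀ {e} → S e → T e) → Contains G S → Contains G T
Contains-mono sub (φ , inj , edges) = φ , inj , λ x y z xyz → let e , e∈ , same = edges x y z xyz in e , sub e∈ , same

-- A crude sum exceeding every vertex that occurs, so that all numbers from here on are new
-- vertices.
bound : List Triple → ℕ
bound [] = 0
bound ((p , q , r) ∷ L) = suc (p + q + r) + bound L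

<-bound : ∀ {L e u} → e ∈ L → u ∈ₜ e → u < bound L
<-bound {(p , q , r) ∷ L} (here refl) u∈ = ≤-trans (s≤s (le u∈)) (m≤m+n _ (bound L))
  where
  le : ∀ {u} → u ∈ₜ (p , q , r) → u ≤ p + q + r
  le (1st refl) = ≤-trans (m≤m+n p q) (m≤m+n (p + q) r)
  le (2nd refl) = ≤-trans (m≤n+m q p) (m≤m+n (p + q) r)
  le (3rd refl) = m≤n+m r (p + q)
<-bound {(p , q , r) ∷ L} (there e∈) u∈ = ≤-trans (<-bound e∈ u∈) (m≤n+m (bound L) _)

runFrom : ℕ → Triple
runFrom n = n , suc n , suc (suc n)

runFrom-valid : ∀ n → ValidEdge (runFrom n)
runFrom-valid n = ≤-refl , ≤-refl

<-runFrom : ∀ {u n} → u < n → ¬ u ∈ₜ runFrom n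
<-runFrom u<n (1st refl) = <-irrefl refl u<n
<-runFrom u<n (2nd refl) = <-asym u<n ≤-refl
<-runFrom u<n (3rd refl) = <-irrefl refl (<-trans (<-trans u<n ≤-refl) ≤-refl)

runFrom-∉ : ∀ {L n} → bound L ≤ n → runFrom n ∉ L
runFrom-∉ le e∈ = <-irrefl refl (≤-trans (<-bound e∈ (1st refl)) le)

-- Lists indexed from their last element

-- Moves are added at the head; counting from the end keeps the index of a move fixed as the list
-- grows. The triple 0, 0, 0 is only the out-of-range value.
at : ℕ → List Triple → Triple
at n [] = 0 , 0 , 0
at n (x ∷ xs) with n ≟ length xs
... | yes _ = x
... | no _  = at n xs

below : ℕ → List Triple → List Triple
below n [] = []
below n (x ∷ xs) with suc (length xs) ≤? n
... | yes _ = x ∷ xs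
... | no _  = below n xs

at-head : ∀ x xs → at (length xs) (x ∷ xs) ≡ x
at-head x xs with length xs ≟ length xs
... | yes _ = refl
... | no ne = ⊥-elim (ne refl)

at-cons : ∀ {n} x xs → n < length xs → at n (x ∷ xs) ≡ at n xs
at-cons {n} x xs n< with n ≟ length xs
... | yes refl = ⊥-elim (<-irrefl refl n<)
... | no _ = refl

below-all : ∀ {n} xs → length xs ≤ n → below n xs ≡ xs
below-all [] _ = refl
below-all {n} (x ∷ xs) le with suc (length xs) ≤? n
... | yes _ = refl
... | no nle = ⊥-elim (nle le)

below-cons : ∀ {n} x xs → n ≤ length xs → below n (x ∷ xs) ≡ below n xs
below-cons {n} x xs le with suc (length xs) ≤? n
... | yes le′ = ⊥-elim (1+n≰n (≤-trans le′ le))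
... | no _ = refl

below-suc : ∀ {n} xs → n < length xs → below (suc n) xs ≡ at n xs ∷ below n xs
below-suc {n} (x ∷ xs) (s≤s n≤) with n ≟ length xs
... | yes refl = ≡-trans (below-all (x ∷ xs) ≤-refl)
                   (cong (x ∷_) (sym (≡-trans (below-cons x xs ≤-refl) (below-all xs ≤-refl))))
... | no ne = ≡-trans (below-cons x xs n<) (≡-trans (below-suc xs n<) (cong (at n xs ∷_) (sym (below-cons x xs n≤))))
  where n< = ≤∧≢⇒< n≤ ne

below-0 : ∀ xs → below 0 xs ≡ []
below-0 [] = refl
below-0 (x ∷ xs) = ≡-trans (below-cons x xs z≤n) (below-0 xs)

at-∈-below : ∀ {i j} xs → i < j → j ≤ length xs → at i xs ∈ below j xs
at-∈-below {i} {suc j} xs (s≤s i≤j) j< rewrite below-suc xs j< with i ≟ j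
... | yes refl = here refl
... | no ne = there (at-∈-below xs (≤∧≢⇒< i≤j ne) (<⇒≤ j<))

below-⊆ : ∀ {n e} xs → e ∈ below n xs → e ∈ xs
below-⊆ {n} (x ∷ xs) e∈ with suc (length xs) ≤? n
... | yes _ = e∈
... | no _ = there (below-⊆ xs e∈)

below-unique : ∀ {n} {xs} → Unique xs → Unique (below n xs)
below-unique [] = []
below-unique {n} {x ∷ xs} u@(_ ∷ u′) with suc (length xs) ≤? n
... | yes _ = u
... | no _ = below-unique u′

-- A position is the list of blue moves made so far (latest first): the replies of the strategy σ are
-- determined by it.  Z lists the edges claimed before σ makes its first move.
module Game (σ : Strategy) (legal : LegalStrategy σ) (Z : List Triple) (Zv : All ValidEdge Z) (Zu : Unique Z) where

  -- Both colours, latest first. Every blue move is stored together with the reply, so blue is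
  -- always to move; `reverse` restores the chronological order that σ reads.
  cl : List Triple → List Triple
  cl [] = σ (reverse Z) ∷ Z
  cl (b ∷ B) = σ (reverse (b ∷ cl B)) ∷ b ∷ cl B

  reply : Triple → List Triple → Triple
  reply b B = σ (reverse (b ∷ cl B))

  red : List Triple → List Triple
  red [] = σ (reverse Z) ∷ []
  red (b ∷ B) = reply b B ∷ red B

  data Legal : List Triple → Set where
    []  : Legal []
    _∷_ : ∀ {b B} → ValidEdge b × b ∉ cl B → Legal B → Legal (b ∷ B)

  σ-legal : ∀ {L} → All ValidEdge L → Unique L → ValidEdge (σ (reverse L)) × σ (reverse L) ∉ L
  σ-legal {L} v u =
    let valid , new = legal (reverse L) (All-resp-↭ (↭-sym (↭-reverse L)) v) (Unique-resp-↭ (↭-sym (↭-reverse L)) u)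
    in valid , λ e∈ → new (∈-resp-↭ (↭-sym (↭-reverse L)) e∈)

  cl-valid : ∀ {B} → Legal B → All ValidEdge (cl B)
  cl-unique : ∀ {B} → Legal B → Unique (cl B)
  blue-unique : ∀ {b B} → Legal (b ∷ B) → Unique (b ∷ cl B)
  reply-legal : ∀ {b B} → Legal (b ∷ B) → ValidEdge (reply b B) × reply b B ∉ b ∷ cl B

  cl-valid [] = proj₁ (σ-legal Zv Zu) ∷ Zv
  cl-valid l@((bv , _) ∷ L) = proj₁ (reply-legal l) ∷ bv ∷ cl-valid L
  cl-unique [] = ∉⇒All≢ (proj₂ (σ-legal Zv Zu)) ∷ Zu
  cl-unique l@(_ ∷ L) = ∉⇒All≢ (proj₂ (reply-legal l)) ∷ blue-unique l
  blue-unique ((_ , b∉) ∷ L) = ∉⇒All≢ b∉ ∷ cl-unique L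
  reply-legal l@((bv , _) ∷ L) = σ-legal (bv ∷ cl-valid L) (blue-unique l)

  red⊆cl : ∀ {B e} → e ∈ red B → e ∈ cl B
  red⊆cl {[]} (here eq) = here eq
  red⊆cl {b ∷ B} (here eq) = here eq
  red⊆cl {b ∷ B} (there e∈) = there (there (red⊆cl e∈))

  blue⊆cl : ∀ {B e} → e ∈ B → e ∈ cl B
  blue⊆cl {b ∷ B} (here eq) = there (here eq)
  blue⊆cl {b ∷ B} (there e∈) = there (there (blue⊆cl e∈))

  red-blue : ∀ {B e} → Legal B → e ∈ red B → e ∉ B
  red-blue l@(_ ∷ _) (here refl) (here eq) = proj₂ (reply-legal l) (here eq)
  red-blue l@(_ ∷ _) (here refl) (there e∈) = proj₂ (reply-legal l) (there (blue⊆cl e∈))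
  red-blue ((_ , b∉) ∷ _) (there e∈) (here refl) = b∉ (red⊆cl e∈)
  red-blue (_ ∷ L) (there e∈) (there e∈′) = red-blue L e∈ e∈′

  red-valid : ∀ {B e} → Legal B → e ∈ red B → ValidEdge e
  red-valid L e∈ = All.lookup (cl-valid L) (red⊆cl e∈)

  red-unique : ∀ {B} → Legal B → Unique (red B)
  red-unique [] = [] ∷ []
  red-unique l@(_ ∷ L) = ∉⇒All≢ (λ e∈ → proj₂ (reply-legal l) (there (red⊆cl e∈))) ∷ red-unique L

  red-length : ∀ B → length (red B) ≡ suc (length B)
  red-length [] = refl
  red-length (b ∷ B) = cong suc (red-length B)

  module Run (Z<2 : length Z < 2) (G : Hypergraph3) (Inv : List Triple → Set)
    (safe : ∀ {B} → Legal B → Inv B → ¬ Contains G (_∈ red B))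
    (step : ∀ {B} → Legal B → Inv B →
            Σ Triple λ b → ValidEdge b × b ∉ cl B × (Inv (b ∷ B) ⊎ Contains G (_∈ b ∷ B)))
    {B₀ : List Triple} (L₀ : Legal B₀) (I₀ : Inv B₀) where

    -- A play never ends, so after completing a copy with b blue goes on with arbitrary legal moves.
    -- What has to be remembered is that red had no copy in the position B′ just before b.
    Done : List Triple → Set
    Done B = ∃₂ λ bs b → Σ (List Triple) λ B′ →
      B ≡ bs ++ b ∷ B′ × Contains G (_∈ b ∷ B′) × ¬ Contains G (_∈ red B′)

    State : Set
    State = Σ (List Triple) λ B → Legal B × (Inv B ⊎ Done B)

    next : (s : State) → Σ State λ s′ → Σ Triple λ b → proj₁ s′ ≡ b ∷ proj₁ s
    next (B , L , inj₁ I) with step L I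
    ... | b , bv , b∉ , inj₁ I′ = (b ∷ B , (bv , b∉) ∷ L , inj₁ I′) , b , refl
    ... | b , bv , b∉ , inj₂ C  = (b ∷ B , (bv , b∉) ∷ L , inj₂ ([] , b , B , refl , C , safe L I)) , b , refl
    next (B , L , inj₂ (bs , b , B′ , refl , C , S)) =
      (e ∷ B , (runFrom-valid _ , runFrom-∉ ≤-refl) ∷ L , inj₂ (e ∷ bs , b , B′ , refl , C , S)) , e , refl
      where e = runFrom (bound (cl B))

    state : ℕ → State
    state zero = B₀ , L₀ , inj₁ I₀
    state (suc n) = proj₁ (next (state n))

    Bs : ℕ → List Triple
    Bs n = proj₁ (state n)

    claimed : ℕ → List Triple
    claimed n = cl (Bs n)

    Bs-suc : ∀ n → Σ Triple λ b → Bs (suc n) ≡ b ∷ Bs n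
    Bs-suc n = proj₂ (next (state n))

    cl-nonempty : ∀ B → 1 ≤ length (cl B)
    cl-nonempty [] = s≤s z≤n
    cl-nonempty (b ∷ B) = s≤s z≤n

    claimed-long : ∀ n → n < length (claimed n)
    claimed-long zero = cl-nonempty B₀
    claimed-long (suc n) with Bs (suc n) | Bs-suc n
    ... | _ | b , refl = s≤s (≤-trans (claimed-long n) (n≤1+n _))

    at-grow : ∀ {i} bs B → i < length (cl B) → at i (cl (bs ++ B)) ≡ at i (cl B)
    at-grow [] B i< = refl
    at-grow {i} (b ∷ bs) B i< =
      ≡-trans (at-cons _ _ (≤-trans i<′ (n≤1+n _))) (≡-trans (at-cons _ _ i<′) (at-grow bs B i<))
      where
      le : ∀ bs → length (cl B) ≤ length (cl (bs ++ B))
      le [] = ≤-refl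
      le (b ∷ bs) = ≤-trans (le bs) (≤-trans (n≤1+n _) (n≤1+n _))
      i<′ : i < length (cl (bs ++ B))
      i<′ = ≤-trans i< (le bs)

    Bs-grow : ∀ {m n} → m ≤ n → Σ (List Triple) λ bs → Bs n ≡ bs ++ Bs m
    Bs-grow {m} {n} m≤n with m ≟ n
    ... | yes refl = [] , refl
    Bs-grow {m} {zero} z≤n | no ne = ⊥-elim (ne refl)
    Bs-grow {m} {suc n} m≤ | no ne with Bs-suc n | Bs-grow {m} {n} (s≤s⁻¹ (≤∧≢⇒< m≤ ne))
    ... | b , eq | bs , eq′ = b ∷ bs , ≡-trans eq (cong (b ∷_) eq′)

    play : Play
    play n = at n (claimed n)

    play-at : ∀ {n} k → n < length (claimed k) → play n ≡ at n (claimed k)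
    play-at {n} k n< with ≤-total n k
    ... | inj₁ n≤k with Bs-grow n≤k
    ...   | bs , eq = sym (≡-trans (cong (λ B → at n (cl B)) eq) (at-grow bs (Bs n) (claimed-long n)))
    play-at {n} k n< | inj₂ k≤n with Bs-grow k≤n
    ...   | bs , eq = ≡-trans (cong (λ B → at n (cl B)) eq) (at-grow bs (Bs k) n<)

    history-below : ∀ n k → n ≤ length (claimed k) → history play n ≡ reverse (below n (claimed k))
    history-below zero k _ = cong reverse (sym (below-0 (claimed k)))
    history-below (suc n) k n< = begin
      applyUpTo play (suc n)                       ≡⟨ sym (applyUpTo-∷ʳ play n) ⟩
      applyUpTo play n ∷ʳ play n                   ≡⟨ cong₂ _∷ʳ_ (history-below n k (<⇒≤ n<)) (play-at k n<) ⟩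
      reverse (below n C) ∷ʳ at n C                ≡⟨ sym (unfold-reverse (at n C) (below n C)) ⟩
      reverse (at n C ∷ below n C)                 ≡⟨ cong reverse (sym (below-suc C n<)) ⟩
      reverse (below (suc n) C)                    ∎
      where
      open ≡-Reasoning
      C = claimed k

    play-valid : ∀ n → ValidEdge (play n)
    play-valid n = All.lookup (cl-valid (proj₁ (proj₂ (state n))))
      (below-⊆ (claimed n) (at-∈-below (claimed n) (≤-refl {suc n}) (claimed-long n)))

    play-distinct : ∀ {i j} → i < j → play i ≢ play j
    play-distinct {i} {j} i<j eq = Unique[x∷xs]⇒x∉xs
      (subst Unique (below-suc C (claimed-long j)) (below-unique {suc j} (cl-unique (proj₁ (proj₂ (state j))))))
      (subst (_∈ below j C) (≡-trans (sym (play-at j (<-trans i<j (claimed-long j)))) eq)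
        (at-∈-below C i<j (<⇒≤ (claimed-long j))))
      where C = claimed j

    play-legal : LegalPlay play
    play-legal = play-valid , λ i j eq → inj i j eq
      where
      inj : ∀ i j → play i ≡ play j → i ≡ j
      inj i j eq with <-cmp i j
      ... | tri< i<j _ _ = ⊥-elim (play-distinct i<j eq)
      ... | tri≈ _ i≡j _ = i≡j
      ... | tri> _ _ j<i = ⊥-elim (play-distinct j<i (sym eq))

    -- Each round adds two edges. As Z has at most one edge, `length Z` is the parity of the
    -- opponent's moves and `1 ∸ length Z` that of blue's.
    cl-parity : ∀ B → length (cl B) % 2 ≡ 1 ∸ length Z
    cl-parity [] = base (length Z) Z<2
      where
      base : ∀ z → z < 2 → suc z % 2 ≡ 1 ∸ z
      base 0 _ = refl
      base 1 _ = refl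
      base (suc (suc _)) (s≤s (s≤s ()))
    cl-parity (b ∷ B) = cl-parity B

    cl-parity-≢ : ∀ B → length (cl B) % 2 ≢ length Z
    cl-parity-≢ B eq = absurd (length Z) (≡-trans (sym (cl-parity B)) eq)
      where
      absurd : ∀ z → 1 ∸ z ≢ z
      absurd (suc zero) ()

    early : ∀ {n} → n < length Z → n % 2 ≢ length Z
    early = go (length Z) Z<2
      where
      go : ∀ z {n} → z < 2 → n < z → n % 2 ≢ z
      go 1 {zero} _ _ ()
      go 1 {suc n} _ (s≤s ()) _
      go (suc (suc _)) (s≤s (s≤s ())) _ _

    opponent-at : ∀ {n} B → n < length (cl B) → n % 2 ≡ length Z →
                  at n (cl B) ∈ red B × at n (cl B) ≡ σ (reverse (below n (cl B)))
    opponent-at {n} [] n< par with n ≟ length Z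
    ... | yes refl = here refl , cong (λ L → σ (reverse L)) (sym (≡-trans (below-cons _ Z ≤-refl) (below-all Z ≤-refl)))
    ... | no ne = ⊥-elim (early (≤∧≢⇒< (s≤s⁻¹ n<) ne) par)
    opponent-at {n} (b ∷ B) n< par with n ≟ suc (length (cl B))
    ... | yes refl = here refl ,
      cong (λ L → σ (reverse L)) (sym (≡-trans (below-cons _ (b ∷ cl B) ≤-refl) (below-all (b ∷ cl B) ≤-refl)))
    ... | no ne with n ≟ length (cl B)
    ...   | yes refl = ⊥-elim (cl-parity-≢ B par)
    ...   | no ne′ = there (proj₁ rec) , ≡-trans (proj₂ rec)
            (cong (λ L → σ (reverse L)) (sym (≡-trans (below-cons _ (b ∷ cl B) (<⇒≤ (≤∧≢⇒< (s≤s⁻¹ n<) ne)))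
              (below-cons b (cl B) (s≤s⁻¹ (≤∧≢⇒< (s≤s⁻¹ n<) ne))))))
      where rec = opponent-at B (≤∧≢⇒< (s≤s⁻¹ (≤∧≢⇒< (s≤s⁻¹ n<) ne)) ne′) par

    play-follows : ∀ n → n % 2 ≡ length Z → play n ≡ σ (history play n)
    play-follows n par = ≡-trans (proj₂ (opponent-at (Bs n) (claimed-long n) par))
      (cong σ (sym (history-below n n (<⇒≤ (claimed-long n)))))

    OpponentAt OwnAt : ℕ → Triple → Set
    OpponentAt n e = Σ ℕ λ i → (i < n) × (i % 2 ≡ length Z) × (play i ≡ e)
    OwnAt n e = Σ ℕ λ i → (i < n) × (i % 2 ≡ 1 ∸ length Z) × (play i ≡ e)

    OpponentAt⇒red : ∀ {n e} bs B → Bs n ≡ bs ++ B → n ≤ length (cl B) → OpponentAt n e → e ∈ red B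
    OpponentAt⇒red {n} bs B eq n≤ (i , i<n , par , refl) =
      subst (_∈ red B) (sym (≡-trans (play-at n (<-trans i<n (claimed-long n)))
          (≡-trans (cong (λ B → at i (cl B)) eq) (at-grow bs B i<))))
        (proj₁ (opponent-at B i< par))
      where
      i< = ≤-trans i<n n≤

    own-at : ∀ {e} b B → e ∈ b ∷ B → Σ ℕ λ i → i ≤ length (cl B) × (i % 2 ≡ 1 ∸ length Z) × at i (cl (b ∷ B)) ≡ e
    own-at b B (here refl) = length (cl B) , ≤-refl , cl-parity B ,
      ≡-trans (at-cons _ (b ∷ cl B) ≤-refl) (at-head b (cl B))
    own-at b (b′ ∷ B) (there e∈) with own-at b′ B e∈
    ... | i , i≤ , par , eq = i , ≤-trans i≤ (≤-trans (n≤1+n _) (n≤1+n _)) , par ,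
      ≡-trans (at-grow (b ∷ []) (b′ ∷ B) (s≤s (≤-trans i≤ (n≤1+n _)))) eq

    -- While the invariant holds there is no red copy at all. Otherwise n is compared with the index
    -- `length (cl B′)` of the completing blue move: up to it, the red edges lie in `red B′`, which
    -- has no copy; beyond it, the blue copy is already there.
    opponent-not-first : ∀ n → Contains G (OpponentAt n) → Contains G (OwnAt n)
    opponent-not-first n C = go (proj₁ (proj₂ (state n))) (proj₂ (proj₂ (state n)))
      where
      go : Legal (Bs n) → Inv (Bs n) ⊎ Done (Bs n) → Contains G (OwnAt n)
      go L (inj₁ I) =
        ⊥-elim (safe L I (Contains-mono {G} (OpponentAt⇒red [] (Bs n) refl (<⇒≤ (claimed-long n))) C))
      go L (inj₂ (bs , b , B′ , eq , C′ , S)) with n ≤? length (cl B′)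
      ... | yes n≤ = ⊥-elim (S (Contains-mono {G}
              (OpponentAt⇒red (bs ++ b ∷ []) B′ (≡-trans eq (sym (++-assoc bs (b ∷ []) B′))) n≤) C))
      ... | no n≰ = Contains-mono {G} own C′
        where
        own : ∀ {e} → e ∈ b ∷ B′ → OwnAt n e
        own e∈ with own-at b B′ e∈
        ... | i , i≤ , par , refl = i , ≤-trans (s≤s i≤) (≰⇒> n≰) , par ,
          ≡-trans (play-at n (<-trans (≤-trans (s≤s i≤) (≰⇒> n≰)) (claimed-long n)))
            (≡-trans (cong (λ B → at i (cl B)) eq) (at-grow bs (b ∷ B′) (s≤s (≤-trans i≤ (n≤1+n _)))))

-- K_{2,n} in the link of v

record K (X : Triple → Set) : Set where
  field
    v g₁ g₂ : ℕ
    M : List ℕ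
    M-unique : Unique M
    v≢g₁ : v ≢ g₁
    v≢g₂ : v ≢ g₂
    g₁≢g₂ : g₁ ≢ g₂
    M≢v : ∀ {m} → m ∈ M → m ≢ v
    M≢g₁ : ∀ {m} → m ∈ M → m ≢ g₁
    M≢g₂ : ∀ {m} → m ∈ M → m ≢ g₂
    edge₁ : ∀ {m} → m ∈ M → X (tri v g₁ m)
    edge₂ : ∀ {m} → m ∈ M → X (tri v g₂ m)

  g₁∉edge₂ : ∀ {m} → m ∈ M → ¬ g₁ ∈ₜ tri v g₂ m
  g₁∉edge₂ m∈ = ∉-tri (≢-sym v≢g₁) g₁≢g₂ (≢-sym (M≢g₁ m∈))

  edges-disjoint : ∀ {m m′} → m ∈ M → m′ ∈ M → tri v g₁ m ≢ tri v g₂ m′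
  edges-disjoint {m} _ m′∈ eq = g₁∉edge₂ m′∈ (subst (g₁ ∈ₜ_) eq (tri₂ v g₁ m))

  edge₁-injective : InjectiveOn (tri v g₁) M
  edge₁-injective m∈ _ = tri-injective (M≢v m∈) (M≢g₁ m∈)

  edge₂-injective : InjectiveOn (tri v g₂) M
  edge₂-injective m∈ _ = tri-injective (M≢v m∈) (M≢g₂ m∈)

  count-edge₁ : ∀ {S} → (∀ {m} → m ∈ M → tri v g₁ m ∈ S) → length M ≤ length S
  count-edge₁ = count-family M-unique edge₁-injective

  count-edges : ∀ {S} → (∀ {m} → m ∈ M → tri v g₁ m ∈ S) → (∀ {m} → m ∈ M → tri v g₂ m ∈ S) →
                length M + length M ≤ length S
  count-edges = count-families M-unique M-unique edge₁-injective edge₂-injective edges-disjoint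

swapK : ∀ {X} → K X → K X
swapK k = record
  { v = v ; g₁ = g₂ ; g₂ = g₁ ; M = M ; M-unique = M-unique ; v≢g₁ = v≢g₂ ; v≢g₂ = v≢g₁ ; g₁≢g₂ = ≢-sym g₁≢g₂
  ; M≢v = M≢v ; M≢g₁ = M≢g₂ ; M≢g₂ = M≢g₁ ; edge₁ = edge₂ ; edge₂ = edge₁ }
  where open K k

another : ∀ {L} → Unique L → 2 ≤ length L → ∀ m → Σ ℕ λ m′ → m′ ∈ L × m′ ≢ m
another {x ∷ []} _ (s≤s ()) m
another {x ∷ y ∷ L} ((x≢y ∷ _) ∷ _) _ m with x ≟ m
... | no x≢m = x , here refl , x≢m
... | yes refl = y , there (here refl) , ≢-sym x≢y

module _ {X : Triple → Set} (k : K X) (R : Triple → Set) (Ys : List ℕ) (a c : ℕ) (E : Triple)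
         (split : ∀ {e} → X e → R e ⊎ (Σ ℕ λ y → y ∈ Ys × e ≡ tri a c y) ⊎ e ≡ E)
         (fresh : ∀ {e y} → R e → y ∈ Ys → ¬ y ∈ₜ e)
         (Ys≢a : ∀ {y} → y ∈ Ys → y ≢ a) (Ys≢c : ∀ {y} → y ∈ Ys → y ≢ c) where
  open K k

  private
    -- An edge at a hub determines the common neighbour, even across the two hubs, so E serves at
    -- most one of them. That one is set aside, or an arbitrary one if E serves none.
    untouched : 1 ≤ length M → Σ ℕ λ m₀ → Σ (List ℕ) λ M′ → M ↭ m₀ ∷ M′ ×
                (∀ {m} → m ∈ M′ → E ≢ tri v g₁ m × E ≢ tri v g₂ m)
    untouched 1≤ with any? (λ m → (E ≟ₜ tri v g₁ m) ⊎-dec (E ≟ₜ tri v g₂ m)) M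
    ... | yes touched with find touched
    ...   | m₀ , m₀∈ , eq with extract m₀∈
    ...     | M′ , p = m₀ , M′ , p , λ m∈ → (λ eq′ → ne m∈ eq (inj₁ eq′)) , (λ eq′ → ne m∈ eq (inj₂ eq′))
      where
      ne : ∀ {m} → m ∈ M′ → E ≡ tri v g₁ m₀ ⊎ E ≡ tri v g₂ m₀ → E ≡ tri v g₁ m ⊎ E ≡ tri v g₂ m → ⊥
      ne {m} m∈ at₀ at = Unique[x∷xs]⇒x∉xs (Unique-resp-↭ p M-unique) (subst (_∈ M′) (sym (m₀≡m at₀ at)) m∈)
        where
        m₀≡m : E ≡ tri v g₁ m₀ ⊎ E ≡ tri v g₂ m₀ → E ≡ tri v g₁ m ⊎ E ≡ tri v g₂ m → m₀ ≡ m
        m₀≡m (inj₁ p) (inj₁ q) = tri-injective (M≢v m₀∈) (M≢g₁ m₀∈) (≡-trans (sym p) q)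
        m₀≡m (inj₁ p) (inj₂ q) = tri-injective (M≢v m₀∈) (M≢g₂ m₀∈) (≡-trans (sym p) q)
        m₀≡m (inj₂ p) (inj₁ q) = tri-injective (M≢v m₀∈) (M≢g₁ m₀∈) (≡-trans (sym p) q)
        m₀≡m (inj₂ p) (inj₂ q) = tri-injective (M≢v m₀∈) (M≢g₂ m₀∈) (≡-trans (sym p) q)
    untouched 1≤ | no none = go M none 1≤
      where
      go : ∀ L → ¬ Any (λ m → E ≡ tri v g₁ m ⊎ E ≡ tri v g₂ m) L → 1 ≤ length L →
           Σ ℕ λ m₀ → Σ (List ℕ) λ M′ → L ↭ m₀ ∷ M′ × (∀ {m} → m ∈ M′ → E ≢ tri v g₁ m × E ≢ tri v g₂ m)
      go (m₀ ∷ M′) none _ = m₀ , M′ , refl , λ m∈ →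
        (λ eq → none (there (lose m∈ (inj₁ eq)))) ,
        (λ eq → none (there (lose m∈ (inj₂ eq))))

    -- Edges of R avoid y, and an answer for another y′ meets y only if y′ = y.
    same-perpetual : ∀ {e f y} → y ∈ Ys → e ≡ tri a c y → X f → f ≢ E → y ∈ₜ f → f ≡ e
    same-perpetual y∈ eq Xf f≢E y∈f with split Xf
    ... | inj₁ Rf = ⊥-elim (fresh Rf y∈ y∈f)
    ... | inj₂ (inj₂ f≡E) = ⊥-elim (f≢E f≡E)
    ... | inj₂ (inj₁ (y′ , y′∈ , refl)) with ∈-tri-third (Ys≢a y∈) (Ys≢c y∈) y∈f
    ...   | refl = sym eq

  -- A vertex of Ys occurs in a single edge tri a c y and possibly in E, so it is not a hub and is a
  -- common neighbour only if E joins it to a hub.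
  reduceK : 3 ≤ length M → Σ (K R) λ k′ → (K.v k′ ≡ v) × (K.g₁ k′ ≡ g₁) × (K.g₂ k′ ≡ g₂) × (length M ≡ suc (length (K.M k′)))
  reduceK 3≤ with untouched (≤-trans (s≤s z≤n) 3≤)
  ... | m₀ , M′ , p , ne = record
    { v = v ; g₁ = g₁ ; g₂ = g₂ ; M = M′ ; M-unique = uM′ ; v≢g₁ = v≢g₁ ; v≢g₂ = v≢g₂ ; g₁≢g₂ = g₁≢g₂
    ; M≢v = λ m∈ → M≢v (old m∈) ; M≢g₁ = λ m∈ → M≢g₁ (old m∈) ; M≢g₂ = λ m∈ → M≢g₂ (old m∈)
    ; edge₁ = e₁ ; edge₂ = e₂ } , refl , refl , refl , ↭-length p
    where
    uM′ : Unique M′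
    uM′ with Unique-resp-↭ p M-unique
    ... | _ ∷ u = u
    old : ∀ {m} → m ∈ M′ → m ∈ M
    old m∈ = ∈-resp-↭ (↭-sym p) (there m∈)
    other : ∀ {m} → m ∈ M′ → Σ ℕ λ m′ → m′ ∈ M′ × m′ ≢ m
    other {m} _ = another uM′ (s≤s⁻¹ (subst (3 ≤_) (↭-length p) 3≤)) m
    e₁ : ∀ {m} → m ∈ M′ → R (tri v g₁ m)
    e₁ {m} m∈ with split (edge₁ (old m∈))
    ... | inj₁ r = r
    ... | inj₂ (inj₂ eq) = ⊥-elim (proj₁ (ne m∈) (sym eq))
    -- If y is the centre or m, it also lies in the edge from m to the other hub; if y is the hub,
    -- it also lies in the edge to another neighbour m′. Either way one edge would be two. The m′
    -- must survive the deletion, hence `3 ≤ length M`.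
    ... | inj₂ (inj₁ (y , y∈ , eq)) with ∈-tri⁻ v g₁ m (subst (y ∈ₜ_) (sym eq) (tri₃ a c y))
    ...   | 1st refl = ⊥-elim (edges-disjoint (old m∈) (old m∈)
              (sym (same-perpetual y∈ eq (edge₂ (old m∈)) (≢-sym (proj₂ (ne m∈))) (tri₁ _ _ _))))
    ...   | 3rd refl = ⊥-elim (edges-disjoint (old m∈) (old m∈)
              (sym (same-perpetual y∈ eq (edge₂ (old m∈)) (≢-sym (proj₂ (ne m∈))) (tri₃ _ _ _))))
    ...   | 2nd refl = let m′ , m′∈ , m′≢m = other m∈ in ⊥-elim (m′≢m (edge₁-injective (old m′∈) (old m∈)
              (same-perpetual y∈ eq (edge₁ (old m′∈)) (≢-sym (proj₁ (ne m′∈))) (tri₂ _ _ _))))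
    e₂ : ∀ {m} → m ∈ M′ → R (tri v g₂ m)
    e₂ {m} m∈ with split (edge₂ (old m∈))
    ... | inj₁ r = r
    ... | inj₂ (inj₂ eq) = ⊥-elim (proj₂ (ne m∈) (sym eq))
    ... | inj₂ (inj₁ (y , y∈ , eq)) with ∈-tri⁻ v g₂ m (subst (y ∈ₜ_) (sym eq) (tri₃ a c y))
    ...   | 1st refl = ⊥-elim (edges-disjoint (old m∈) (old m∈)
              (same-perpetual y∈ eq (edge₁ (old m∈)) (≢-sym (proj₁ (ne m∈))) (tri₁ _ _ _)))
    ...   | 3rd refl = ⊥-elim (edges-disjoint (old m∈) (old m∈)
              (same-perpetual y∈ eq (edge₁ (old m∈)) (≢-sym (proj₁ (ne m∈))) (tri₃ _ _ _)))
    ...   | 2nd refl = let m′ , m′∈ , m′≢m = other m∈ in ⊥-elim (m′≢m (edge₂-injective (old m′∈) (old m∈)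
              (same-perpetual y∈ eq (edge₂ (old m′∈)) (≢-sym (proj₂ (ne m′∈))) (tri₂ _ _ _))))

-- The target and its copies

module Target (s : ℕ) where

  -- In terms of s: 1 + s = t - 2 leaves, 2 + s = t - 1, 4 + s = t + 1 mids, 5 + (s + s) = 2t - 1
  -- neighbours of `hub1`, 6 + (s + s) = 2t and 9 + (s + s + s) = 3t edges of the target.
  t : ℕ
  t = 3 + s

  G : Hypergraph3
  G = K2ts3 (suc t) (t ∸ 2)

  -- N contains the 2t - 1 neighbours of hub1 (mids and leaves) and M the t + 1 mids.
  record Copy : Set where
    field
      v g₁ g₂ : ℕ
      N M : List ℕ
      N-unique : Unique N
      M-unique : Unique M
      N-length : length N ≡ 5 + (s + s)
      M-length : length M ≡ 4 + s
      M⊆N : ∀ {m} → m ∈ M → m ∈ N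
      v≢g₁ : v ≢ g₁
      v≢g₂ : v ≢ g₂
      g₁≢g₂ : g₁ ≢ g₂
      N≢v : ∀ {m} → m ∈ N → m ≢ v
      N≢g₁ : ∀ {m} → m ∈ N → m ≢ g₁
      N≢g₂ : ∀ {m} → m ∈ N → m ≢ g₂

    Edges : Triple → Set
    Edges e = (Σ ℕ λ m → m ∈ N × e ≡ tri v g₁ m) ⊎ (Σ ℕ λ m → m ∈ M × e ≡ tri v g₂ m)

    N-injective : InjectiveOn (tri v g₁) N
    N-injective m∈ _ = tri-injective (N≢v m∈) (N≢g₁ m∈)

    M-injective : InjectiveOn (tri v g₂) M
    M-injective m∈ _ = tri-injective (N≢v (M⊆N m∈)) (N≢g₂ (M⊆N m∈))

    NM-disjoint : ∀ {m m′} → m ∈ N → m′ ∈ M → tri v g₁ m ≢ tri v g₂ m′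
    NM-disjoint {m} _ m′∈ eq =
      ∉-tri (≢-sym v≢g₁) g₁≢g₂ (≢-sym (N≢g₁ (M⊆N m′∈))) (subst (g₁ ∈ₜ_) eq (tri₂ v g₁ m))

    size≡ : length N + length M ≡ 9 + (s + s + s)
    size≡ = ≡-trans (cong₂ _+_ N-length M-length) (eq s)
      where
      eq : ∀ s → 5 + (s + s) + (4 + s) ≡ 9 + (s + s + s)
      eq = solve-∀

    module _ {S : List Triple} (sub : ∀ {e} → Edges e → e ∈ S) where

      size≤ : 9 + (s + s + s) ≤ length S
      size≤ = subst (_≤ length S) size≡
        (count-families N-unique M-unique N-injective M-injective NM-disjoint
          (λ m∈ → sub (inj₁ (_ , m∈ , refl))) (λ m∈ → sub (inj₂ (_ , m∈ , refl))))

      size-tight : length S ≤ 9 + (s + s + s) → ∀ {e} → e ∈ S → Edges e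
      size-tight le = tight-families N-unique M-unique N-injective M-injective NM-disjoint
        (λ m∈ → sub (inj₁ (_ , m∈ , refl))) (λ m∈ → sub (inj₂ (_ , m∈ , refl))) _≟ₜ_
        (subst (length S ≤_) (sym size≡) le)

    toK : {X : Triple → Set} → (∀ {e} → Edges e → X e) → K X
    toK sub = record
      { v = v ; g₁ = g₁ ; g₂ = g₂ ; M = M ; M-unique = M-unique ; v≢g₁ = v≢g₁ ; v≢g₂ = v≢g₂ ; g₁≢g₂ = g₁≢g₂
      ; M≢v = λ m∈ → N≢v (M⊆N m∈) ; M≢g₁ = λ m∈ → N≢g₁ (M⊆N m∈) ; M≢g₂ = λ m∈ → N≢g₂ (M⊆N m∈)
      ; edge₁ = λ m∈ → sub (inj₁ (_ , M⊆N m∈ , refl)) ; edge₂ = λ m∈ → sub (inj₂ (_ , m∈ , refl)) }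

  Contains⇒Copy : ∀ {X} → (∀ {e} → X e → ValidEdge e) → Contains G X →
                  Σ Copy λ C → ∀ {e} → Copy.Edges C e → X e
  Contains⇒Copy {X} valid (φ , inj , edges) = C , sub
    where
    v g₁ g₂ : ℕ
    v = φ nothing
    g₁ = φ (just hub1)
    g₂ = φ (just hub2)
    mids : Fin (suc t) → ℕ
    mids i = φ (just (mid i))
    leaves : Fin (t ∸ 2) → ℕ
    leaves j = φ (just (leaf j))
    φ≢ : ∀ {x y} → x ≢ y → φ x ≢ φ y
    φ≢ x≢y eq = x≢y (inj _ _ eq)
    N-elim : (P : ℕ → Set) → (∀ i → P (mids i)) → (∀ j → P (leaves j)) →
             ∀ {m} → m ∈ tabulate mids ++ tabulate leaves → P m
    N-elim P pm pl m∈ with ∈-++⁻ (tabulate mids) m∈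
    ... | inj₁ p = let i , eq = ∈-tabulate⁻ {f = mids} p in subst P (sym eq) (pm i)
    ... | inj₂ p = let j , eq = ∈-tabulate⁻ {f = leaves} p in subst P (sym eq) (pl j)
    mids-inj : ∀ {i j} → mids i ≡ mids j → i ≡ j
    mids-inj eq with inj _ _ eq
    ... | refl = refl
    leaves-inj : ∀ {i j} → leaves i ≡ leaves j → i ≡ j
    leaves-inj eq with inj _ _ eq
    ... | refl = refl
    C : Copy
    C = record
      { v = v ; g₁ = g₁ ; g₂ = g₂ ; N = tabulate mids ++ tabulate leaves ; M = tabulate mids
      ; N-unique = Unique-++⁺ (tabulate⁺ mids-inj) (tabulate⁺ leaves-inj) λ (p , q) →
          let i , eq = ∈-tabulate⁻ {f = mids} p ; j , eq′ = ∈-tabulate⁻ {f = leaves} q in φ≢ (λ ()) (≡-trans (sym eq) eq′)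
      ; M-unique = tabulate⁺ mids-inj
      ; N-length = ≡-trans (length-++ (tabulate mids))
          (≡-trans (cong₂ _+_ (length-tabulate mids) (length-tabulate leaves)) (eq s))
      ; M-length = length-tabulate mids
      ; M⊆N = ∈-++⁺ˡ
      ; v≢g₁ = φ≢ λ () ; v≢g₂ = φ≢ λ () ; g₁≢g₂ = φ≢ λ ()
      ; N≢v = N-elim (_≢ v) (λ _ → φ≢ λ ()) (λ _ → φ≢ λ ())
      ; N≢g₁ = N-elim (_≢ g₁) (λ _ → φ≢ λ ()) (λ _ → φ≢ λ ())
      ; N≢g₂ = N-elim (_≢ g₂) (λ _ → φ≢ λ ()) (λ _ → φ≢ λ ()) }
      where
      eq : ∀ s → 4 + s + (1 + s) ≡ 5 + (s + s)
      eq = solve-∀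
    edge : ∀ {x y} → x ≢ y → KEdge (suc t) (t ∸ 2) x y → X (tri v (φ (just x)) (φ (just y)))
    edge {x} {y} x≢y xy with edges _ _ _ (lift xy)
    ... | e , Xe , same = subst X (tri-by-members (valid Xe)
            (φ≢ λ ()) (φ≢ λ { refl → x≢y refl }) (φ≢ λ ())
            (proj₂ (same _) (3rd refl)) (proj₂ (same _) (1st refl)) (proj₂ (same _) (2nd refl))) Xe
    sub : ∀ {e} → Copy.Edges C e → X e
    sub (inj₁ (m , m∈ , refl)) = N-elim (λ m → X (tri v g₁ m)) (λ i → edge (λ ()) (e1 i)) (λ j → edge (λ ()) (e3 j)) m∈
    sub (inj₂ (m , m∈ , refl)) = let i , eq = ∈-tabulate⁻ {f = mids} m∈ in subst (λ m → X (tri v g₂ m)) (sym eq) (edge (λ ()) (e2 i))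

  enumerate : ∀ {n} (L : List ℕ) → Unique L → length L ≡ n →
              Σ (Fin n → ℕ) λ f → (∀ i j → f i ≡ f j → i ≡ j) × (∀ i → f i ∈ L)
  enumerate L u refl = lookup L , inj L u , ∈-lookup
    where
    inj : ∀ L → Unique L → ∀ i j → lookup L i ≡ lookup L j → i ≡ j
    inj (x ∷ L) u zero zero eq = refl
    inj (x ∷ L) u zero (suc j) eq = ⊥-elim (Unique[x∷xs]⇒x∉xs u (subst (_∈ L) (sym eq) (∈-lookup j)))
    inj (x ∷ L) u (suc i) zero eq = ⊥-elim (Unique[x∷xs]⇒x∉xs u (subst (_∈ L) eq (∈-lookup i)))
    inj (x ∷ L) (_ ∷ u) (suc i) (suc j) eq = cong suc (inj L u i j eq)

  -- The added vertex is placed at a, `hub1` at b and `hub2` at c; Ms become the mids and Ls the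
  -- leaves.
  book : ∀ {X a b c} (Ms Ls : List ℕ) → length Ms ≡ 4 + s → length Ls ≡ 1 + s → Unique (Ms ++ Ls) →
         a ≢ b → a ≢ c → b ≢ c → a ∉ Ms ++ Ls → b ∉ Ms ++ Ls → c ∉ Ms ++ Ls →
         (∀ {x} → x ∈ Ms ++ Ls → X (tri a b x)) → (∀ {x} → x ∈ Ms → X (tri a c x)) → Contains G X
  book {X} {a} {b} {c} Ms Ls lenM lenL u a≢b a≢c b≢c a∉ b∉ c∉ ab ac = φ , inj , edges
    where
    split : ∀ (Ms : List ℕ) → Unique (Ms ++ Ls) → Unique Ms × Unique Ls × (∀ {x} → x ∈ Ms → x ∉ Ls)
    split [] u = [] , u , λ ()
    split (m ∷ Ms) w@(_ ∷ u) =
      let uM , uL , dis = split Ms u in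
      ∉⇒All≢ (λ m∈ → Unique[x∷xs]⇒x∉xs w (∈-++⁺ˡ m∈)) ∷ uM , uL ,
      λ { (here refl) x∈ → Unique[x∷xs]⇒x∉xs w (∈-++⁺ʳ Ms x∈) ; (there p) → dis p }
    f = enumerate Ms (proj₁ (split Ms u)) lenM
    g = enumerate Ls (proj₁ (proj₂ (split Ms u))) lenL
    dis = proj₂ (proj₂ (split Ms u))
    f∈ : ∀ i → proj₁ f i ∈ Ms ++ Ls
    f∈ i = ∈-++⁺ˡ (proj₂ (proj₂ f) i)
    g∈ : ∀ j → proj₁ g j ∈ Ms ++ Ls
    g∈ j = ∈-++⁺ʳ Ms (proj₂ (proj₂ g) j)
    φ : Vtx G → ℕ
    φ nothing = a
    φ (just hub1) = b
    φ (just hub2) = c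
    φ (just (mid i)) = proj₁ f i
    φ (just (leaf j)) = proj₁ g j
    out : ∀ {x y} → x ∉ Ms ++ Ls → y ∈ Ms ++ Ls → x ≢ y
    out x∉ y∈ refl = x∉ y∈
    inj : ∀ x y → φ x ≡ φ y → x ≡ y
    inj nothing nothing _ = refl
    inj nothing (just hub1) eq = ⊥-elim (a≢b eq)
    inj nothing (just hub2) eq = ⊥-elim (a≢c eq)
    inj nothing (just (mid i)) eq = ⊥-elim (out a∉ (f∈ i) eq)
    inj nothing (just (leaf j)) eq = ⊥-elim (out a∉ (g∈ j) eq)
    inj (just hub1) nothing eq = ⊥-elim (a≢b (sym eq))
    inj (just hub1) (just hub1) _ = refl
    inj (just hub1) (just hub2) eq = ⊥-elim (b≢c eq)
    inj (just hub1) (just (mid i)) eq = ⊥-elim (out b∉ (f∈ i) eq)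
    inj (just hub1) (just (leaf j)) eq = ⊥-elim (out b∉ (g∈ j) eq)
    inj (just hub2) nothing eq = ⊥-elim (a≢c (sym eq))
    inj (just hub2) (just hub1) eq = ⊥-elim (b≢c (sym eq))
    inj (just hub2) (just hub2) _ = refl
    inj (just hub2) (just (mid i)) eq = ⊥-elim (out c∉ (f∈ i) eq)
    inj (just hub2) (just (leaf j)) eq = ⊥-elim (out c∉ (g∈ j) eq)
    inj (just (mid i)) nothing eq = ⊥-elim (out a∉ (f∈ i) (sym eq))
    inj (just (mid i)) (just hub1) eq = ⊥-elim (out b∉ (f∈ i) (sym eq))
    inj (just (mid i)) (just hub2) eq = ⊥-elim (out c∉ (f∈ i) (sym eq))
    inj (just (mid i)) (just (mid j)) eq = cong (λ i → just (mid i)) (proj₁ (proj₂ f) i j eq)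
    inj (just (mid i)) (just (leaf j)) eq = ⊥-elim (dis (proj₂ (proj₂ f) i) (subst (_∈ Ls) (sym eq) (proj₂ (proj₂ g) j)))
    inj (just (leaf i)) nothing eq = ⊥-elim (out a∉ (g∈ i) (sym eq))
    inj (just (leaf i)) (just hub1) eq = ⊥-elim (out b∉ (g∈ i) (sym eq))
    inj (just (leaf i)) (just hub2) eq = ⊥-elim (out c∉ (g∈ i) (sym eq))
    inj (just (leaf i)) (just (mid j)) eq = ⊥-elim (dis (proj₂ (proj₂ f) j) (subst (_∈ Ls) eq (proj₂ (proj₂ g) i)))
    inj (just (leaf i)) (just (leaf j)) eq = cong (λ i → just (leaf i)) (proj₁ (proj₂ g) i j eq)
    same : ∀ {p q r} → SameSet (tri p q r) (q , r , p)
    same {p} {q} {r} u = (λ u∈ → rot (∈-tri⁻ p q r u∈)) , λ u∈ → ∈-tri⁺ p q r (unrot u∈)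
      where
      rot : u ∈ₜ (p , q , r) → u ∈ₜ (q , r , p)
      rot (1st e) = 3rd e
      rot (2nd e) = 1st e
      rot (3rd e) = 2nd e
      unrot : u ∈ₜ (q , r , p) → u ∈ₜ (p , q , r)
      unrot (1st e) = 2nd e
      unrot (2nd e) = 3rd e
      unrot (3rd e) = 1st e
    edges : ∀ x y z → Edge G x y z → Σ Triple λ e → X e × SameSet e (φ x , φ y , φ z)
    edges _ _ _ (lift (e1 i)) = _ , ab (f∈ i) , same
    edges _ _ _ (lift (e2 i)) = _ , ac (proj₂ (proj₂ f) i) , same
    edges _ _ _ (lift (e3 j)) = _ , ab (g∈ j) , same

-- Edges at one pair of hubs, and the other edges that a different K_{2,n} needs

module Double (v h h′ : ℕ) where

  Third : ℕ → Set
  Third y = y ≢ v × y ≢ h × y ≢ h′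

  -- Edges through v and exactly one of h, h′. The triple {v,h,h′} is excluded, as a copy with these
  -- hubs cannot use it.
  Q : Triple → Set
  Q e = Σ ℕ λ y → Third y × (e ≡ tri v h y ⊎ e ≡ tri v h′ y)

Q-swap : ∀ {v h h′ e} → Double.Q v h h′ e → Double.Q v h′ h e
Q-swap (y , (y≢v , y≢h , y≢h′) , inj₁ eq) = y , (y≢v , y≢h′ , y≢h) , inj₂ eq
Q-swap (y , (y≢v , y≢h , y≢h′) , inj₂ eq) = y , (y≢v , y≢h′ , y≢h) , inj₁ eq

module QCount (v h h′ : ℕ) (v≢h : v ≢ h) (v≢h′ : v ≢ h′) (h≢h′ : h ≢ h′) where
  open Double v h h′

  Q-centre : ∀ {e} → Q e → v ∈ₜ e
  Q-centre (_ , _ , inj₁ refl) = tri₁ _ _ _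
  Q-centre (_ , _ , inj₂ refl) = tri₁ _ _ _

  Q-hub : ∀ {e} → Q e → h ∈ₜ e ⊎ h′ ∈ₜ e
  Q-hub (_ , _ , inj₁ refl) = inj₁ (tri₂ _ _ _)
  Q-hub (_ , _ , inj₂ refl) = inj₂ (tri₂ _ _ _)

  Q-hubs : ∀ {e} → Q e → h ∈ₜ e → ¬ h′ ∈ₜ e
  Q-hubs (_ , (_ , _ , y≢h′) , inj₁ refl) _ h′∈ = ∉-tri (≢-sym v≢h′) (≢-sym h≢h′) (≢-sym y≢h′) h′∈
  Q-hubs (_ , (_ , y≢h , _) , inj₂ refl) h∈ _ = ∉-tri (≢-sym v≢h) h≢h′ (≢-sym y≢h) h∈

  module _ {X : Triple → Set} (k : K X) (S : List Triple)
           (split : ∀ {e} → X e → K.v k ∈ₜ e → Q e ⊎ e ∈ S) where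
    open K k renaming (v to w; v≢g₁ to w≢g₁; v≢g₂ to w≢g₂; M≢v to M≢w)

    -- An edge of Q through such a w is {v,h,w} or {v,h′,w}.
    centre-elsewhere : w ≢ v → w ≢ h → w ≢ h′ → length M + length M ≤ 2 + length S
    centre-elsewhere w≢v w≢h w≢h′ = count-edges {S = tri w v h ∷ tri w v h′ ∷ S}
      (λ m∈ → put (tri-valid w≢g₁ (≢-sym (M≢g₁ m∈)) (≢-sym (M≢w m∈))) (tri₁ _ _ _) (split (edge₁ m∈) (tri₁ _ _ _)))
      (λ m∈ → put (tri-valid w≢g₂ (≢-sym (M≢g₂ m∈)) (≢-sym (M≢w m∈))) (tri₁ _ _ _) (split (edge₂ m∈) (tri₁ _ _ _)))
      where
      put : ∀ {e} → ValidEdge e → w ∈ₜ e → Q e ⊎ e ∈ S → e ∈ tri w v h ∷ tri w v h′ ∷ S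
      put _ _ (inj₂ e∈) = there (there e∈)
      put val w∈ (inj₁ q) with Q-hub q
      ... | inj₁ h∈ = here (tri-by-members val w≢v v≢h w≢h w∈ (Q-centre q) h∈)
      ... | inj₂ h′∈ = there (here (tri-by-members val w≢v v≢h′ w≢h′ w∈ (Q-centre q) h′∈))

  module _ {X : Triple → Set} (k : K X) (S : List Triple)
           (split : ∀ {e} → X e → K.v k ∈ₜ e → Q e ⊎ e ∈ S) where
    open K k renaming (v to w; v≢g₁ to w≢g₁; v≢g₂ to w≢g₂; M≢v to M≢w)

    -- Every edge of Q passes through v, which is now a hub; so none of them is at the other hub.
    count-hub-v : w ≡ h → v ≡ g₂ → length M ≤ length S
    count-hub-v refl refl = count-edge₁ λ m∈ → nonQ m∈ (split (edge₁ m∈) (tri₁ _ _ _))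
      where
      nonQ : ∀ {m} → m ∈ M → Q (tri w g₁ m) ⊎ tri w g₁ m ∈ S → tri w g₁ m ∈ S
      nonQ m∈ (inj₂ e∈) = e∈
      nonQ m∈ (inj₁ q) = ⊥-elim (∉-tri v≢h (≢-sym g₁≢g₂) (≢-sym (M≢g₂ m∈)) (Q-centre q))

    -- An edge at g₂ belongs to Q only if its neighbour is h′. For that neighbour the edge {v,h,h′}
    -- at the other hub is counted instead, which is outside Q.
    count-two-hubs : w ≡ v → g₁ ≡ h → g₂ ≢ h′ → length M ≤ length S
    count-two-hubs refl refl g₂≢h′ = count-family {f = f} M-unique f-inj f∈
      where
      f : ℕ → Triple
      f m with m ≟ h′
      ... | yes _ = tri w g₁ m
      ... | no _  = tri w g₂ m
      f-inj : InjectiveOn f M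
      f-inj {x} {y} x∈ y∈ eq with x ≟ h′ | y ≟ h′
      ... | yes _ | yes _ = edge₁-injective x∈ y∈ eq
      ... | yes _ | no _  = ⊥-elim (edges-disjoint x∈ y∈ eq)
      ... | no _  | yes _ = ⊥-elim (edges-disjoint y∈ x∈ (sym eq))
      ... | no _  | no _  = edge₂-injective x∈ y∈ eq
      f∈ : ∀ {m} → m ∈ M → f m ∈ S
      f∈ {m} m∈ with m ≟ h′
      f∈ {m} m∈ | yes refl with split (edge₁ m∈) (tri₁ _ _ _)
      ... | inj₁ q = ⊥-elim (Q-hubs q (tri₂ _ _ _) (tri₃ _ _ _))
      ... | inj₂ e∈ = e∈
      f∈ {m} m∈ | no m≢h′ with split (edge₂ m∈) (tri₁ _ _ _)
      ... | inj₂ e∈ = e∈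
      ... | inj₁ q with Q-hub q
      ...   | inj₁ h∈ = ⊥-elim (∉-tri (≢-sym v≢h) g₁≢g₂ (≢-sym (M≢g₁ m∈)) h∈)
      ...   | inj₂ h′∈ = ⊥-elim (∉-tri (≢-sym v≢h′) (≢-sym g₂≢h′) (≢-sym m≢h′) h′∈)

    -- An edge of Q must have v as its neighbour vertex, which allows one edge per hub; with two new
    -- hubs below, h and h′ allow two per hub.
    count-no-hub-v : w ≡ h → v ≢ g₁ → v ≢ g₂ → length M + length M ≤ 2 + length S
    count-no-hub-v refl v≢g₁ v≢g₂ = count-edges {S = tri w g₁ v ∷ tri w g₂ v ∷ S} put₁ put₂
      where
      put₁ : ∀ {m} → m ∈ M → tri w g₁ m ∈ tri w g₁ v ∷ tri w g₂ v ∷ S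
      put₁ m∈ with split (edge₁ m∈) (tri₁ _ _ _)
      ... | inj₂ e∈ = there (there e∈)
      ... | inj₁ q with ∈-tri-third v≢h v≢g₁ (Q-centre q)
      ...   | refl = here refl
      put₂ : ∀ {m} → m ∈ M → tri w g₂ m ∈ tri w g₁ v ∷ tri w g₂ v ∷ S
      put₂ m∈ with split (edge₂ m∈) (tri₁ _ _ _)
      ... | inj₂ e∈ = there (there e∈)
      ... | inj₁ q with ∈-tri-third v≢h v≢g₂ (Q-centre q)
      ...   | refl = there (here refl)

    count-new-hubs : w ≡ v → h ≢ g₁ → h ≢ g₂ → h′ ≢ g₁ → h′ ≢ g₂ → length M + length M ≤ 4 + length S
    count-new-hubs refl h≢g₁ h≢g₂ h′≢g₁ h′≢g₂ =
      count-edges {S = tri w g₁ h ∷ tri w g₁ h′ ∷ tri w g₂ h ∷ tri w g₂ h′ ∷ S} put₁ put₂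
      where
      put₁ : ∀ {m} → m ∈ M → tri w g₁ m ∈ tri w g₁ h ∷ tri w g₁ h′ ∷ tri w g₂ h ∷ tri w g₂ h′ ∷ S
      put₁ m∈ with split (edge₁ m∈) (tri₁ _ _ _)
      ... | inj₂ e∈ = there (there (there (there e∈)))
      ... | inj₁ q with Q-hub q
      ...   | inj₁ h∈ with ∈-tri-third (≢-sym v≢h) h≢g₁ h∈
      ...     | refl = here refl
      put₁ m∈ | inj₁ q | inj₂ h∈ with ∈-tri-third (≢-sym v≢h′) h′≢g₁ h∈
      ...     | refl = there (here refl)
      put₂ : ∀ {m} → m ∈ M → tri w g₂ m ∈ tri w g₁ h ∷ tri w g₁ h′ ∷ tri w g₂ h ∷ tri w g₂ h′ ∷ S
      put₂ m∈ with split (edge₂ m∈) (tri₁ _ _ _)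
      ... | inj₂ e∈ = there (there (there (there e∈)))
      ... | inj₁ q with Q-hub q
      ...   | inj₁ h∈ with ∈-tri-third (≢-sym v≢h) h≢g₂ h∈
      ...     | refl = there (there (here refl))
      put₂ m∈ | inj₁ q | inj₂ h∈ with ∈-tri-third (≢-sym v≢h′) h′≢g₂ h∈
      ...     | refl = there (there (there (here refl)))

module QCounts (v h h′ : ℕ) (v≢h : v ≢ h) (v≢h′ : v ≢ h′) (h≢h′ : h ≢ h′)
         {X : Triple → Set} (k : K X) (S : List Triple)
         (split : ∀ {e} → X e → K.v k ∈ₜ e → Double.Q v h h′ e ⊎ e ∈ S) where
  open K k using (g₁; g₂; M) renaming (v to w)
  private
    module A = QCount v h h′ v≢h v≢h′ h≢h′
    module B = QCount v h′ h v≢h′ v≢h (≢-sym h≢h′)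
    split′ : ∀ {e} → X e → w ∈ₜ e → Double.Q v h′ h e ⊎ e ∈ S
    split′ Xe w∈ with split Xe w∈
    ... | inj₁ q = inj₁ (Q-swap q)
    ... | inj₂ e∈ = inj₂ e∈

  centre-elsewhere : w ≢ v → w ≢ h → w ≢ h′ → length M + length M ≤ 2 + length S
  centre-elsewhere = A.centre-elsewhere k S split

  centre-hub : w ≡ h ⊎ w ≡ h′ → length M ≤ length S ⊎ length M + length M ≤ 2 + length S
  centre-hub w≡ with v ≟ g₁ | v ≟ g₂
  centre-hub (inj₁ w≡h)  | _ | yes v≡g₂ = inj₁ (A.count-hub-v k S split w≡h v≡g₂)
  centre-hub (inj₂ w≡h′) | _ | yes v≡g₂ = inj₁ (B.count-hub-v k S split′ w≡h′ v≡g₂)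
  centre-hub (inj₁ w≡h)  | yes v≡g₁ | no _ = inj₁ (A.count-hub-v (swapK k) S split w≡h v≡g₁)
  centre-hub (inj₂ w≡h′) | yes v≡g₁ | no _ = inj₁ (B.count-hub-v (swapK k) S split′ w≡h′ v≡g₁)
  centre-hub (inj₁ w≡h)  | no v≢g₁ | no v≢g₂ = inj₂ (A.count-no-hub-v k S split w≡h v≢g₁ v≢g₂)
  centre-hub (inj₂ w≡h′) | no v≢g₁ | no v≢g₂ = inj₂ (B.count-no-hub-v k S split′ w≡h′ v≢g₁ v≢g₂)

  centre-same : w ≡ v → ¬ (g₁ ≡ h × g₂ ≡ h′) → ¬ (g₁ ≡ h′ × g₂ ≡ h) →
                length M ≤ length S ⊎ length M + length M ≤ 4 + length S
  centre-same w≡v ne ne′ with h ≟ g₁ | h ≟ g₂ | h′ ≟ g₁ | h′ ≟ g₂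
  ... | yes eq | _ | _ | _ = inj₁ (A.count-two-hubs k S split w≡v (sym eq) λ eq′ → ne (sym eq , eq′))
  ... | no _ | yes eq | _ | _ = inj₁ (A.count-two-hubs (swapK k) S split w≡v (sym eq) λ eq′ → ne′ (eq′ , sym eq))
  ... | no _ | no _ | yes eq | _ = inj₁ (B.count-two-hubs k S split′ w≡v (sym eq) λ eq′ → ne′ (sym eq , eq′))
  ... | no _ | no _ | no _ | yes eq = inj₁ (B.count-two-hubs (swapK k) S split′ w≡v (sym eq) λ eq′ → ne (eq′ , sym eq))
  ... | no n₁ | no n₂ | no n₃ | no n₄ = inj₂ (A.count-new-hubs k S split w≡v n₁ n₂ n₃ n₄)

-- Choosing the centre

length-filter-exclusive : {A : Set} {P P′ : A → Set} (P? : ∀ x → Dec (P x)) (P′? : ∀ x → Dec (P′ x)) →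
  (∀ {x} → P x → ¬ P′ x) → ∀ L → length (filter P? L) + length (filter P′? L) ≤ length L
length-filter-exclusive P? P′? ex [] = z≤n
length-filter-exclusive P? P′? ex (x ∷ L) with P? x | P′? x
... | yes p | yes p′ = ⊥-elim (ex p p′)
... | yes _ | no _ = s≤s (length-filter-exclusive P? P′? ex L)
... | no _ | yes _ = subst (_≤ suc (length L)) (sym (+-suc _ _)) (s≤s (length-filter-exclusive P? P′? ex L))
... | no _ | no _ = ≤-trans (length-filter-exclusive P? P′? ex L) (n≤1+n _)

Only : ℕ → ℕ → Triple → Set
Only a b e = a ∈ₜ e × ¬ b ∈ₜ e

only? : ∀ a b e → Dec (Only a b e)
only? a b e with a ∈ₜ? e | b ∈ₜ? e
... | yes p | no q = yes (p , q)
... | yes _ | yes q = no λ (_ , n) → n q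
... | no n | _ = no λ (p , _) → n p

module Centre (s : ℕ) (R : List Triple) (R-unique : Unique R) (R-length : length R ≡ 6 + (s + s))
              (R-valid : ∀ {e} → e ∈ R → ValidEdge e) (e₁ : Triple) (e₁∈R : e₁ ∈ R) where
  open Target s

  -- One description for both places that a can have among the two hubs. `leaves` retains the
  -- asymmetry: either the other hub g is the one of degree t + 1, or the neighbours of a are among
  -- those of g.
  record HubView (a : ℕ) : Set where
    field
      v g : ℕ
      Na Ng : List ℕ
      v≢a : v ≢ a
      v≢g : v ≢ g
      a≢g : a ≢ g
      Na≢g : ∀ {m} → m ∈ Na → m ≢ g
      Ng≢a : ∀ {m} → m ∈ Ng → m ≢ a
      Ng≤ : length Ng ≤ 5 + (s + s)
      leaves : length Ng ≤ 4 + s ⊎ (∀ {m} → m ∈ Na → m ∈ Ng)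
      cover : ∀ {e} → e ∈ R → (Σ ℕ λ m → m ∈ Na × e ≡ tri v a m) ⊎ (Σ ℕ λ m → m ∈ Ng × e ≡ tri v g m)

    centre∈ : ∀ {e} → e ∈ R → v ∈ₜ e
    centre∈ e∈ with cover e∈
    ... | inj₁ (_ , _ , refl) = tri₁ _ _ _
    ... | inj₂ (_ , _ , refl) = tri₁ _ _ _

    hub∈ : ∀ {e} → e ∈ R → a ∈ₜ e ⊎ g ∈ₜ e
    hub∈ e∈ with cover e∈
    ... | inj₁ (_ , _ , refl) = inj₁ (tri₂ _ _ _)
    ... | inj₂ (_ , _ , refl) = inj₂ (tri₂ _ _ _)

    not-both : ∀ {e} → e ∈ R → a ∈ₜ e → ¬ g ∈ₜ e
    not-both e∈ a∈ g∈ with cover e∈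
    ... | inj₁ (_ , m∈ , refl) = ∉-tri (≢-sym v≢g) (≢-sym a≢g) (≢-sym (Na≢g m∈)) g∈
    ... | inj₂ (_ , m∈ , refl) = ∉-tri (≢-sym v≢a) a≢g (≢-sym (Ng≢a m∈)) a∈

  HasHub : ℕ → Set
  HasHub a = Σ Copy λ C → (∀ {e} → e ∈ R → Copy.Edges C e) × (a ≡ Copy.g₁ C ⊎ a ≡ Copy.g₂ C)

  hubView : ∀ {a} → HasHub a → HubView a
  hubView (C , R⊆ , inj₁ refl) = record
    { v = v ; g = g₂ ; Na = N ; Ng = M ; v≢a = v≢g₁ ; v≢g = v≢g₂ ; a≢g = g₁≢g₂ ; Na≢g = N≢g₂
    ; Ng≢a = λ m∈ → N≢g₁ (M⊆N m∈)
    ; Ng≤ = subst (_≤ 5 + (s + s)) (sym M-length) (s≤s (s≤s (s≤s (s≤s (≤-trans (m≤m+n s s) (n≤1+n _))))))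
    ; leaves = inj₁ (≤-reflexive M-length) ; cover = R⊆ }
    where open Copy C
  hubView (C , R⊆ , inj₂ refl) = record
    { v = v ; g = g₁ ; Na = M ; Ng = N ; v≢a = v≢g₂ ; v≢g = v≢g₁ ; a≢g = ≢-sym g₁≢g₂
    ; Na≢g = λ m∈ → N≢g₁ (M⊆N m∈) ; Ng≢a = N≢g₂ ; Ng≤ = ≤-reflexive N-length ; leaves = inj₂ M⊆N
    ; cover = λ e∈ → [ inj₂ , inj₁ ] (R⊆ e∈) }
    where open Copy C

  private
    too-short : ∀ {S} → (∀ {e} → e ∈ R → e ∈ S) → ¬ length S ≤ 5 + (s + s)
    too-short sub le = 1+n≰n (≤-trans (subst (_≤ _) R-length (Unique-⊆-length R-unique sub)) le)

  -- All 2t edges of R would be at the other hub, whose degree is at most 2t - 1.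
  unplayed-not-hub : ∀ {c} → (∀ {e} → e ∈ R → ¬ c ∈ₜ e) → ¬ HubView c
  unplayed-not-hub c∉ H = too-short {S = map (tri v g) Ng} sub (subst (_≤ _) (sym (length-map (tri v g) Ng)) Ng≤)
    where
    open HubView H
    sub : ∀ {e} → e ∈ R → e ∈ map (tri v g) Ng
    sub e∈ with cover e∈
    ... | inj₁ (_ , _ , refl) = ⊥-elim (c∉ e∈ (tri₂ _ _ _))
    ... | inj₂ (_ , m∈ , refl) = ∈-map⁺ (tri v g) m∈

  module _ {a b : ℕ} (a≢b : a ≢ b) (a∉e₁ : ¬ a ∈ₜ e₁) (b∉e₁ : ¬ b ∈ₜ e₁) where

    -- The edge e₁ contains the centre and, missing a, also the hub g. As b is not in e₁, it can
    -- only be a neighbour, with one edge to each hub.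
    at-most-two : HubView a → Σ (List Triple) λ L → length L ≡ 2 × (∀ {e} → e ∈ R → b ∈ₜ e → e ∈ L)
    at-most-two H = tri v a b ∷ tri v g b ∷ [] , refl , sub
      where
      open HubView H
      b≢v : b ≢ v
      b≢v refl = b∉e₁ (centre∈ e₁∈R)
      b≢g : b ≢ g
      b≢g refl with hub∈ e₁∈R
      ... | inj₁ a∈ = a∉e₁ a∈
      ... | inj₂ g∈ = b∉e₁ g∈
      sub : ∀ {e} → e ∈ R → b ∈ₜ e → e ∈ tri v a b ∷ tri v g b ∷ []
      sub e∈ b∈ with cover e∈
      sub e∈ b∈ | inj₁ (_ , _ , refl) with ∈-tri-third b≢v (≢-sym a≢b) b∈
      ... | refl = here refl
      sub e∈ b∈ | inj₂ (_ , _ , refl) with ∈-tri-third b≢v b≢g b∈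
      ... | refl = there (here refl)

    -- The two views may come from different copies, but both cover R. In each case this confines
    -- the 2t edges of R to fewer than 2t triples: two centres leave one hub or two triples, and one
    -- centre with distinct further hubs g, g′ leaves four.
    not-both-hubs : HubView a → HubView b → ⊥
    not-both-hubs H H′ with HubView.v H ≟ HubView.v H′
    ... | no v≢v′ = two-centres
      where
      open HubView H
      open HubView H′ using () renaming (v to v′; centre∈ to centre′∈)
      two-centres : ⊥
      two-centres with v′ ≟ g
      ... | yes refl = too-short {S = map (tri v g) Ng} sub (subst (_≤ _) (sym (length-map (tri v g) Ng)) Ng≤)
        where
        sub : ∀ {e} → e ∈ R → e ∈ map (tri v g) Ng
        sub e∈ with cover e∈
        ... | inj₁ (_ , _ , refl) = ⊥-elim (not-both e∈ (tri₂ _ _ _) (centre′∈ e∈))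
        ... | inj₂ (_ , m∈ , refl) = ∈-map⁺ (tri v g) m∈
      ... | no v′≢g = too-short {S = tri v a v′ ∷ tri v g v′ ∷ []} sub (s≤s (s≤s z≤n))
        where
        v′≢a : v′ ≢ a
        v′≢a refl = a∉e₁ (centre′∈ e₁∈R)
        sub : ∀ {e} → e ∈ R → e ∈ tri v a v′ ∷ tri v g v′ ∷ []
        sub e∈ with cover e∈ | centre′∈ e∈
        ... | inj₁ (_ , _ , refl) | v′∈ with ∈-tri-third (≢-sym v≢v′) v′≢a v′∈
        ...   | refl = here refl
        sub e∈ | inj₂ (_ , _ , refl) | v′∈ with ∈-tri-third (≢-sym v≢v′) v′≢g v′∈
        ...   | refl = there (here refl)
    ... | yes refl = one-centre
      where
      open HubView H
      open HubView H′ using () renaming (g to g′; hub∈ to hub′∈; not-both to not-both′; v≢a to v≢b; v≢g to v≢g′)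
      g∈e₁ : g ∈ₜ e₁
      g∈e₁ with hub∈ e₁∈R
      ... | inj₁ a∈ = ⊥-elim (a∉e₁ a∈)
      ... | inj₂ g∈ = g∈
      g′∈e₁ : g′ ∈ₜ e₁
      g′∈e₁ with hub′∈ e₁∈R
      ... | inj₁ b∈ = ⊥-elim (b∉e₁ b∈)
      ... | inj₂ g∈ = g∈
      g≢b : g ≢ b
      g≢b refl = b∉e₁ g∈e₁
      a≢g′ : a ≢ g′
      a≢g′ refl = a∉e₁ g′∈e₁
      one-centre : ⊥
      one-centre with g ≟ g′
      ... | no g≢g′ = too-short {S = tri v a b ∷ tri v a g′ ∷ tri v g b ∷ tri v g g′ ∷ []} sub (s≤s (s≤s (s≤s (s≤s z≤n))))
        where
        sub : ∀ {e} → e ∈ R → e ∈ tri v a b ∷ tri v a g′ ∷ tri v g b ∷ tri v g g′ ∷ []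
        sub e∈ with hub∈ e∈ | hub′∈ e∈
        ... | inj₁ p | inj₁ q = here (tri-by-members (R-valid e∈) v≢a a≢b v≢b (centre∈ e∈) p q)
        ... | inj₁ p | inj₂ q = there (here (tri-by-members (R-valid e∈) v≢a a≢g′ v≢g′ (centre∈ e∈) p q))
        ... | inj₂ p | inj₁ q = there (there (here (tri-by-members (R-valid e∈) v≢g g≢b v≢b (centre∈ e∈) p q)))
        ... | inj₂ p | inj₂ q = there (there (there (here (tri-by-members (R-valid e∈) v≢g g≢g′ v≢g′ (centre∈ e∈) p q))))
      ... | yes refl = finish leaves
        where
        third-b : ∀ {m} → tri v a m ∈ R → m ≡ b
        third-b e∈ with hub′∈ e∈
        ... | inj₁ b∈ = sym (∈-tri-third (≢-sym v≢b) (≢-sym a≢b) b∈)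
        ... | inj₂ g∈ = ⊥-elim (not-both e∈ (tri₂ _ _ _) g∈)
        -- With g shared, the only possible edge of R at a is {v,a,b}, and {v,g,b} is not in R. If g
        -- has large degree, either b is no neighbour of g and {v,a,b} drops out, or {v,a,b} merely
        -- replaces {v,g,b}.
        finish : length Ng ≤ 4 + s ⊎ (∀ {m} → m ∈ Na → m ∈ Ng) → ⊥
        finish (inj₁ small) = too-short {S = tri v a b ∷ map (tri v g) Ng} sub
          (s≤s (subst (_≤ 4 + (s + s)) (sym (length-map (tri v g) Ng)) (≤-trans small (+-monoʳ-≤ 4 (m≤m+n s s)))))
          where
          sub : ∀ {e} → e ∈ R → e ∈ tri v a b ∷ map (tri v g) Ng
          sub e∈ with cover e∈
          ... | inj₂ (_ , m∈ , refl) = there (∈-map⁺ (tri v g) m∈)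
          ... | inj₁ (_ , _ , refl) with third-b e∈
          ...   | refl = here refl
        finish (inj₂ Na⊆Ng) with any? (b ≟_) Ng
        ... | no b∉ = too-short {S = map (tri v g) Ng} sub (subst (_≤ _) (sym (length-map (tri v g) Ng)) Ng≤)
          where
          sub : ∀ {e} → e ∈ R → e ∈ map (tri v g) Ng
          sub e∈ with cover e∈
          ... | inj₂ (_ , m∈ , refl) = ∈-map⁺ (tri v g) m∈
          ... | inj₁ (_ , m∈ , refl) with third-b e∈
          ...   | refl = ⊥-elim (b∉ (Na⊆Ng m∈))
        ... | yes b∈Ng with extract b∈Ng
        ...   | L , p = too-short {S = tri v a b ∷ map (tri v g) L} sub
                  (subst (_≤ _) (≡-trans (↭-length p) (cong suc (sym (length-map (tri v g) L)))) Ng≤)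
          where
          sub : ∀ {e} → e ∈ R → e ∈ tri v a b ∷ map (tri v g) L
          sub e∈ with cover e∈
          sub e∈ | inj₁ (_ , _ , refl) with third-b e∈
          ... | refl = here refl
          sub e∈ | inj₂ (m , m∈ , refl) = there (∈-map⁺ (tri v g) (∈-strict (∈-resp-↭ p m∈)
            λ { refl → not-both′ e∈ (tri₃ _ _ _) (tri₂ _ _ _) }))

  -- The bound t - 1 on the edges at a avoiding b decides the critical count in `hubs-ac`; `not-hub`
  -- yields a ≢ h and a ≢ h′ when the edges turn out to be `Doubled`.
  record GoodCentre (a b : ℕ) : Set where
    field
      A₁ : List Triple
      A₁-length : length A₁ ≤ 2 + s
      A₁-all : ∀ {e} → e ∈ R → a ∈ₜ e → ¬ b ∈ₜ e → e ∈ A₁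
      not-hub : ¬ HasHub a

  module _ (R′ : List Triple) (R′-length : length R′ ≡ 5 + (s + s)) (R-split : ∀ {e} → e ∈ R → e ≡ e₁ ⊎ e ∈ R′)
           {a b : ℕ} (a≢b : a ≢ b) (a∉e₁ : ¬ a ∈ₜ e₁) (b∉e₁ : ¬ b ∈ₜ e₁) where

    private
      few : ∀ {a b} → a ≢ b → ¬ a ∈ₜ e₁ → ¬ b ∈ₜ e₁ → HasHub a → GoodCentre b a
      few a≢b a∉ b∉ H with at-most-two a≢b a∉ b∉ (hubView H)
      ... | L , len , all = record
        { A₁ = L ; A₁-length = subst (_≤ 2 + s) (sym len) (s≤s (s≤s z≤n)) ; A₁-all = λ e∈ b∈ _ → all e∈ b∈
        ; not-hub = λ H′ → not-both-hubs a≢b a∉ b∉ (hubView H) (hubView H′) }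

    good : ∀ a b → ¬ a ∈ₜ e₁ → ¬ HasHub a → length (filter (only? a b) R′) ≤ 2 + s → GoodCentre a b
    good a b a∉ nh le = record
      { A₁ = filter (only? a b) R′ ; A₁-length = le ; A₁-all = all ; not-hub = nh }
      where
      all : ∀ {e} → e ∈ R → a ∈ₜ e → ¬ b ∈ₜ e → e ∈ filter (only? a b) R′
      all e∈ a∈ b∉ with R-split e∈
      ... | inj₁ refl = ⊥-elim (a∉ a∈)
      ... | inj₂ e∈′ = ∈-filter⁺ (only? a b) e∈′ (a∈ , b∉)

    -- If one of them can be a hub, the other has at most two edges and cannot be a hub. If neither
    -- can, the 2t - 1 edges of R′ do not suffice for t edges at a only and t at b only.
    choose : Dec (HasHub a) → Dec (HasHub b) → GoodCentre a b ⊎ GoodCentre b a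
    choose (yes H) _ = inj₂ (few a≢b a∉e₁ b∉e₁ H)
    choose (no _) (yes H) = inj₁ (few (≢-sym a≢b) b∉e₁ a∉e₁ H)
    choose (no na) (no nb) with length (filter (only? a b) R′) ≤? 2 + s | length (filter (only? b a) R′) ≤? 2 + s
    ... | yes le | _ = inj₁ (good a b a∉e₁ na le)
    ... | no _ | yes le = inj₂ (good b a b∉e₁ nb le)
    ... | no n | no n′ = ⊥-elim (1+n≰n (≤-trans (≤-trans (≤-reflexive (eq s)) (+-mono-≤ (≰⇒> n) (≰⇒> n′)))
            (≤-trans (length-filter-exclusive (only? a b) (only? b a) (λ (p , _) (_ , n) → n p) R′) (≤-reflexive R′-length))))
      where
      eq : ∀ s → 6 + (s + s) ≡ 3 + s + (3 + s)
      eq = solve-∀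

-- Red during the perpetual threats, when blue has not defended: R are the first 2t edges, F and the
-- tri a c x with x in Bk the next t, the tri a c y with y in Ys the forced answers, E the latest edge.
module RaceSafety (s a b c : ℕ) (a≢b : a ≢ b) (a≢c : a ≢ c) (b≢c : b ≢ c)
  (R₁ : Triple → Set) (R R′ A₁ : List Triple) (e₁ F E : Triple) (Bk Ys : List ℕ) (x₁ : ℕ)
  (R₁-split : ∀ {e} → R₁ e → e ∈ R ⊎ (Σ ℕ λ x → x ∈ Bk × e ≡ tri a c x) ⊎ e ≡ F)
  (R⊆R₁ : ∀ {e} → e ∈ R → R₁ e) (R-valid : ∀ {e} → e ∈ R → ValidEdge e)
  (e₁∈R : e₁ ∈ R) (R-split : ∀ {e} → e ∈ R → e ≡ e₁ ⊎ e ∈ R′) (R′-length : length R′ ≡ 5 + (s + s))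
  (A₁-length : length A₁ ≤ 2 + s) (A₁-all : ∀ {e} → e ∈ R → a ∈ₜ e → ¬ b ∈ₜ e → e ∈ A₁)
  (c∉R : ∀ {e} → e ∈ R → ¬ c ∈ₜ e) (a∉e₁ : ¬ a ∈ₜ e₁)
  (Bk-length : length Bk ≡ 2 + s)
  (Bk∉e₁ : ∀ {x} → x ∈ Bk → ¬ x ∈ₜ e₁) (Bk≢b : ∀ {x} → x ∈ Bk → x ≢ b) (Bk-ab : ∀ {x} → x ∈ Bk → ¬ R₁ (tri a b x))
  (x₁≢a : x₁ ≢ a) (x₁≢b : x₁ ≢ b) (x₁-ab : ¬ R₁ (tri a b x₁)) (x₁-ac : ¬ R₁ (tri a c x₁))
  (danger : (Σ Triple λ e → e ∈ R × a ∈ₜ e × x₁ ∈ₜ e) ⊎ (∀ {e x} → e ∈ R → x ∈ Bk → a ∈ₜ e → ¬ x ∈ₜ e))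
  (Ys-fresh : ∀ {e y} → R₁ e → y ∈ Ys → ¬ y ∈ₜ e)
  (Ys≢a : ∀ {y} → y ∈ Ys → y ≢ a) (Ys≢b : ∀ {y} → y ∈ Ys → y ≢ b) (Ys≢c : ∀ {y} → y ∈ Ys → y ≢ c)
  where
  open Target s

  private
    acBk : List Triple
    acBk = map (tri a c) Bk

    acBk-length : length acBk ≡ 2 + s
    acBk-length = ≡-trans (length-map (tri a c) Bk) Bk-length

    8+2s<size : ¬ 9 + (s + s + s) ≤ 8 + (s + s)
    8+2s<size = <⇒≱ (m≤m+n (9 + (s + s)) s)

    8+s<size : ¬ 9 + (s + s + s) ≤ 8 + s
    8+s<size = <⇒≱ (+-monoʳ-≤ 9 (≤-trans (m≤n+m s s) (m≤m+n (s + s) s)))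

  -- Only F and the t - 1 edges to Bk can contain c, against the 2t edges of a K_{2,t}.
  centre-c : (k : K R₁) → K.v k ≡ c → length (K.M k) ≡ 3 + s → ⊥
  centre-c k refl len = <⇒≱ bound′ (count-edges {S = F ∷ acBk} (λ m∈ → put (tri₁ _ _ _) (edge₁ m∈)) (λ m∈ → put (tri₁ _ _ _) (edge₂ m∈)))
    where
    open K k
    put : ∀ {e} → c ∈ₜ e → R₁ e → e ∈ F ∷ acBk
    put c∈ r with R₁-split r
    ... | inj₁ e∈ = ⊥-elim (c∉R e∈ c∈)
    ... | inj₂ (inj₁ (x , x∈ , refl)) = there (∈-map⁺ (tri a c) x∈)
    ... | inj₂ (inj₂ refl) = here refl
    bound′ : length (F ∷ acBk) < length M + length M
    bound′ rewrite len | acBk-length = s≤s (s≤s (s≤s (≤-trans (≤-trans (n≤1+n _) (n≤1+n _)) (m≤n+m (3 + s) s))))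

  hubs-ac : (k : K R₁) → K.v k ≡ a → K.g₁ k ≡ c → length (K.M k) ≡ 3 + s → ⊥
  hubs-ac k refl refl len with K.g₂ k ≟ b
  -- With b as the other hub no neighbour lies in Bk, since {a,b,x} is not red for those x. So every
  -- edge at c is F.
  ... | yes refl = <⇒≱ (subst (1 <_) (sym len) (s≤s (s≤s z≤n))) (count-edge₁ {S = F ∷ []} put)
    where
    open K k
    put : ∀ {m} → m ∈ M → tri a c m ∈ F ∷ []
    put m∈ with R₁-split (edge₁ m∈)
    ... | inj₁ e∈ = ⊥-elim (c∉R e∈ (tri₂ _ _ _))
    ... | inj₂ (inj₂ refl) = here refl
    ... | inj₂ (inj₁ (x , x∈ , eq)) with tri-injective (M≢v m∈) (M≢g₁ m∈) eq
    ...   | refl = ⊥-elim (Bk-ab x∈ (edge₂ m∈))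
  ... | no g≢b = race danger
    where
    open K k
    in-ac : ∀ {m} → m ∈ M → m ∈ Bk ⊎ tri a c m ≡ F
    in-ac m∈ with R₁-split (edge₁ m∈)
    ... | inj₁ e∈ = ⊥-elim (c∉R e∈ (tri₂ _ _ _))
    ... | inj₂ (inj₂ eq) = inj₂ eq
    ... | inj₂ (inj₁ (x , x∈ , eq)) with tri-injective (M≢v m∈) (M≢g₁ m∈) eq
    ...   | refl = inj₁ x∈
    in-ag : ∀ {m} → m ∈ M → tri a g₂ m ∈ R ⊎ tri a g₂ m ≡ F
    in-ag m∈ with R₁-split (edge₂ m∈)
    ... | inj₁ e∈ = inj₁ e∈
    ... | inj₂ (inj₂ eq) = inj₂ eq
    ... | inj₂ (inj₁ (x , x∈ , eq)) = ⊥-elim (g₁∉edge₂ m∈ (subst (c ∈ₜ_) (sym eq) (tri₂ _ _ _)))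
    race : _ → ⊥
    -- No x in Bk has a red edge of R at a, so each common neighbour needs F at one of the hubs, but
    -- F serves only one. The 0 merely asks for some element of M.
    race (inj₂ none) = meet (another M-unique (subst (2 ≤_) (sym len) (s≤s (s≤s z≤n))) 0)
      where
      m∈F : ∀ {m} → m ∈ M → Σ ℕ λ g → (g ≡ c ⊎ g ≡ g₂) × tri a g m ≡ F
      m∈F m∈ with in-ac m∈ | in-ag m∈
      ... | inj₂ eq | _ = c , inj₁ refl , eq
      ... | inj₁ _ | inj₂ eq = g₂ , inj₂ refl , eq
      ... | inj₁ x∈ | inj₁ e∈ = ⊥-elim (none e∈ x∈ (tri₁ _ _ _) (tri₃ _ _ _))
      meet : (Σ ℕ λ m → m ∈ M × m ≢ 0) → ⊥
      meet (m , m∈ , _) with another M-unique (subst (2 ≤_) (sym len) (s≤s (s≤s z≤n))) m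
      ... | m′ , m′∈ , m′≢m with m∈F m∈ | m∈F m′∈
      ...   | g , hub , eq | _ , _ , eq′ = m′≢m (tri-injective (M≢v m′∈) (m′≢g hub) (≡-trans eq′ (sym eq)))
        where
        m′≢g : g ≡ c ⊎ g ≡ g₂ → m′ ≢ g
        m′≢g (inj₁ refl) = M≢g₁ m′∈
        m′≢g (inj₂ refl) = M≢g₂ m′∈
    -- 2t distinct edges among F, the t - 1 edges to Bk and the at most t - 1 of A₁. An edge from g₂
    -- to the neighbour b is not covered by A₁; D stands in for it.
    race (inj₁ (D , D∈ , a∈D , x₁∈D)) = <⇒≱ short
      (count-families {f = tri a c} {g = f} {ys = F ∷ acBk ++ A₁} M-unique M-unique edge₁-injective f-inj dis ac∈ f∈)
      where
      b∉D : ¬ b ∈ₜ D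
      b∉D b∈ = x₁-ab (subst R₁ (tri-by-members (R-valid D∈) a≢b (≢-sym x₁≢b) (≢-sym x₁≢a) a∈D b∈ x₁∈D) (R⊆R₁ D∈))
      f : ℕ → Triple
      f m with m ≟ b
      ... | yes _ = D
      ... | no _ = tri a g₂ m
      -- If b is a common neighbour then x₁ is neither one (tri a c x₁ is not red) nor the hub g₂
      -- (tri a b x₁ is not red), so D is a further edge at a.
      D-new : ∀ {m} → b ∈ M → m ∈ M → D ≢ tri a g₂ m
      D-new {m} b∈ m∈ refl with ∈-tri⁻ a g₂ m x₁∈D
      ... | 1st eq = x₁≢a eq
      ... | 3rd refl = x₁-ac (edge₁ m∈)
      ... | 2nd refl = x₁-ab (subst R₁ (tri-by-members
              (tri-valid v≢g₂ (≢-sym (M≢g₂ b∈)) a≢b) a≢b (≢-sym x₁≢b) (≢-sym x₁≢a)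
              (tri₁ _ _ _) (tri₃ _ _ _) (tri₂ _ _ _)) (edge₂ b∈))
      f-inj : InjectiveOn f M
      f-inj {x} {y} x∈ y∈ eq with x ≟ b | y ≟ b
      ... | yes refl | yes refl = refl
      ... | yes refl | no _ = ⊥-elim (D-new x∈ y∈ eq)
      ... | no _ | yes refl = ⊥-elim (D-new y∈ x∈ (sym eq))
      ... | no _ | no _ = edge₂-injective x∈ y∈ eq
      dis : ∀ {x y} → x ∈ M → y ∈ M → tri a c x ≢ f y
      dis {x} {y} x∈ y∈ eq with y ≟ b
      ... | yes _ = c∉R D∈ (subst (c ∈ₜ_) eq (tri₂ _ _ _))
      ... | no _ = edges-disjoint x∈ y∈ eq
      ac∈ : ∀ {m} → m ∈ M → tri a c m ∈ F ∷ acBk ++ A₁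
      ac∈ m∈ with in-ac m∈
      ... | inj₁ x∈ = there (∈-++⁺ˡ (∈-map⁺ (tri a c) x∈))
      ... | inj₂ eq = here eq
      f∈ : ∀ {m} → m ∈ M → f m ∈ F ∷ acBk ++ A₁
      f∈ {m} m∈ with m ≟ b
      ... | yes _ = there (∈-++⁺ʳ acBk (A₁-all D∈ a∈D b∉D))
      ... | no m≢b with in-ag m∈
      ...   | inj₁ e∈ = there (∈-++⁺ʳ acBk (A₁-all e∈ (tri₁ _ _ _) (∉-tri (≢-sym a≢b) (≢-sym g≢b) (≢-sym m≢b))))
      ...   | inj₂ eq = here eq
      short : length (F ∷ acBk ++ A₁) < length M + length M
      short rewrite length-++ acBk {A₁} | acBk-length | len =
        ≤-trans (≤-reflexive (eq s (length A₁))) (+-monoʳ-≤ (3 + s) (s≤s A₁-length))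
        where
        eq : ∀ s n → 2 + (2 + s + n) ≡ (3 + s) + (1 + n)
        eq = solve-∀

  module _ {X : Triple → Set}
    (X-split : ∀ {e} → X e → R₁ e ⊎ (Σ ℕ λ y → y ∈ Ys × e ≡ tri a c y) ⊎ e ≡ E)
    (C : Copy) (C⊆X : ∀ {e} → Copy.Edges C e → X e) where
    open Copy C renaming (v to w; v≢g₁ to w≢g₁; v≢g₂ to w≢g₂; N≢v to N≢w)

    private
      reduced = reduceK (toK C⊆X) R₁ Ys a c E X-split Ys-fresh Ys≢a Ys≢c (subst (3 ≤_) (sym M-length) (s≤s (s≤s (s≤s z≤n))))

      k : K R₁
      k = proj₁ reduced

      k-length : length (K.M k) ≡ 3 + s
      k-length = suc-injective (≡-trans (sym (proj₂ (proj₂ (proj₂ (proj₂ reduced))))) M-length)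

      data Kind (e : Triple) : Set where
        in-R : e ∈ R → Kind e
        ac   : ∀ z → z ∈ Bk ⊎ z ∈ Ys → e ≡ tri a c z → Kind e
        is-F : e ≡ F → Kind e
        is-E : e ≡ E → Kind e

      kind : ∀ {e} → Edges e → Kind e
      kind e∈ with X-split (C⊆X e∈)
      ... | inj₂ (inj₂ eq) = is-E eq
      ... | inj₂ (inj₁ (y , y∈ , eq)) = ac y (inj₂ y∈) eq
      ... | inj₁ r with R₁-split r
      ...   | inj₁ e∈R = in-R e∈R
      ...   | inj₂ (inj₁ (x , x∈ , eq)) = ac x (inj₁ x∈) eq
      ...   | inj₂ (inj₂ eq) = is-F eq

      centre∈ : ∀ {e} → Edges e → w ∈ₜ e
      centre∈ (inj₁ (_ , _ , refl)) = tri₁ _ _ _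
      centre∈ (inj₂ (_ , _ , refl)) = tri₁ _ _ _

    -- Only z = w puts {a,c,z} through w. Together with R, F and E this would allow 2t + 3 edges,
    -- just enough for t = 3. The edge e₁ saves one: if it contains w, then w is none of the z;
    -- otherwise e₁ is not in the copy.
    centre-outside : w ≢ a → w ≢ c → ⊥
    centre-outside w≢a w≢c with w ∈ₜ? e₁
    ... | yes w∈e₁ = 8+2s<size (subst (9 + (s + s + s) ≤_) (cong (3 +_) R′-length) (size≤ {S = e₁ ∷ F ∷ E ∷ R′} put))
      where
      put : ∀ {e} → Edges e → e ∈ e₁ ∷ F ∷ E ∷ R′
      put e∈ with kind e∈
      ... | is-F refl = there (here refl)
      ... | is-E refl = there (there (here refl))
      ... | in-R r with R-split r
      ...   | inj₁ refl = here refl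
      ...   | inj₂ r′ = there (there (there r′))
      put e∈ | ac z z∈ refl with ∈-tri-third w≢a w≢c (centre∈ e∈)
      put e∈ | ac z (inj₁ z∈) refl | refl = ⊥-elim (Bk∉e₁ z∈ w∈e₁)
      put e∈ | ac z (inj₂ z∈) refl | refl = ⊥-elim (Ys-fresh (R⊆R₁ e₁∈R) z∈ w∈e₁)
    ... | no w∉e₁ = 8+2s<size (subst (9 + (s + s + s) ≤_) (cong (3 +_) R′-length) (size≤ {S = F ∷ E ∷ tri a c w ∷ R′} put))
      where
      put : ∀ {e} → Edges e → e ∈ F ∷ E ∷ tri a c w ∷ R′
      put e∈ with kind e∈
      ... | is-F refl = here refl
      ... | is-E refl = there (here refl)
      ... | in-R r with R-split r
      ...   | inj₁ refl = ⊥-elim (w∉e₁ (centre∈ e∈))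
      ...   | inj₂ r′ = there (there (there r′))
      put e∈ | ac z z∈ refl with ∈-tri-third w≢a w≢c (centre∈ e∈)
      ... | refl = there (there (here refl))

    private
      -- As c is not a hub, it is the neighbour in such an edge, and z must be the hub.
      ac-edge : w ≡ a → g₁ ≢ c → g₂ ≢ c → ∀ {e z} → Edges e → e ≡ tri a c z →
                (z ≡ g₁ × e ≡ tri a c g₁) ⊎ (z ≡ g₂ × e ≡ tri a c g₂)
      ac-edge refl g₁≢c g₂≢c (inj₁ (m , m∈ , refl)) eq
        with ∈-tri-third (≢-sym w≢g₁) g₁≢c (subst (g₁ ∈ₜ_) eq (tri₂ _ _ _))
      ... | refl = inj₁ (refl , eq)
      ac-edge refl g₁≢c g₂≢c (inj₂ (m , m∈ , refl)) eq
        with ∈-tri-third (≢-sym w≢g₂) g₂≢c (subst (g₂ ∈ₜ_) eq (tri₂ _ _ _))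
      ... | refl = inj₂ (refl , eq)

      in-R′ : w ≡ a → ∀ {e} → Edges e → e ∈ R → e ∈ R′
      in-R′ refl e∈ r with R-split r
      ... | inj₁ refl = ⊥-elim (a∉e₁ (centre∈ e∈))
      ... | inj₂ r′ = r′

      ≢b : ∀ {z} → z ∈ Bk ⊎ z ∈ Ys → z ≢ b
      ≢b (inj₁ z∈) = Bk≢b z∈
      ≢b (inj₂ z∈) = Ys≢b z∈

    -- If b is a hub, there is one edge at c at most, and e₁ drops out because it misses a. If not,
    -- each hub has one edge to c and one to b at most; F, E and A₁ then give 8 + s edges in all.
    hub-not-c : w ≡ a → g₁ ≢ c → g₂ ≢ c → ⊥
    hub-not-c refl g₁≢c g₂≢c with g₁ ≟ b | g₂ ≟ b
    ... | yes refl | _ = 8+2s<size (subst (9 + (s + s + s) ≤_) (cong (3 +_) R′-length) (size≤ {S = F ∷ E ∷ tri a c g₂ ∷ R′} put))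
      where
      put : ∀ {e} → Edges e → e ∈ F ∷ E ∷ tri a c g₂ ∷ R′
      put e∈ with kind e∈
      ... | is-F refl = here refl
      ... | is-E refl = there (here refl)
      ... | in-R r = there (there (there (in-R′ refl e∈ r)))
      ... | ac z z∈ eq with ac-edge refl g₁≢c g₂≢c e∈ eq
      ...   | inj₁ (z≡b , _) = ⊥-elim (≢b z∈ z≡b)
      ...   | inj₂ (_ , eq′) = there (there (here eq′))
    ... | no _ | yes refl = 8+2s<size (subst (9 + (s + s + s) ≤_) (cong (3 +_) R′-length) (size≤ {S = F ∷ E ∷ tri a c g₁ ∷ R′} put))
      where
      put : ∀ {e} → Edges e → e ∈ F ∷ E ∷ tri a c g₁ ∷ R′
      put e∈ with kind e∈
      ... | is-F refl = here refl
      ... | is-E refl = there (here refl)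
      ... | in-R r = there (there (there (in-R′ refl e∈ r)))
      ... | ac z z∈ eq with ac-edge refl g₁≢c g₂≢c e∈ eq
      ...   | inj₁ (_ , eq′) = there (there (here eq′))
      ...   | inj₂ (z≡b , _) = ⊥-elim (≢b z∈ z≡b)
    ... | no g₁≢b | no g₂≢b = 8+s<size (≤-trans (size≤ {S = S} put) (+-monoʳ-≤ 6 A₁-length))
      where
      S = tri a c g₁ ∷ tri a c g₂ ∷ tri a g₁ b ∷ tri a g₂ b ∷ F ∷ E ∷ A₁
      at-b : ∀ {e} → Edges e → b ∈ₜ e → e ∈ S
      at-b (inj₁ (m , m∈ , refl)) b∈ with ∈-tri-third (≢-sym a≢b) (≢-sym g₁≢b) b∈
      ... | refl = there (there (here refl))
      at-b (inj₂ (m , m∈ , refl)) b∈ with ∈-tri-third (≢-sym a≢b) (≢-sym g₂≢b) b∈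
      ... | refl = there (there (there (here refl)))
      put : ∀ {e} → Edges e → e ∈ S
      put {e} e∈ with kind e∈
      ... | is-F refl = there (there (there (there (here refl))))
      ... | is-E refl = there (there (there (there (there (here refl)))))
      ... | ac z z∈ eq with ac-edge refl g₁≢c g₂≢c e∈ eq
      ...   | inj₁ (_ , eq′) = here eq′
      ...   | inj₂ (_ , eq′) = there (here eq′)
      put {e} e∈ | in-R r with b ∈ₜ? e
      ... | yes b∈ = at-b e∈ b∈
      ... | no b∉ = there (there (there (there (there (there (A₁-all r (centre∈ e∈) b∉))))))

    race-safe : ⊥
    race-safe with w ≟ a | w ≟ c | g₁ ≟ c | g₂ ≟ c
    ... | no w≢a | no w≢c | _ | _ = centre-outside w≢a w≢c
    ... | no _ | yes w≡c | _ | _ = centre-c k w≡c k-length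
    ... | yes w≡a | _ | yes g₁≡c | _ = hubs-ac k w≡a g₁≡c k-length
    ... | yes w≡a | _ | no _ | yes g₂≡c = hubs-ac (swapK k) w≡a g₂≡c k-length
    ... | yes w≡a | _ | no g₁≢c | no g₂≢c = hub-not-c w≡a g₁≢c g₂≢c

-- Defence of a pair of hubs

double-≤ : ∀ {k} n → k + k ≤ suc (n + n) → k ≤ n
double-≤ {k} n le with k ≤? n
... | yes k≤n = k≤n
... | no k≰n = ⊥-elim (1+n≰n (≤-trans (≤-trans (≤-reflexive (cong suc (sym (+-suc n n)))) (+-mono-≤ (≰⇒> k≰n) (≰⇒> k≰n))) le))

_∈?_ : (e : Triple) (L : List Triple) → Dec (e ∈ L)
e ∈? L = any? (e ≟ₜ_) L

module Pairing (v h h′ : ℕ) (v≢h : v ≢ h) (v≢h′ : v ≢ h′) (h≢h′ : h ≢ h′) where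
  open Double v h h′

  Dead : List Triple → List Triple → Triple → Set
  Dead rd cl e = e ∈ cl × e ∉ rd

  -- M collects the vertices with two red edges to the hubs, O those with one red and one free edge; an
  -- edge that is claimed but not red is dead.
  record Track (n : ℕ) (rd cl : List Triple) : Set where
    field
      M O : List ℕ
      -- This weight is a potential: a red edge of Q raises the bound by one, an answer lowers it by
      -- one, and a bound 2t + 1 still limits M to t.
      size : length M + length M + length O ≤ n
      both : ∀ {y} → Third y → tri v h y ∈ rd → tri v h′ y ∈ rd → y ∈ M
      track : ∀ {y} → Third y → y ∈ M ⊎ y ∈ O ⊎ (tri v h y ∉ rd × tri v h′ y ∉ rd) ⊎
              (Dead rd cl (tri v h y) ⊎ Dead rd cl (tri v h′ y))

  open Track

  hubs-distinct : ∀ {y y′} → Third y′ → tri v h y ≢ tri v h′ y′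
  hubs-distinct {y} (_ , y′≢h , _) eq = ∉-tri (≢-sym v≢h) h≢h′ (≢-sym y′≢h) (subst (h ∈ₜ_) eq (tri₂ v h y))

  Track-start : ∀ {cl} → Track 0 [] cl
  Track-start = record { M = [] ; O = [] ; size = z≤n ; both = λ _ () ; track = λ _ → inj₂ (inj₂ (inj₁ ((λ ()) , λ ()))) }

  Track-≤ : ∀ {m n rd cl} → m ≤ n → Track m rd cl → Track n rd cl
  Track-≤ m≤n T = record { M = M T ; O = O T ; size = ≤-trans (size T) m≤n ; both = both T ; track = track T }

  Track-blue : ∀ {n rd cl} b → Track n rd cl → Track n rd (b ∷ cl)
  Track-blue b T = record
    { M = M T ; O = O T ; size = size T ; both = both T
    ; track = λ th → case₄ (track T th) }
    where
    case₄ : ∀ {rd cl y} → y ∈ M T ⊎ y ∈ O T ⊎ (tri v h y ∉ rd × tri v h′ y ∉ rd) ⊎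
              (Dead rd cl (tri v h y) ⊎ Dead rd cl (tri v h′ y)) →
            y ∈ M T ⊎ y ∈ O T ⊎ (tri v h y ∉ rd × tri v h′ y ∉ rd) ⊎
              (Dead rd (b ∷ cl) (tri v h y) ⊎ Dead rd (b ∷ cl) (tri v h′ y))
    case₄ (inj₁ p) = inj₁ p
    case₄ (inj₂ (inj₁ p)) = inj₂ (inj₁ p)
    case₄ (inj₂ (inj₂ (inj₁ p))) = inj₂ (inj₂ (inj₁ p))
    case₄ (inj₂ (inj₂ (inj₂ (inj₁ (p , q))))) = inj₂ (inj₂ (inj₂ (inj₁ (there p , q))))
    case₄ (inj₂ (inj₂ (inj₂ (inj₂ (p , q))))) = inj₂ (inj₂ (inj₂ (inj₂ (there p , q))))

  private
    dead-red : ∀ {e f rd cl} → e ∉ cl → Dead rd cl f → Dead (e ∷ rd) (e ∷ cl) f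
    dead-red e∉ (f∈ , f∉) = there f∈ , λ { (here refl) → e∉ f∈ ; (there p) → f∉ p }

    older : {e f : Triple} {L : List Triple} → f ≢ e → f ∈ e ∷ L → f ∈ L
    older f≢e f∈ = ∈-strict f∈ f≢e

  module _ {n n′ e rd cl} (T : Track n rd cl) (e∉ : e ∉ cl) (y : ℕ)
           (only : ∀ {y′} → Third y′ → y′ ≢ y → tri v h y′ ≢ e × tri v h′ y′ ≢ e)
           (M′ O′ : List ℕ) (size′ : length M′ + length M′ + length O′ ≤ n′)
           (M⊆ : ∀ {y′} → y′ ∈ M T → y′ ∈ M′) (O⊆ : ∀ {y′} → y′ ≢ y → y′ ∈ O T → y′ ∈ O′)
           (both′ : Third y → tri v h y ∈ e ∷ rd → tri v h′ y ∈ e ∷ rd → y ∈ M′)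
           (track′ : Third y → y ∈ M′ ⊎ y ∈ O′ ⊎
                     (Dead (e ∷ rd) (e ∷ cl) (tri v h y) ⊎ Dead (e ∷ rd) (e ∷ cl) (tri v h′ y))) where

    Track-update : Track n′ (e ∷ rd) (e ∷ cl)
    Track-update = record { M = M′ ; O = O′ ; size = size′ ; both = both″ ; track = track″ }
      where
      both″ : ∀ {y′} → Third y′ → tri v h y′ ∈ e ∷ rd → tri v h′ y′ ∈ e ∷ rd → y′ ∈ M′
      both″ {y′} th p q with y′ ≟ y
      ... | yes refl = both′ th p q
      ... | no ne = M⊆ (both T th (older (proj₁ (only th ne)) p) (older (proj₂ (only th ne)) q))
      track″ : ∀ {y′} → Third y′ → y′ ∈ M′ ⊎ y′ ∈ O′ ⊎ (tri v h y′ ∉ e ∷ rd × tri v h′ y′ ∉ e ∷ rd) ⊎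
               (Dead (e ∷ rd) (e ∷ cl) (tri v h y′) ⊎ Dead (e ∷ rd) (e ∷ cl) (tri v h′ y′))
      track″ {y′} th with y′ ≟ y
      track″ th | yes refl with track′ th
      ... | inj₁ p = inj₁ p
      ... | inj₂ (inj₁ p) = inj₂ (inj₁ p)
      ... | inj₂ (inj₂ p) = inj₂ (inj₂ (inj₂ p))
      track″ th | no ne with track T th
      ... | inj₁ p = inj₁ (M⊆ p)
      ... | inj₂ (inj₁ p) = inj₂ (inj₁ (O⊆ ne p))
      ... | inj₂ (inj₂ (inj₁ (p , q))) =
        inj₂ (inj₂ (inj₁ ((λ r → p (older (proj₁ (only th ne)) r)) , λ r → q (older (proj₂ (only th ne)) r))))
      ... | inj₂ (inj₂ (inj₂ (inj₁ d))) = inj₂ (inj₂ (inj₂ (inj₁ (dead-red e∉ d))))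
      ... | inj₂ (inj₂ (inj₂ (inj₂ d))) = inj₂ (inj₂ (inj₂ (inj₂ (dead-red e∉ d))))

  Track-other : ∀ {n e rd cl} → Track n rd cl → e ∉ cl → ¬ Q e → Track n (e ∷ rd) (e ∷ cl)
  Track-other {e = e} {rd} {cl} T e∉ nq = record
    { M = M T ; O = O T ; size = size T
    ; both = λ th p q → both T th (older (λ { refl → nq (_ , th , inj₁ refl) }) p) (older (λ { refl → nq (_ , th , inj₂ refl) }) q)
    ; track = λ th → go th (track T th) }
    where
    go : ∀ {y} → Third y → y ∈ M T ⊎ y ∈ O T ⊎ (tri v h y ∉ rd × tri v h′ y ∉ rd) ⊎
           (Dead rd cl (tri v h y) ⊎ Dead rd cl (tri v h′ y)) →
         y ∈ M T ⊎ y ∈ O T ⊎ (tri v h y ∉ e ∷ rd × tri v h′ y ∉ e ∷ rd) ⊎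
           (Dead (e ∷ rd) (e ∷ cl) (tri v h y) ⊎ Dead (e ∷ rd) (e ∷ cl) (tri v h′ y))
    go th (inj₁ p) = inj₁ p
    go th (inj₂ (inj₁ p)) = inj₂ (inj₁ p)
    go th (inj₂ (inj₂ (inj₁ (p , q)))) = inj₂ (inj₂ (inj₁
      ((λ { (here refl) → nq (_ , th , inj₁ refl) ; (there r) → p r }) ,
       (λ { (here refl) → nq (_ , th , inj₂ refl) ; (there r) → q r }))))
    go th (inj₂ (inj₂ (inj₂ (inj₁ d)))) = inj₂ (inj₂ (inj₂ (inj₁ (dead-red e∉ d))))
    go th (inj₂ (inj₂ (inj₂ (inj₂ d)))) = inj₂ (inj₂ (inj₂ (inj₂ (dead-red e∉ d))))

  -- The vertex y enters O at weight 1, or moves from O to M where it weighs 2, or was settled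
  -- before and changes nothing.
  Track-Q : ∀ {n e rd cl} → Track n rd cl → e ∉ cl → Q e → Track (suc n) (e ∷ rd) (e ∷ cl)
  Track-Q {n} {e} {rd} {cl} T e∉ (y , th , e≡) = go (any? (y ≟_) (O T)) (track T th)
    where
    only : ∀ {y′} → Third y′ → y′ ≢ y → tri v h y′ ≢ e × tri v h′ y′ ≢ e
    only {y′} th′@(y′≢v , y′≢h , y′≢h′) ne = f e≡ , g e≡
      where
      f : e ≡ tri v h y ⊎ e ≡ tri v h′ y → tri v h y′ ≢ e
      f (inj₁ refl) eq = ne (tri-injective y′≢v y′≢h eq)
      f (inj₂ refl) eq = hubs-distinct th eq
      g : e ≡ tri v h y ⊎ e ≡ tri v h′ y → tri v h′ y′ ≢ e
      g (inj₁ refl) eq = hubs-distinct th′ (sym eq)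
      g (inj₂ refl) eq = ne (tri-injective y′≢v y′≢h′ eq)
    O-to-M : ∀ {m o} → m + m + suc o ≤ n → suc m + suc m + o ≤ suc n
    O-to-M {m} {o} le = ≤-trans (≤-reflexive (eq m o)) (s≤s le)
      where
      eq : ∀ m o → (1 + m) + (1 + m) + o ≡ 1 + (m + m + (1 + o))
      eq = solve-∀
    go : Dec (y ∈ O T) → _ → Track (suc n) (e ∷ rd) (e ∷ cl)
    go (yes y∈) _ with extract y∈
    ... | L , p = Track-update T e∉ y only (y ∷ M T) L
          (O-to-M {length (M T)} (subst (λ k → length (M T) + length (M T) + k ≤ n) (↭-length p) (size T)))
          there (λ ne q → ∈-strict (∈-resp-↭ p q) ne) (λ _ _ _ → here refl) (λ _ → inj₁ (here refl))
    go (no _) (inj₁ y∈) = Track-update T e∉ y only (M T) (O T) (≤-trans (size T) (n≤1+n _))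
          (λ p → p) (λ _ p → p) (λ _ _ _ → y∈) (λ _ → inj₁ y∈)
    go (no y∉) (inj₂ (inj₁ y∈)) = ⊥-elim (y∉ y∈)
    go (no _) (inj₂ (inj₂ (inj₁ (p , q)))) = Track-update T e∉ y only (M T) (y ∷ O T)
          (≤-trans (≤-reflexive (+-suc (length (M T) + length (M T)) _)) (s≤s (size T)))
          (λ p → p) (λ _ → there) not-both (λ _ → inj₂ (inj₁ (here refl)))
      where
      not-both : Third y → tri v h y ∈ e ∷ rd → tri v h′ y ∈ e ∷ rd → y ∈ M T
      not-both th (here eq) (here eq′) = ⊥-elim (hubs-distinct th (≡-trans eq (sym eq′)))
      not-both _ (there r) _ = ⊥-elim (p r)
      not-both _ _ (there r) = ⊥-elim (q r)
    go (no _) (inj₂ (inj₂ (inj₂ (inj₁ d)))) = Track-update T e∉ y only (M T) (O T) (≤-trans (size T) (n≤1+n _))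
          (λ p → p) (λ _ p → p) (λ _ p _ → ⊥-elim (proj₂ (dead-red e∉ d) p)) (λ _ → inj₂ (inj₂ (inj₁ (dead-red e∉ d))))
    go (no _) (inj₂ (inj₂ (inj₂ (inj₂ d)))) = Track-update T e∉ y only (M T) (O T) (≤-trans (size T) (n≤1+n _))
          (λ p → p) (λ _ p → p) (λ _ _ p → ⊥-elim (proj₂ (dead-red e∉ d) p)) (λ _ → inj₂ (inj₂ (inj₂ (dead-red e∉ d))))

  Q? : ∀ {e} → ValidEdge e → Dec (Q e)
  Q? {e} val with v ∈ₜ? e | h ∈ₜ? e | h′ ∈ₜ? e
  ... | no v∉ | _ | _ = no λ q → v∉ (Q-centre q)
    where open QCount v h h′ v≢h v≢h′ h≢h′
  ... | yes _ | yes p | yes q = no λ r → Q-hubs r p q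
    where open QCount v h h′ v≢h v≢h′ h≢h′
  ... | yes _ | no p | no q = no λ r → [ p , q ] (Q-hub r)
    where open QCount v h h′ v≢h v≢h′ h≢h′
  ... | yes v∈ | yes h∈ | no h′∉ with third val v≢h v∈ h∈
  ...   | y , y≢v , y≢h , refl = yes (y , (y≢v , y≢h , λ { refl → h′∉ (tri₃ _ _ _) }) , inj₁ refl)
  Q? {e} val | yes v∈ | no h∉ | yes h′∈ with third val v≢h′ v∈ h′∈
  ...   | y , y≢v , y≢h′ , refl = yes (y , (y≢v , (λ { refl → h∉ (tri₃ _ _ _) }) , y≢h′) , inj₂ refl)

  private
    drop-open : ∀ {n rd cl z O′} (T : Track (suc n) rd cl) → O T ≡ z ∷ O′ →
                (Third z → z ∈ M T ⊎ (Dead rd cl (tri v h z) ⊎ Dead rd cl (tri v h′ z))) → Track n rd cl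
    drop-open {n} {rd} {cl} {z} {O′} T eq settled = record
      { M = M T ; O = O′
      ; size = s≤s⁻¹ (subst (_≤ suc n) (+-suc (length (M T) + length (M T)) (length O′))
                 (subst (λ L → length (M T) + length (M T) + length L ≤ suc n) eq (size T)))
      ; both = both T ; track = λ th → go th (track T th) }
      where
      go : ∀ {y} → Third y → y ∈ M T ⊎ y ∈ O T ⊎ (tri v h y ∉ rd × tri v h′ y ∉ rd) ⊎
             (Dead rd cl (tri v h y) ⊎ Dead rd cl (tri v h′ y)) →
           y ∈ M T ⊎ y ∈ O′ ⊎ (tri v h y ∉ rd × tri v h′ y ∉ rd) ⊎
             (Dead rd cl (tri v h y) ⊎ Dead rd cl (tri v h′ y))
      go th (inj₁ p) = inj₁ p
      go th (inj₂ (inj₂ p)) = inj₂ (inj₂ p)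
      go th (inj₂ (inj₁ p)) with subst (_ ∈_) eq p
      ... | there q = inj₂ (inj₁ q)
      ... | here refl with settled th
      ...   | inj₁ q = inj₁ q
      ...   | inj₂ d = inj₂ (inj₂ (inj₂ d))

  third? : ∀ z → Dec (Third z)
  third? z with z ≟ v | z ≟ h | z ≟ h′
  ... | yes p | _ | _ = no λ (q , _) → q p
  ... | no _ | yes p | _ = no λ (_ , q , _) → q p
  ... | no _ | no _ | yes p = no λ (_ , _ , q) → q p
  ... | no p | no q | no r = yes (p , q , r)

  -- An open vertex is closed by claiming its free edge, unless it turns out to be settled already.
  -- If O is empty, the weight is even and the odd bound can be lowered without a move.
  answer : ∀ {n rd cl} → (∀ {e} → e ∈ rd → e ∈ cl) → Track (suc (n + n)) rd cl →
           Track (n + n) rd cl ⊎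
           (Σ Triple λ b → ValidEdge b × b ∉ cl × v ∈ₜ b × Track (n + n) rd (b ∷ cl))
  answer {n} {rd} {cl} rd⊆cl T = go (O T) refl
    where
    go : ∀ L → O T ≡ L → _
    go [] eq = inj₁ (record
      { M = M T ; O = [] ; both = both T
      ; size = subst (_≤ n + n) (sym (+-identityʳ _)) (+-mono-≤ M≤n M≤n)
      ; track = λ th → subst (λ L → _ ∈ M T ⊎ _ ∈ L ⊎ _) eq (track T th) })
      where
      M≤n : length (M T) ≤ n
      M≤n = double-≤ n (≤-trans (m≤m+n _ _) (size T))
    go (z ∷ O′) eq with third? z
    ... | no nth = inj₁ (drop-open T eq λ th → ⊥-elim (nth th))
    ... | yes th@(z≢v , z≢h , z≢h′) with tri v h z ∈? cl | tri v h′ z ∈? cl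
    ...   | no p | _ = inj₂ (_ , tri-valid v≢h (≢-sym z≢h) (≢-sym z≢v) , p , tri₁ _ _ _ ,
              drop-open (Track-blue (tri v h z) T) eq λ _ → inj₂ (inj₁ (here refl , λ q → p (rd⊆cl q))))
    ...   | yes _ | no p = inj₂ (_ , tri-valid v≢h′ (≢-sym z≢h′) (≢-sym z≢v) , p , tri₁ _ _ _ ,
              drop-open (Track-blue (tri v h′ z) T) eq λ _ → inj₂ (inj₂ (here refl , λ q → p (rd⊆cl q))))
    ...   | yes p | yes p′ with tri v h z ∈? rd | tri v h′ z ∈? rd
    ...     | yes q | yes q′ = inj₁ (drop-open T eq λ th → inj₁ (both T th q q′))
    ...     | no q | _ = inj₁ (drop-open T eq λ _ → inj₂ (inj₁ (p , q)))
    ...     | yes _ | no q′ = inj₁ (drop-open T eq λ _ → inj₂ (inj₂ (p′ , q′)))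

  K-capped : ∀ {n rd cl} → Track (suc (n + n)) rd cl → (k : K (_∈ rd)) → K.v k ≡ v →
             (K.g₁ k ≡ h × K.g₂ k ≡ h′) ⊎ (K.g₁ k ≡ h′ × K.g₂ k ≡ h) → length (K.M k) ≤ n
  K-capped {n} T k refl hubs =
    ≤-trans (Unique-⊆-length (K.M-unique k) (in-M hubs)) (double-≤ n (≤-trans (m≤m+n _ _) (size T)))
    where
    in-M : (K.g₁ k ≡ h × K.g₂ k ≡ h′) ⊎ (K.g₁ k ≡ h′ × K.g₂ k ≡ h) → ∀ {m} → m ∈ K.M k → m ∈ M T
    in-M (inj₁ (refl , refl)) m∈ = both T (K.M≢v k m∈ , K.M≢g₁ k m∈ , K.M≢g₂ k m∈) (K.edge₁ k m∈) (K.edge₂ k m∈)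
    in-M (inj₂ (refl , refl)) m∈ = both T (K.M≢v k m∈ , K.M≢g₂ k m∈ , K.M≢g₁ k m∈) (K.edge₂ k m∈) (K.edge₁ k m∈)

-- Claiming edges at the second hub c

module SecondHub (s a b c : ℕ) (a≢b : a ≢ b) (a≢c : a ≢ c) (b≢c : b ≢ c)
  (xs : List ℕ) (xs-unique : Unique xs) (xs-length : length xs ≡ 5 + (s + s))
  (a∉xs : a ∉ xs) (b∉xs : b ∉ xs) (c∉xs : c ∉ xs) (x₁ : ℕ) (Base : Triple → Set) where
  open Target s

  ab ac : ℕ → Triple
  ab = tri a b
  ac = tri a c

  ≢a : ∀ {x} → x ∈ xs → x ≢ a
  ≢a x∈ refl = a∉xs x∈

  ≢b : ∀ {x} → x ∈ xs → x ≢ b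
  ≢b x∈ refl = b∉xs x∈

  ≢c : ∀ {x} → x ∈ xs → x ≢ c
  ≢c x∈ refl = c∉xs x∈

  ac-injective : ∀ {x y} → x ∈ xs → ac x ≡ ac y → x ≡ y
  ac-injective x∈ = tri-injective (≢a x∈) (≢c x∈)

  -- The vertices of xs whose edge at c is free (Op), blue (Tk) or red (Bk); Oth contains the
  -- remaining red edges outside Base.
  record Core (Bl Cl Rd : List Triple) : Set where
    field
      Op Tk Bk : List ℕ
      Oth : List Triple
      perm : xs ↭ Op ++ Tk ++ Bk
      x₁∈Tk : x₁ ∈ Tk
      xs-ab : ∀ {x} → x ∈ xs → ab x ∈ Bl
      Tk-ac : ∀ {x} → x ∈ Tk → ac x ∈ Bl
      Op-ac : ∀ {x} → x ∈ Op → ac x ∉ Cl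
      Rd-split : ∀ {e} → e ∈ Rd → Base e ⊎ (Σ ℕ λ x → x ∈ Bk × e ≡ ac x) ⊎ e ∈ Oth

    -- The moves the opponent has spent outside `Base`. Blue's edges at c are kept equal to this
    -- number, or one ahead while an answer in `Base` is due.
    free : ℕ
    free = length Bk + length Oth

    Op⊆xs : ∀ {x} → x ∈ Op → x ∈ xs
    Op⊆xs x∈ = ∈-resp-↭ (↭-sym perm) (∈-++⁺ˡ x∈)

    Tk⊆xs : ∀ {x} → x ∈ Tk → x ∈ xs
    Tk⊆xs x∈ = ∈-resp-↭ (↭-sym perm) (∈-++⁺ʳ Op (∈-++⁺ˡ x∈))

    Bk⊆xs : ∀ {x} → x ∈ Bk → x ∈ xs
    Bk⊆xs x∈ = ∈-resp-↭ (↭-sym perm) (∈-++⁺ʳ Op (∈-++⁺ʳ Tk x∈))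

    lengths : length Op + (length Tk + length Bk) ≡ 5 + (s + s)
    lengths = ≡-trans (sym (≡-trans (length-++ Op) (cong (length Op +_) (length-++ Tk)))) (≡-trans (sym (↭-length perm)) xs-length)

  open Core

  Core-blue : ∀ {Bl Cl Rd} e → (C : Core Bl Cl Rd) → (∀ {x} → x ∈ xs → e ≢ ac x) → Core (e ∷ Bl) (e ∷ Cl) Rd
  Core-blue e C ne = record
    { Op = Op C ; Tk = Tk C ; Bk = Bk C ; Oth = Oth C ; perm = perm C ; x₁∈Tk = x₁∈Tk C
    ; xs-ab = λ x∈ → there (xs-ab C x∈) ; Tk-ac = λ x∈ → there (Tk-ac C x∈)
    ; Op-ac = λ { x∈ (here eq) → ne (Op⊆xs C x∈) (sym eq) ; x∈ (there p) → Op-ac C x∈ p }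
    ; Rd-split = Rd-split C }

  Core-base : ∀ {Bl Cl Rd e} → (C : Core Bl Cl Rd) → Base e → (∀ {x} → x ∈ xs → e ≢ ac x) → Core Bl (e ∷ Cl) (e ∷ Rd)
  Core-base C be ne = record
    { Op = Op C ; Tk = Tk C ; Bk = Bk C ; Oth = Oth C ; perm = perm C ; x₁∈Tk = x₁∈Tk C
    ; xs-ab = xs-ab C ; Tk-ac = Tk-ac C
    ; Op-ac = λ { x∈ (here eq) → ne (Op⊆xs C x∈) (sym eq) ; x∈ (there p) → Op-ac C x∈ p }
    ; Rd-split = λ { (here refl) → inj₁ be ; (there e∈) → Rd-split C e∈ } }

  private
    head-new : ∀ {L : List ℕ} {x y} → Unique (x ∷ L) → y ∈ L → x ≢ y
    head-new u y∈ refl = Unique[x∷xs]⇒x∉xs u y∈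

  Core-take : ∀ {Bl Cl Rd x L} → (C : Core Bl Cl Rd) → Op C ≡ x ∷ L →
              Σ (Core (ac x ∷ Bl) (ac x ∷ Cl) Rd) λ C′ →
                Tk C′ ≡ x ∷ Tk C × free C′ ≡ free C
  Core-take {x = x} {L} C eq = record
    { Op = L ; Tk = x ∷ Tk C ; Bk = Bk C ; Oth = Oth C
    ; perm = trans p (↭-sym (shift x L (Tk C ++ Bk C)))
    ; x₁∈Tk = there (x₁∈Tk C) ; xs-ab = λ x∈ → there (xs-ab C x∈)
    ; Tk-ac = λ { (here refl) → here refl ; (there x∈) → there (Tk-ac C x∈) }
    ; Op-ac = λ { y∈ (here e) → head-new u (∈-++⁺ˡ y∈)
                    (sym (ac-injective (∈-resp-↭ (↭-sym p) (there (∈-++⁺ˡ y∈))) e))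
                ; y∈ (there q) → Op-ac C (subst (_ ∈_) (sym eq) (there y∈)) q }
    ; Rd-split = Rd-split C } , refl , refl
    where
    p : xs ↭ x ∷ L ++ Tk C ++ Bk C
    p = subst (λ O → xs ↭ O ++ Tk C ++ Bk C) eq (perm C)
    u : Unique (x ∷ L ++ Tk C ++ Bk C)
    u = Unique-resp-↭ p xs-unique

  Core-red : ∀ {Bl Cl Rd} e → (C : Core Bl Cl Rd) →
             Σ (Core Bl (e ∷ Cl) (e ∷ Rd)) λ C′ → Tk C′ ≡ Tk C × free C′ ≡ suc (free C)
  Core-red e C with any? (λ x → e ≟ₜ ac x) (Op C)
  ... | no none = record
    { Op = Op C ; Tk = Tk C ; Bk = Bk C ; Oth = e ∷ Oth C ; perm = perm C ; x₁∈Tk = x₁∈Tk C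
    ; xs-ab = xs-ab C ; Tk-ac = Tk-ac C
    ; Op-ac = λ { x∈ (here eq) → none (lose x∈ (sym eq)) ; x∈ (there p) → Op-ac C x∈ p }
    ; Rd-split = λ { (here refl) → inj₂ (inj₂ (here refl))
                   ; (there e∈) → [ inj₁ , (λ q → inj₂ ([ inj₁ , (λ r → inj₂ (there r)) ] q)) ] (Rd-split C e∈) } }
    , refl , +-suc (length (Bk C)) (length (Oth C))
  ... | yes hit with find hit
  ...   | x , x∈ , refl with extract x∈
  ...     | L , p = record
    { Op = L ; Tk = Tk C ; Bk = x ∷ Bk C ; Oth = Oth C
    ; perm = trans q (↭-sym (trans (↭-++⁺ˡ L (shift x (Tk C) (Bk C))) (shift x L (Tk C ++ Bk C))))
    ; x₁∈Tk = x₁∈Tk C ; xs-ab = xs-ab C ; Tk-ac = Tk-ac C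
    ; Op-ac = λ { y∈ (here eq) → head-new u (∈-++⁺ˡ y∈) (sym (ac-injective (∈-resp-↭ (↭-sym q) (there (∈-++⁺ˡ y∈))) eq))
                ; y∈ (there r) → Op-ac C (∈-resp-↭ (↭-sym p) (there y∈)) r }
    ; Rd-split = λ { (here refl) → inj₂ (inj₁ (x , here refl , refl))
                   ; (there e∈) → [ inj₁ , (λ q → inj₂ ([ (λ (y , y∈ , eq) → inj₁ (y , there y∈ , eq)) , inj₂ ] q)) ] (Rd-split C e∈) } }
    , refl , refl
    where
    q : xs ↭ x ∷ L ++ Tk C ++ Bk C
    q = trans (perm C) (↭-++⁺ʳ (Tk C ++ Bk C) p)
    u : Unique (x ∷ L ++ Tk C ++ Bk C)
    u = Unique-resp-↭ q xs-unique

  -- Besides the t + 1 mids exactly t - 2 vertices of xs remain. They serve as leaves whatever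
  -- became of their edges at c.
  Core-win : ∀ {Bl Cl Rd x L} → (C : Core Bl Cl Rd) → Op C ≡ x ∷ L → length (Tk C) ≡ 3 + s → Contains G (_∈ ac x ∷ Bl)
  Core-win {x = x} {L} C eq len = book (x ∷ Tk C) (L ++ Bk C) (cong suc len)
    (≡-trans (length-++ L) lenL) (Unique-resp-↭ p xs-unique) a≢b a≢c b≢c
    (λ q → a∉xs (∈-resp-↭ (↭-sym p) q)) (λ q → b∉xs (∈-resp-↭ (↭-sym p) q)) (λ q → c∉xs (∈-resp-↭ (↭-sym p) q))
    (λ q → there (xs-ab C (∈-resp-↭ (↭-sym p) q)))
    (λ { (here refl) → here refl ; (there q) → there (Tk-ac C q) })
    where
    p : xs ↭ (x ∷ Tk C) ++ (L ++ Bk C)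
    p = trans (subst (λ O → xs ↭ O ++ Tk C ++ Bk C) eq (perm C)) (prep x (shifts L (Tk C)))
    lenL : length L + length (Bk C) ≡ 1 + s
    lenL = +-cancelˡ-≡ (4 + s) _ _ (≡-trans (arith s (length L) (length (Bk C)))
      (≡-trans (subst (λ k → suc (length L) + (k + length (Bk C)) ≡ 5 + (s + s)) len
        (subst (λ O → length O + (length (Tk C) + length (Bk C)) ≡ 5 + (s + s)) eq (lengths C))) (arith′ s)))
      where
      arith : ∀ s l k → 4 + s + (l + k) ≡ 1 + l + (3 + s + k)
      arith = solve-∀
      arith′ : ∀ s → 5 + (s + s) ≡ 4 + s + (1 + s)
      arith′ = solve-∀

  -- Bk is no longer than Tk, so together they cover at most 2t - 2 of the 2t - 1 vertices.
  Core-open : ∀ {Bl Cl Rd} → (C : Core Bl Cl Rd) → length (Tk C) ≡ free C → length (Tk C) ≤ 2 + s → Op C ≢ []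
  Core-open C len le eq = 1+n≰n (≤-trans (≤-reflexive (arith s)) (≤-trans
    (≤-reflexive (sym (subst (λ O → length O + (length (Tk C) + length (Bk C)) ≡ 5 + (s + s)) eq (lengths C))))
    (+-mono-≤ le (≤-trans (≤-trans (m≤m+n _ _) (≤-reflexive (sym len))) le))))
    where
    arith : ∀ s → 1 + (2 + s + (2 + s)) ≡ 5 + (s + s)
    arith = solve-∀

  record Blocked (Bl Cl Rd : List Triple) : Set where
    field
      core : Core Bl Cl Rd
      Tk-length : length (Tk core) ≡ 3 + s
      Bk-length : length (Bk core) ≡ 2 + s
      F : Triple
      split : ∀ {e} → e ∈ Rd → Base e ⊎ (Σ ℕ λ x → x ∈ Bk core × e ≡ ac x) ⊎ e ≡ F

  -- Blocking takes t - 1 of the opponent's t free moves, which leaves the single edge F.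
  Core-blocked : ∀ {Bl Cl Rd} → (C : Core Bl Cl Rd) → length (Tk C) ≡ free C → length (Tk C) ≡ 3 + s → Op C ≡ [] → Blocked Bl Cl Rd
  Core-blocked C len len′ eq = go (Oth C) refl
    where
    lenB : length (Bk C) ≡ 2 + s
    lenB = +-cancelˡ-≡ (3 + s) _ _ (≡-trans
      (subst (λ k → k + length (Bk C) ≡ 5 + (s + s)) len′
        (subst (λ O → length O + (length (Tk C) + length (Bk C)) ≡ 5 + (s + s)) eq (lengths C))) (arith s))
      where
      arith : ∀ s → 5 + (s + s) ≡ 3 + s + (2 + s)
      arith = solve-∀
    lenO : length (Oth C) ≡ 1
    lenO = +-cancelˡ-≡ (2 + s) _ _ (≡-trans (cong (_+ length (Oth C)) (sym lenB)) (≡-trans (sym len) (≡-trans len′ (arith s))))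
      where
      arith : ∀ s → 3 + s ≡ 2 + s + 1
      arith = solve-∀
    go : ∀ L → Oth C ≡ L → _
    go [] eq′ = ⊥-elim (0≢1+n (≡-trans (cong length (sym eq′)) lenO))
    go (_ ∷ _ ∷ _) eq′ = ⊥-elim (0≢1+n (sym (suc-injective (≡-trans (cong length (sym eq′)) lenO))))
    go (F ∷ []) eq′ = record { core = C ; Tk-length = len′ ; Bk-length = lenB ; F = F ; split = spl }
      where
      spl : ∀ {e} → e ∈ _ → Base e ⊎ (Σ ℕ λ x → x ∈ Bk C × e ≡ ac x) ⊎ e ≡ F
      spl e∈ with Rd-split C e∈
      ... | inj₁ p = inj₁ p
      ... | inj₂ (inj₁ p) = inj₂ (inj₁ p)
      ... | inj₂ (inj₂ p) with subst (_ ∈_) eq′ p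
      ...   | here q = inj₂ (inj₂ q)

  -- With Tk, the new y completes the t + 1 mids. The t - 1 vertices of Bk are one leaf too many, so
  -- one of them is dropped.
  Blocked-win : ∀ {Bl Cl Rd Bl′ y} → (D : Blocked Bl Cl Rd) → (∀ {e} → e ∈ Bl → e ∈ Bl′) → ab y ∈ Bl′ →
                y ≢ a → y ≢ b → y ≢ c → y ∉ xs → Contains G (_∈ ac y ∷ Bl′)
  Blocked-win {y = y} D sub aby y≢a y≢b y≢c y∉xs = go (Bk C) refl
    where
    open Blocked D using (Tk-length; Bk-length) renaming (core to C)
    go : ∀ L → Bk C ≡ L → _
    go [] eq = ⊥-elim (0≢1+n (≡-trans (cong length (sym eq)) Bk-length))
    go (z ∷ L) eq = book (y ∷ Tk C) L (cong suc Tk-length)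
      (suc-injective (≡-trans (cong length (sym eq)) Bk-length))
      (∉⇒All≢ (λ p → y∉xs (old p)) ∷ uL) a≢b a≢c b≢c
      (λ { (here e) → y≢a (sym e) ; (there p) → a∉xs (old p) })
      (λ { (here e) → y≢b (sym e) ; (there p) → b∉xs (old p) })
      (λ { (here e) → y≢c (sym e) ; (there p) → c∉xs (old p) })
      (λ { (here refl) → there aby ; (there p) → there (sub (xs-ab C (old p))) })
      (λ { (here refl) → here refl ; (there p) → there (sub (Tk-ac C p)) })
      where
      drop-Op : ∀ O {L} → Unique (O ++ L) → Unique L
      drop-Op [] u = u
      drop-Op (_ ∷ O) (_ ∷ u) = drop-Op O u
      old : ∀ {x} → x ∈ Tk C ++ L → x ∈ xs
      old p with ∈-++⁻ (Tk C) p
      ... | inj₁ q = Tk⊆xs C q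
      ... | inj₂ q = Bk⊆xs C (subst (_ ∈_) (sym eq) (there q))
      uL : Unique (Tk C ++ L)
      uL with Unique-resp-↭ (shift z (Tk C) L) (subst (λ B → Unique (Tk C ++ B)) eq (drop-Op (Op C) (Unique-resp-↭ (perm C) xs-unique)))
      ... | _ ∷ u = u

-- The strategy of blue from the second hub on

module Machine (σ : Strategy) (legal : LegalStrategy σ) (Z : List Triple) (Zv : All ValidEdge Z) (Zu : Unique Z) where
  open Game σ legal Z Zv Zu

  first : Triple
  first = σ (reverse Z)

  first∈red : ∀ B → first ∈ red B
  first∈red [] = here refl
  first∈red (b ∷ B) = there (first∈red B)

  module Play (s a b c : ℕ) (a≢b : a ≢ b) (a≢c : a ≢ c) (b≢c : b ≢ c)
    (xs : List ℕ) (xs-unique : Unique xs) (xs-length : length xs ≡ 5 + (s + s))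
    (a∉xs : a ∉ xs) (b∉xs : b ∉ xs) (c∉xs : c ∉ xs) (xs∉first : ∀ {x} → x ∈ xs → ¬ x ∈ₜ first)
    (x₁ : ℕ) (Base : Triple → Set) where
    open Target s
    open SecondHub s a b c a≢b a≢c b≢c xs xs-unique xs-length a∉xs b∉xs c∉xs x₁ Base
    open Core

    CoreAt BlockedAt : List Triple → Set
    CoreAt B = Core B (cl B) (red B)
    BlockedAt B = Blocked B (cl B) (red B)

    -- B₁ is the position in which the threats began and Ys lists the answered ones. X is empty
    -- while all are answered, and holds the one edge E once a threat has been left open.
    record PerpetualRed (B₁ B : List Triple) (Ys : List ℕ) (X : Triple → Set) : Set where
      field
        Ys-fresh : ∀ {e y} → e ∈ cl B₁ → y ∈ Ys → ¬ y ∈ₜ e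
        red-split : ∀ {e} → e ∈ red B → e ∈ red B₁ ⊎ (Σ ℕ λ y → y ∈ Ys × e ≡ ac y) ⊎ X e

    -- How blue treats the edges in Base: an edge of Base that puts blue on Alert has to be answered at
    -- once, whereas in a Calm position blue may move at c.
    record Mode : Set₁ where
      field
        Calm Alert : List Triple → Set
        calm-next : ∀ {e B} → Legal (e ∷ B) → Calm B → Calm (e ∷ B) ⊎ (Alert (e ∷ B) × Base (reply e B))
        respond : ∀ {B} → Legal B → Alert B →
          Σ Triple λ e → ValidEdge e × e ∉ cl B × (∀ {x} → x ∈ xs → e ≢ ac x) ×
            (Legal (e ∷ B) → Calm (e ∷ B) ⊎ (Alert (e ∷ B) × Base (reply e B)))
        Base-ac : ∀ {e x} → Base e → ¬ x ∈ₜ first → e ≢ ac x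
        safe : ∀ {B} → Legal B → Calm B ⊎ Alert B → (C : CoreAt B) → free C ≤ 3 + s → ¬ Contains G (_∈ red B)
        safe-perpetual : ∀ {B₁ B Ys E} → Legal B₁ → Legal B → BlockedAt B₁ → Calm B₁ → Calm B ⊎ Alert B →
          PerpetualRed B₁ B Ys (_≡ E) → ¬ Contains G (_∈ red B)

    module Strategy (mode : Mode) where
      open Mode mode

      record Perpetual (B : List Triple) (X : Triple → Set) : Set where
        field
          B₁ : List Triple
          L₁ : Legal B₁
          calm₁ : Calm B₁
          D : BlockedAt B₁
          Ys : List ℕ
          reds : PerpetualRed B₁ B Ys X
          blue⊆ : ∀ {e} → e ∈ B₁ → e ∈ B
          cl⊆ : ∀ {e} → e ∈ cl B₁ → e ∈ cl B

        open Blocked D public using (core)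

        xs-old : ∀ {x} → x ∈ xs → ab x ∈ cl B
        xs-old x∈ = blue⊆cl (blue⊆ (xs-ab core x∈))

        a-old : Σ Triple λ e → e ∈ cl B × a ∈ₜ e
        a-old = ab x₁ , xs-old (Tk⊆xs core (x₁∈Tk core)) , tri₁ _ _ _

        b-old : Σ Triple λ e → e ∈ cl B × b ∈ₜ e
        b-old = ab x₁ , xs-old (Tk⊆xs core (x₁∈Tk core)) , tri₂ _ _ _

        c-old : Σ Triple λ e → e ∈ cl B × c ∈ₜ e
        c-old = ac x₁ , blue⊆cl (blue⊆ (Tk-ac core (x₁∈Tk core))) , tri₂ _ _ _

      data Inv (B : List Triple) : Set where
        calm : Calm B → (C : CoreAt B) → length (Tk C) ≡ free C → length (Tk C) ≤ 3 + s → Inv B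
        alert : Alert B → (C : CoreAt B) → length (Tk C) ≡ suc (free C) → length (Tk C) ≤ 3 + s → Inv B
        perpetual : Calm B → Perpetual B (λ _ → ⊥) → Inv B
        winning : ∀ {E y} → Calm B ⊎ Alert B → Perpetual B (_≡ E) → ab y ∈ B → ac y ∉ cl B →
                  y ≢ a → y ≢ b → y ≢ c → y ∉ xs → Inv B

      inv-safe : ∀ {B} → Legal B → Inv B → ¬ Contains G (_∈ red B)
      inv-safe L (calm q C len le) = safe L (inj₁ q) C (subst (_≤ 3 + s) len le)
      inv-safe L (alert q C len le) = safe L (inj₂ q) C (≤-trans (n≤1+n _) (subst (_≤ 3 + s) len le))
      -- There is no stray edge yet; `first` is an arbitrary value for E.
      inv-safe L (perpetual q P) = safe-perpetual {E = first} (Perpetual.L₁ P) L (Perpetual.D P) (Perpetual.calm₁ P) (inj₁ q)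
        (record { Ys-fresh = Ys-fresh ; red-split = λ e∈ → [ inj₁ , (λ r → inj₂ ([ inj₁ , ⊥-elim ] r)) ] (red-split e∈) } )
        where open PerpetualRed (Perpetual.reds P)
      inv-safe L (winning q P _ _ _ _ _ _) = safe-perpetual (Perpetual.L₁ P) L (Perpetual.D P) (Perpetual.calm₁ P) q (Perpetual.reds P)

      -- Blue is one ahead before the reply. A reply in `Base` that alerts blue keeps this lead for
      -- the time after the answer; any other reply uses it up as a free move.
      land : ∀ {e B} → Legal (e ∷ B) → (C : Core (e ∷ B) (e ∷ cl B) (red B)) →
             length (Tk C) ≡ suc (free C) → length (Tk C) ≤ 3 + s →
             Calm (e ∷ B) ⊎ (Alert (e ∷ B) × Base (reply e B)) → Inv (e ∷ B)
      land L C len le (inj₂ (q , be)) = alert q (Core-base C be λ x∈ → Base-ac be (xs∉first x∈)) len le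
      land {e} {B} L C len le (inj₁ q) with Core-red (reply e B) C
      ... | C′ , eqT , eqF = calm q C′ (≡-trans (cong length eqT) (≡-trans len (sym eqF))) (subst (_≤ 3 + s) (sym (cong length eqT)) le)

      Step : List Triple → Set
      Step B = Σ Triple λ e → ValidEdge e × e ∉ cl B × (Inv (e ∷ B) ⊎ Contains G (_∈ e ∷ B))

      ac-valid : ∀ {y} → y ≢ a → y ≢ c → ValidEdge (ac y)
      ac-valid y≢a y≢c = tri-valid a≢c (≢-sym y≢c) (≢-sym y≢a)

      step-perpetual : ∀ {B} → Legal B → Calm B → Perpetual B (λ _ → ⊥) → Step B
      step-perpetual {B} L q P = ab y , val , new , inj₁ (next (reply (ab y) B ≟ₜ ac y))
        where
        open Perpetual P
        open PerpetualRed reds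
        y = bound (cl B)
        y-fresh : ∀ {e} → e ∈ cl B → ¬ y ∈ₜ e
        y-fresh e∈ y∈ = <-irrefl refl (<-bound e∈ y∈)
        y≢ : ∀ {u} → (Σ Triple λ e → e ∈ cl B × u ∈ₜ e) → y ≢ u
        y≢ (e , e∈ , u∈) refl = y-fresh e∈ u∈
        y≢a = y≢ a-old
        y≢b = y≢ b-old
        y≢c = y≢ c-old
        y∉xs : y ∉ xs
        y∉xs y∈ = y-fresh (xs-old y∈) (tri₃ _ _ _)
        val : ValidEdge (ab y)
        val = tri-valid a≢b (≢-sym y≢b) (≢-sym y≢a)
        new : ab y ∉ cl B
        new e∈ = y-fresh e∈ (tri₃ _ _ _)
        L′ : Legal (ab y ∷ B)
        L′ = (val , new) ∷ L
        next : Dec (reply (ab y) B ≡ ac y) → Inv (ab y ∷ B)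
        next (no ne) = winning {E = reply (ab y) B} {y = y} (mood (calm-next L′ q)) P′ (here refl) ac-free y≢a y≢b y≢c y∉xs
          where
          mood : Calm (ab y ∷ B) ⊎ (Alert (ab y ∷ B) × Base (reply (ab y) B)) → Calm (ab y ∷ B) ⊎ Alert (ab y ∷ B)
          mood (inj₁ p) = inj₁ p
          mood (inj₂ (p , _)) = inj₂ p
          ac-free : ac y ∉ cl (ab y ∷ B)
          ac-free (here eq) = ne (sym eq)
          ac-free (there (here eq)) = ∉-tri (≢-sym a≢c) (≢-sym b≢c) (≢-sym y≢c) (subst (c ∈ₜ_) eq (tri₂ _ _ _))
          ac-free (there (there p)) = y-fresh p (tri₃ _ _ _)
          P′ : Perpetual (ab y ∷ B) (_≡ reply (ab y) B)
          P′ = record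
            { B₁ = B₁ ; L₁ = L₁ ; calm₁ = calm₁ ; D = D ; Ys = Ys
            ; reds = record { Ys-fresh = Ys-fresh ; red-split = λ { (here eq) → inj₂ (inj₂ eq) ; (there e∈) → keep (red-split e∈) } }
            ; blue⊆ = λ p → there (blue⊆ p) ; cl⊆ = λ p → there (there (cl⊆ p)) }
            where
            keep : ∀ {e} → e ∈ red B₁ ⊎ (Σ ℕ λ y → y ∈ Ys × e ≡ ac y) ⊎ ⊥ →
                   e ∈ red B₁ ⊎ (Σ ℕ λ y → y ∈ Ys × e ≡ ac y) ⊎ e ≡ reply (ab y) B
            keep (inj₁ p) = inj₁ p
            keep (inj₂ (inj₁ p)) = inj₂ (inj₁ p)
        next (yes eq) with calm-next L′ q
        ... | inj₂ (_ , be) = ⊥-elim (Base-ac be (y-fresh (red⊆cl (first∈red B))) eq)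
        ... | inj₁ q′ = perpetual q′ record
            { B₁ = B₁ ; L₁ = L₁ ; calm₁ = calm₁ ; D = D ; Ys = y ∷ Ys
            ; reds = record
              { Ys-fresh = λ { e∈ (here refl) → y-fresh (cl⊆ e∈) ; e∈ (there p) → Ys-fresh e∈ p }
              ; red-split = λ { (here refl) → inj₂ (inj₁ (y , here refl , eq)) ; (there e∈) → more (red-split e∈) } }
            ; blue⊆ = λ p → there (blue⊆ p) ; cl⊆ = λ p → there (there (cl⊆ p)) }
          where
          more : ∀ {e} → e ∈ red B₁ ⊎ (Σ ℕ λ y → y ∈ Ys × e ≡ ac y) ⊎ ⊥ → e ∈ red B₁ ⊎ (Σ ℕ λ z → z ∈ y ∷ Ys × e ≡ ac z) ⊎ ⊥
          more (inj₁ p) = inj₁ p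
          more (inj₂ (inj₁ (z , z∈ , e))) = inj₂ (inj₁ (z , there z∈ , e))

      step : ∀ {B} → Legal B → Inv B → Step B
      step L (winning _ P aby∈ ac∉ y≢a y≢b y≢c y∉xs) =
        ac _ , ac-valid y≢a y≢c , ac∉ , inj₂ (Blocked-win (Perpetual.D P) (Perpetual.blue⊆ P) aby∈ y≢a y≢b y≢c y∉xs)
      step L (perpetual q P) = step-perpetual L q P
      step {B} L (alert q C len le) with respond L q
      ... | e , val , new , ne , next = e , val , new ,
            inj₁ (land ((val , new) ∷ L) (Core-blue e C ne) len le (next ((val , new) ∷ L)))
      step {B} L (calm q C len le) = go (Op C) refl (length (Tk C) ≟ 3 + s)
        where
        go : ∀ O → Op C ≡ O → Dec (length (Tk C) ≡ 3 + s) → Step B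
        go (x ∷ O) eq (yes full) = ac x , ac-valid (≢a x∈) (≢c x∈) , Op-ac C (subst (x ∈_) (sym eq) (here refl)) , inj₂ (Core-win C eq full)
          where x∈ = Op⊆xs C (subst (x ∈_) (sym eq) (here refl))
        go [] eq (yes full) = step-perpetual L q record
          { B₁ = B ; L₁ = L ; calm₁ = q ; D = Core-blocked C len full eq ; Ys = []
          ; reds = record { Ys-fresh = λ _ () ; red-split = inj₁ }
          ; blue⊆ = λ p → p ; cl⊆ = λ p → p }
        go [] eq (no notfull) = ⊥-elim (Core-open C len (s≤s⁻¹ (≤∧≢⇒< le notfull)) eq)
        go (x ∷ O) eq (no notfull) = ac x , val , new ,
            inj₁ (land L′ (proj₁ taken) (≡-trans (cong length eqT) (cong suc (≡-trans len (sym eqF))))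
              (subst (_≤ 3 + s) (sym (cong length eqT)) (≤∧≢⇒< le notfull)) (calm-next L′ q))
          where
          x∈Op = subst (x ∈_) (sym eq) (here refl)
          x∈ = Op⊆xs C x∈Op
          val = ac-valid (≢a x∈) (≢c x∈)
          new = Op-ac C x∈Op
          L′ : Legal (ac x ∷ B)
          L′ = (val , new) ∷ L
          taken = Core-take C eq
          eqT = proj₁ (proj₂ taken)
          eqF = proj₂ (proj₂ taken)

-- The opening star and the two modes of play

module Opening (σ : Strategy) (legal : LegalStrategy σ) (Z : List Triple) (Zv : All ValidEdge Z) (Zu : Unique Z) (s : ℕ) where
  open Game σ legal Z Zv Zu
  open Machine σ legal Z Zv Zu
  open Target s

  later : List Triple → List Triple
  later [] = []
  later (b ∷ B) = reply b B ∷ later B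

  later-length : ∀ B → length (later B) ≡ length B
  later-length [] = refl
  later-length (b ∷ B) = cong suc (later-length B)

  later-split : ∀ B {e} → e ∈ red B → e ≡ first ⊎ e ∈ later B
  later-split [] (here eq) = inj₁ eq
  later-split (b ∷ B) (here eq) = inj₂ (here eq)
  later-split (b ∷ B) (there e∈) with later-split B e∈
  ... | inj₁ eq = inj₁ eq
  ... | inj₂ e∈′ = inj₂ (there e∈′)

  record Star (n a b : ℕ) (B : List Triple) : Set where
    field
      L : Legal B
      B-length : length B ≡ n
      xs : List ℕ
      xs-unique : Unique xs
      xs-length : length xs ≡ n
      xs-ab : ∀ {x} → x ∈ xs → tri a b x ∈ B
      a≢b : a ≢ b
      a∉xs : a ∉ xs
      b∉xs : b ∉ xs
      xs∉first : ∀ {x} → x ∈ xs → ¬ x ∈ₜ first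
      a∉first : ¬ a ∈ₜ first
      b∉first : ¬ b ∈ₜ first

  swapStar : ∀ {n a b B} → Star n a b B → Star n b a B
  swapStar {a = a} {b} {B} S = record
    { L = L ; B-length = B-length ; xs = xs ; xs-unique = xs-unique ; xs-length = xs-length
    ; xs-ab = λ {x} x∈ → subst (_∈ B) (tri-by-members (All.lookup (cl-valid L) (blue⊆cl (xs-ab x∈)))
                (≢-sym a≢b) (λ { refl → a∉xs x∈ }) (λ { refl → b∉xs x∈ }) (tri₂ _ _ _) (tri₁ _ _ _) (tri₃ _ _ _)) (xs-ab x∈)
    ; a≢b = ≢-sym a≢b ; a∉xs = b∉xs ; b∉xs = a∉xs ; xs∉first = xs∉first ; a∉first = b∉first ; b∉first = a∉first }
    where open Star S

  a₀ b₀ : ℕ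
  a₀ = bound (cl [])
  b₀ = suc a₀

  star : ∀ n → Σ (List Triple) (Star n a₀ b₀)
  star zero = [] , record
    { L = [] ; B-length = refl ; xs = [] ; xs-unique = [] ; xs-length = refl ; xs-ab = λ ()
    ; a≢b = <⇒≢ ≤-refl ; a∉xs = λ () ; b∉xs = λ () ; xs∉first = λ ()
    ; a∉first = λ p → <-irrefl refl (<-bound {cl []} (here refl) p)
    ; b∉first = λ p → <-asym (<-bound {cl []} (here refl) p) ≤-refl }
  star (suc n) with star n
  ... | B , S = e ∷ B , record
    { L = (tri-valid a≢b (<⇒≢ b<x) (<⇒≢ a<x) , λ e∈ → <-irrefl refl (≤-trans (<-bound e∈ (tri₃ _ _ _)) (m≤m+n _ _))) ∷ L
    ; B-length = cong suc B-length ; xs = x ∷ xs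
    ; xs-unique = ∉⇒All≢ (λ x∈ → fresh (blue⊆cl (xs-ab x∈)) (tri₃ _ _ _)) ∷ xs-unique
    ; xs-length = cong suc xs-length
    ; xs-ab = λ { (here refl) → here refl ; (there p) → there (xs-ab p) }
    ; a≢b = a≢b
    ; a∉xs = λ { (here eq) → <⇒≢ a<x eq ; (there p) → a∉xs p }
    ; b∉xs = λ { (here eq) → <⇒≢ b<x eq ; (there p) → b∉xs p }
    ; xs∉first = λ { (here refl) → fresh (red⊆cl (first∈red B)) ; (there p) → xs∉first p }
    ; a∉first = a∉first ; b∉first = b∉first }
    where
    open Star S
    -- The summand keeps x above a₀ and b₀ also in the first step, when these are in no claimed edge
    -- yet.
    x = bound (cl B) + suc b₀
    e = tri a₀ b₀ x
    b<x : b₀ < x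
    b<x = m≤n+m (suc b₀) (bound (cl B))
    a<x : a₀ < x
    a<x = <-trans ≤-refl b<x
    fresh : ∀ {f} → f ∈ cl B → ¬ x ∈ₜ f
    fresh f∈ x∈ = <-irrefl refl (≤-trans (<-bound f∈ x∈) (m≤m+n _ _))

  module Centred {a b : ℕ} {B₀ : List Triple} (S : Star (5 + (s + s)) a b B₀) where
    open Star S

    R : List Triple
    R = red B₀

    R-length : length R ≡ 6 + (s + s)
    R-length = ≡-trans (red-length B₀) (cong suc B-length)

    R-valid : ∀ {e} → e ∈ R → ValidEdge e
    R-valid = red-valid L

    open Centre s R (red-unique L) R-length R-valid first (first∈red B₀) public

    R′-length : length (later B₀) ≡ 5 + (s + s)
    R′-length = ≡-trans (later-length B₀) B-length

    c : ℕ
    c = bound (cl B₀)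

    c-fresh : ∀ {e} → e ∈ cl B₀ → ¬ c ∈ₜ e
    c-fresh e∈ c∈ = <-irrefl refl (<-bound e∈ c∈)

    c∉R : ∀ {e} → e ∈ R → ¬ c ∈ₜ e
    c∉R e∈ = c-fresh (red⊆cl e∈)

    c∉xs : c ∉ xs
    c∉xs c∈ = c-fresh (blue⊆cl (xs-ab c∈)) (tri₃ _ _ _)

    c∉first : ¬ c ∈ₜ first
    c∉first = c∉R (first∈red B₀)

    module FirstBlock (x₁ : ℕ) (x₁∈xs : x₁ ∈ xs) where

      a≢c : a ≢ c
      a≢c refl = c-fresh (blue⊆cl (xs-ab x₁∈xs)) (tri₁ _ _ _)

      b≢c : b ≢ c
      b≢c refl = c-fresh (blue⊆cl (xs-ab x₁∈xs)) (tri₂ _ _ _)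

      x₁≢a : x₁ ≢ a
      x₁≢a refl = a∉xs x₁∈xs

      x₁≢b : x₁ ≢ b
      x₁≢b refl = b∉xs x₁∈xs

      x₁≢c : x₁ ≢ c
      x₁≢c refl = c∉xs x₁∈xs

      B⋆ : List Triple
      B⋆ = tri a c x₁ ∷ B₀

      L⋆ : Legal B⋆
      L⋆ = (tri-valid a≢c (≢-sym x₁≢c) (≢-sym x₁≢a) , λ e∈ → c-fresh e∈ (tri₂ _ _ _)) ∷ L

      module Hub = SecondHub s a b c a≢b a≢c b≢c xs xs-unique xs-length a∉xs b∉xs c∉xs x₁
      module Played = Play s a b c a≢b a≢c b≢c xs xs-unique xs-length a∉xs b∉xs c∉xs xs∉first x₁

      Core-start : (Base : Triple → Set) → (∀ {e} → e ∈ R → Base e) →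
                   Σ (Hub.Core Base B⋆ (tri a c x₁ ∷ cl B₀) R) λ C →
                     length (Hub.Core.Tk C) ≡ 1 × Hub.Core.free Base C ≡ 0
      Core-start Base base with extract x₁∈xs
      ... | ys , p = record
        { Op = ys ; Tk = x₁ ∷ [] ; Bk = [] ; Oth = []
        ; perm = trans p (↭-sym (trans (shift x₁ ys []) (prep x₁ (↭-reflexive (++-identityʳ ys)))))
        ; x₁∈Tk = here refl ; xs-ab = λ x∈ → there (xs-ab x∈)
        ; Tk-ac = λ { (here refl) → here refl }
        ; Op-ac = λ { x∈ (here eq) → Unique[x∷xs]⇒x∉xs (Unique-resp-↭ p xs-unique) (subst (_∈ ys) (x≡x₁ x∈ eq) x∈)
                    ; x∈ (there q) → c-fresh q (tri₂ _ _ _) }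
        ; Rd-split = λ e∈ → inj₁ (base e∈) } , refl , refl
        where
        x≡x₁ : ∀ {x} → x ∈ ys → tri a c x ≡ tri a c x₁ → x ≡ x₁
        x≡x₁ x∈ eq = tri-injective (λ { refl → a∉xs (old x∈) }) (λ { refl → c∉xs (old x∈) }) eq
          where
          old : ∀ {x} → x ∈ ys → x ∈ xs
          old x∈ = ∈-resp-↭ (↭-sym p) (there x∈)

      -- The conditions on a and c limit the edges {a,c,x} through a centre h or h′ to one. They
      -- follow from `not-hub` and `unplayed-not-hub`.
      record Doubled : Set where
        field
          v h h′ : ℕ
          v≢h : v ≢ h
          v≢h′ : v ≢ h′
          h≢h′ : h ≢ h′
          a≢h : a ≢ h
          a≢h′ : a ≢ h′
          c≢h : c ≢ h
          c≢h′ : c ≢ h′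
          all-Q : ∀ {e} → e ∈ red B⋆ → Double.Q v h h′ e

      -- As long as there are at most 3t red edges, a red copy uses all of them, so the first 2t + 1 would
      -- be Doubled.
      module Race (good : GoodCentre a b) (undoubled : ¬ Doubled)
        (danger : (Σ Triple λ e → e ∈ R × a ∈ₜ e × x₁ ∈ₜ e) ⊎ (∀ {e x} → e ∈ R → x ∈ xs → a ∈ₜ e → ¬ x ∈ₜ e)) where
        open GoodCentre good
        open Played (_∈ R)
        open Hub (_∈ R)
        open Core

        safe-A : ∀ {B} → (∀ {e} → e ∈ red B⋆ → e ∈ red B) → Legal B → (C : CoreAt B) → free C ≤ 3 + s → ¬ Contains G (_∈ red B)
        safe-A {B} B⋆⊆ LB C le con with Contains⇒Copy (red-valid LB) con
        ... | Cp , sub = undoubled record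
          { v = v ; h = g₁ ; h′ = g₂ ; v≢h = v≢g₁ ; v≢h′ = v≢g₂ ; h≢h′ = g₁≢g₂
          ; a≢h = λ eq → not-hub (Cp , R⊆ , inj₁ eq) ; a≢h′ = λ eq → not-hub (Cp , R⊆ , inj₂ eq)
          ; c≢h = λ eq → unplayed-not-hub c∉R (hubView (Cp , R⊆ , inj₁ eq))
          ; c≢h′ = λ eq → unplayed-not-hub c∉R (hubView (Cp , R⊆ , inj₂ eq))
          ; all-Q = λ e∈ → toQ (tight (red⊆S (B⋆⊆ e∈))) }
          where
          open Copy Cp
          T : List Triple
          T = R ++ map (tri a c) (Bk C) ++ Oth C
          red⊆S : ∀ {e} → e ∈ red B → e ∈ T
          red⊆S e∈ with Rd-split C e∈
          ... | inj₁ p = ∈-++⁺ˡ p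
          ... | inj₂ (inj₁ (x , x∈ , refl)) = ∈-++⁺ʳ R (∈-++⁺ˡ (∈-map⁺ (tri a c) x∈))
          ... | inj₂ (inj₂ p) = ∈-++⁺ʳ R (∈-++⁺ʳ (map (tri a c) (Bk C)) p)
          T-length : length T ≡ 6 + (s + s) + free C
          T-length = ≡-trans (length-++ R) (cong₂ _+_ R-length
            (≡-trans (length-++ (map (tri a c) (Bk C))) (cong (_+ length (Oth C)) (length-map (tri a c) (Bk C)))))
          tight : ∀ {e} → e ∈ T → Edges e
          tight = size-tight (λ e∈ → red⊆S (sub e∈))
            (≤-trans (≤-reflexive T-length) (≤-trans (+-monoʳ-≤ (6 + (s + s)) le) (≤-reflexive (arith s))))
            where
            arith : ∀ s → 6 + (s + s) + (3 + s) ≡ 9 + (s + s + s)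
            arith = solve-∀
          R⊆ : ∀ {e} → e ∈ R → Edges e
          R⊆ e∈ = tight (∈-++⁺ˡ e∈)
          toQ : ∀ {e} → Edges e → Double.Q v g₁ g₂ e
          toQ (inj₁ (m , m∈ , eq)) = m , (N≢v m∈ , N≢g₁ m∈ , N≢g₂ m∈) , inj₁ eq
          toQ (inj₂ (m , m∈ , eq)) = m , (N≢v (M⊆N m∈) , N≢g₁ (M⊆N m∈) , N≢g₂ (M⊆N m∈)) , inj₂ eq

        safe-perpetual-A : ∀ {B₁ B Ys E} → Legal B₁ → Legal B → BlockedAt B₁ → (∀ {e} → e ∈ red B⋆ → e ∈ red B₁) →
          PerpetualRed B₁ B Ys (_≡ E) → ¬ Contains G (_∈ red B)
        safe-perpetual-A {B₁} {B} {Ys} {E} L₁ LB D B⋆⊆ P con with Contains⇒Copy (red-valid LB) con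
        ... | Cp , sub = RaceSafety.race-safe s a b c a≢b a≢c b≢c (_∈ red B₁) R (later B₀) A₁ first (Blocked.F D) E (Bk C) Ys x₁
            (Blocked.split D) (λ e∈ → B⋆⊆ (there e∈)) R-valid (first∈red B₀) (later-split B₀) R′-length
            A₁-length A₁-all c∉R a∉first (Blocked.Bk-length D)
            (λ x∈ → xs∉first (Bk⊆xs C x∈)) (λ x∈ → ≢b (Bk⊆xs C x∈))
            (λ x∈ r → red-blue L₁ r (Core.xs-ab C (Bk⊆xs C x∈)))
            x₁≢a x₁≢b (λ r → red-blue L₁ r (Core.xs-ab C x₁∈xs)) (λ r → red-blue L₁ r (Tk-ac C (x₁∈Tk C)))
            (danger′ danger) (λ r → Ys-fresh (red⊆cl r))
            (λ { y∈ refl → Ys-fresh (blue⊆cl (Core.xs-ab C x₁∈xs)) y∈ (tri₁ _ _ _) })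
            (λ { y∈ refl → Ys-fresh (blue⊆cl (Core.xs-ab C x₁∈xs)) y∈ (tri₂ _ _ _) })
            (λ { y∈ refl → Ys-fresh (blue⊆cl (Tk-ac C (x₁∈Tk C))) y∈ (tri₂ _ _ _) })
            red-split Cp sub
          where
          open PerpetualRed P
          C = Blocked.core D
          danger′ : (Σ Triple λ e → e ∈ R × a ∈ₜ e × x₁ ∈ₜ e) ⊎ (∀ {e x} → e ∈ R → x ∈ xs → a ∈ₜ e → ¬ x ∈ₜ e) →
                    (Σ Triple λ e → e ∈ R × a ∈ₜ e × x₁ ∈ₜ e) ⊎ (∀ {e x} → e ∈ R → x ∈ Bk C → a ∈ₜ e → ¬ x ∈ₜ e)
          danger′ (inj₁ p) = inj₁ p
          danger′ (inj₂ n) = inj₂ λ e∈ x∈ → n e∈ (Bk⊆xs C x∈)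

        mode : Mode
        mode = record
          { Calm = λ B → ∀ {e} → e ∈ red B⋆ → e ∈ red B
          ; Alert = λ _ → ⊥
          ; calm-next = λ _ q → inj₁ λ e∈ → there (q e∈)
          ; respond = λ _ ()
          ; Base-ac = λ e∈ _ eq → c∉R e∈ (subst (c ∈ₜ_) (sym eq) (tri₂ _ _ _))
          ; safe = λ { LB (inj₁ q) C le → safe-A q LB C le }
          ; safe-perpetual = λ L₁ LB D q₁ _ P → safe-perpetual-A L₁ LB D q₁ P }

        open Strategy mode public using (Inv; inv-safe; step)

        inv : Inv B⋆
        inv with Core-start (_∈ R) (λ e∈ → e∈)
        ... | C , len , fr = Strategy.land mode L⋆ C (≡-trans len (cong suc (sym fr)))
                (≤-trans (≤-reflexive len) (s≤s z≤n)) (inj₁ λ e∈ → e∈)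

      module Defence (doubled : Doubled) where
        open Doubled doubled
        open Double v h h′ using (Q)
        open Played Q
        open Hub Q
        open Core
        open Pairing v h h′ v≢h v≢h′ h≢h′
        open QCount v h h′ v≢h v≢h′ h≢h′ using (Q-centre)

        v∈first : v ∈ₜ first
        v∈first = Q-centre (all-Q (first∈red B⋆))

        v≢a : v ≢ a
        v≢a refl = a∉first v∈first

        v≢c : v ≢ c
        v≢c refl = c∉first v∈first

        -- The centre v lies in the first red edge, which a and c avoid. Hence play at c and play in
        -- Q never interfere.
        v∉ac : ∀ {x} → ¬ x ∈ₜ first → ¬ v ∈ₜ tri a c x
        v∉ac x∉ v∈ with ∈-tri-third v≢a v≢c v∈
        ... | refl = x∉ v∈first

        n : ℕ
        n = 3 + s

        Calm Alert : List Triple → Set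
        Calm B = Track (n + n) (red B) (cl B)
        Alert B = Track (suc (n + n)) (red B) (cl B)

        finish : ∀ {e B} → Legal (e ∷ B) → Track (n + n) (red B) (e ∷ cl B) → Calm (e ∷ B) ⊎ (Alert (e ∷ B) × Q (reply e B))
        finish LB T with Q? (proj₁ (reply-legal LB))
        ... | yes q = inj₂ (Track-Q T (proj₂ (reply-legal LB)) q , q)
        ... | no nq = inj₁ (Track-other T (proj₂ (reply-legal LB)) nq)

        track-all : ∀ {B} → Legal B → Track (suc (length B)) (red B) (cl B)
        track-all [] = add (proj₁ (σ-legal Zv Zu)) (proj₂ (σ-legal Zv Zu)) Track-start
          where
          add : ∀ {m e rd cl} → ValidEdge e → e ∉ cl → Track m rd cl → Track (suc m) (e ∷ rd) (e ∷ cl)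
          add val e∉ T with Q? val
          ... | yes q = Track-Q T e∉ q
          ... | no nq = Track-≤ (n≤1+n _) (Track-other T e∉ nq)
        track-all {e ∷ B} LB@(_ ∷ L′) with Q? (proj₁ (reply-legal LB))
        ... | yes q = Track-Q (Track-blue e (track-all L′)) (proj₂ (reply-legal LB)) q
        ... | no nq = Track-≤ (n≤1+n _) (Track-other (Track-blue e (track-all L′)) (proj₂ (reply-legal LB)) nq)

        respond : ∀ {B} → Legal B → Alert B →
          Σ Triple λ e → ValidEdge e × e ∉ cl B × (∀ {x} → x ∈ xs → e ≢ tri a c x) ×
            (Legal (e ∷ B) → Calm (e ∷ B) ⊎ (Alert (e ∷ B) × Q (reply e B)))
        respond {B} LB T with answer {n} red⊆cl T
        ... | inj₂ (e , val , new , v∈ , T′) = e , val , new ,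
              (λ { x∈ refl → v∉ac (xs∉first x∈) v∈ }) , λ LB′ → finish LB′ T′
        ... | inj₁ T′ = e , runFrom-valid m , runFrom-∉ (m≤m+n _ _) ,
              (λ x∈ eq → <-runFrom (m≤n+m (suc a) (bound (cl B))) (subst (a ∈ₜ_) (sym eq) (tri₁ _ _ _))) ,
              λ LB′ → finish LB′ (Track-blue e T′)
          where
          -- Starting above a makes the idle move avoid a, so it occupies none of the {a,c,x}.
          m = bound (cl B) + suc a
          e = runFrom m

        to-alert : ∀ {B} → Calm B ⊎ Alert B → Alert B
        to-alert (inj₁ T) = Track-≤ (n≤1+n _) T
        to-alert (inj₂ T) = T

        same-hubs? : (g g′ : ℕ) → Dec ((g ≡ h × g′ ≡ h′) ⊎ (g ≡ h′ × g′ ≡ h))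
        same-hubs? g g′ = ((g ≟ h) ×-dec (g′ ≟ h′)) ⊎-dec ((g ≟ h′) ×-dec (g′ ≟ h))

        private
          1+n+k≰n : ∀ k {m} → ¬ suc k + m ≤ m
          1+n+k≰n k {m} le = 1+n≰n (≤-trans (s≤s (m≤n+m m k)) le)

        -- The hubs h, h′ are capped at t common neighbours. Any other K_{2,t+1} needs t + 1 or at
        -- least 2(t + 1) - 4 edges outside Q, and there are at most t.
        safe-B : ∀ {B} → Legal B → Calm B ⊎ Alert B → (C : CoreAt B) → free C ≤ 3 + s → ¬ Contains G (_∈ red B)
        safe-B {B} LB T C le con with Contains⇒Copy (red-valid LB) con
        ... | Cp , sub = go (K.v k ≟ v) ((K.v k ≟ h) ⊎-dec (K.v k ≟ h′)) (same-hubs? (K.g₁ k) (K.g₂ k))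
          where
          k = Copy.toK Cp sub
          len : length (K.M k) ≡ 4 + s
          len = Copy.M-length Cp
          T′ : List Triple
          T′ = map (tri a c) (Bk C) ++ Oth C
          T′-length : length T′ ≤ 3 + s
          T′-length = ≤-trans (≤-reflexive (≡-trans (length-++ (map (tri a c) (Bk C)))
            (cong (_+ length (Oth C)) (length-map (tri a c) (Bk C))))) le
          split : ∀ {e} → e ∈ red B → K.v k ∈ₜ e → Q e ⊎ e ∈ T′
          split e∈ _ with Rd-split C e∈
          ... | inj₁ q = inj₁ q
          ... | inj₂ (inj₁ (x , x∈ , refl)) = inj₂ (∈-++⁺ˡ (∈-map⁺ (tri a c) x∈))
          ... | inj₂ (inj₂ p) = inj₂ (∈-++⁺ʳ (map (tri a c) (Bk C)) p)
          open QCounts v h h′ v≢h v≢h′ h≢h′ k T′ split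
          small : ¬ length (K.M k) ≤ length T′
          small le′ = 1+n≰n (≤-trans (≤-trans (≤-reflexive (sym len)) le′) T′-length)
          large : ¬ length (K.M k) + length (K.M k) ≤ 4 + length T′
          large le′ = 1+n+k≰n s (≤-trans (≤-reflexive (arith s)) (≤-trans
            (≤-trans (≤-reflexive (sym (cong₂ _+_ len len))) le′) (+-monoʳ-≤ 4 T′-length)))
            where
            arith : ∀ s → (1 + s) + (4 + (3 + s)) ≡ (4 + s) + (4 + s)
            arith = solve-∀
          2≤4 : ∀ {m} → m ≤ 2 + length T′ → m ≤ 4 + length T′
          2≤4 le′ = ≤-trans le′ (≤-trans (n≤1+n _) (n≤1+n _))
          go : _ → _ → _ → ⊥
          go (yes w≡v) _ (yes hubs) = 1+n≰n (≤-trans (≤-reflexive (sym len)) (K-capped {n = n} (to-alert T) k w≡v hubs))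
          go (yes w≡v) _ (no ne) = [ small , large ] (centre-same w≡v (λ p → ne (inj₁ p)) (λ p → ne (inj₂ p)))
          go (no _) (yes w≡h) _ = [ small , (λ le′ → large (2≤4 le′)) ] (centre-hub w≡h)
          go (no w≢v) (no ne) _ = large (2≤4 (centre-elsewhere w≢v (λ p → ne (inj₁ p)) (λ p → ne (inj₂ p))))

        -- For other hubs the reduced K_{2,t} is counted: outside Q only F passes through v, only F
        -- and one {a,c,x} through h or h′, and at most t edges exist altogether.
        safe-perpetual-B : ∀ {B₁ B Ys E} → Legal B₁ → Legal B → BlockedAt B₁ → Calm B ⊎ Alert B →
          PerpetualRed B₁ B Ys (_≡ E) → ¬ Contains G (_∈ red B)
        safe-perpetual-B {B₁} {B} {Ys} {E} L₁ LB D T P con with Contains⇒Copy (red-valid LB) con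
        ... | Cp , sub = go (K.v k ≟ v) ((K.v k ≟ h) ⊎-dec (K.v k ≟ h′)) (same-hubs? (Copy.g₁ Cp) (Copy.g₂ Cp))
          where
          open PerpetualRed P
          C = Blocked.core D
          F = Blocked.F D
          ab-old : tri a b x₁ ∈ cl B₁
          ab-old = blue⊆cl (Core.xs-ab C x₁∈xs)
          ac-old : tri a c x₁ ∈ cl B₁
          ac-old = blue⊆cl (Tk-ac C (x₁∈Tk C))
          reduced = reduceK (Copy.toK Cp sub) (_∈ red B₁) Ys a c E red-split (λ r → Ys-fresh (red⊆cl r))
            (λ { y∈ refl → Ys-fresh ab-old y∈ (tri₁ _ _ _) }) (λ { y∈ refl → Ys-fresh ac-old y∈ (tri₂ _ _ _) })
            (subst (3 ≤_) (sym (Copy.M-length Cp)) (s≤s (s≤s (s≤s z≤n))))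
          k = proj₁ reduced
          len : length (K.M k) ≡ 3 + s
          len = suc-injective (≡-trans (sym (proj₂ (proj₂ (proj₂ (proj₂ reduced))))) (Copy.M-length Cp))
          few : ∀ m → m ≤ 2 → ¬ length (K.M k) ≤ m
          few m m≤ le = 1+n≰n (≤-trans (subst (3 ≤_) (sym len) (s≤s (s≤s (s≤s z≤n)))) (≤-trans le m≤))
          few₂ : ∀ m → m ≤ 5 → ¬ length (K.M k) + length (K.M k) ≤ m
          few₂ m m≤ le = 1+n≰n (≤-trans (subst (λ l → 6 ≤ l + l) (sym len) (+-mono-≤ {3} {3 + s} (m≤m+n 3 s) (m≤m+n 3 s))) (≤-trans le m≤))
          at-v : K.v k ≡ v → ∀ {e} → e ∈ red B₁ → K.v k ∈ₜ e → Q e ⊎ e ∈ F ∷ []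
          at-v refl e∈ v∈ with Blocked.split D e∈
          ... | inj₁ q = inj₁ q
          ... | inj₂ (inj₂ refl) = inj₂ (here refl)
          ... | inj₂ (inj₁ (x , x∈ , refl)) = ⊥-elim (v∉ac (xs∉first (Bk⊆xs C x∈)) v∈)
          at-hub : K.v k ≢ a → K.v k ≢ c → ∀ {e} → e ∈ red B₁ → K.v k ∈ₜ e → Q e ⊎ e ∈ F ∷ tri a c (K.v k) ∷ []
          at-hub w≢a w≢c e∈ w∈ with Blocked.split D e∈
          ... | inj₁ q = inj₁ q
          ... | inj₂ (inj₂ refl) = inj₂ (here refl)
          ... | inj₂ (inj₁ (x , x∈ , refl)) with ∈-tri-third w≢a w≢c w∈
          ...   | refl = inj₂ (there (here refl))
          anywhere : ∀ {e} → e ∈ red B₁ → K.v k ∈ₜ e → Q e ⊎ e ∈ F ∷ map (tri a c) (Bk C)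
          anywhere e∈ _ with Blocked.split D e∈
          ... | inj₁ q = inj₁ q
          ... | inj₂ (inj₂ refl) = inj₂ (here refl)
          ... | inj₂ (inj₁ (x , x∈ , refl)) = inj₂ (there (∈-map⁺ (tri a c) x∈))
          module QC = QCounts v h h′ v≢h v≢h′ h≢h′ k
          hub≢a : K.v k ≡ h ⊎ K.v k ≡ h′ → K.v k ≢ a
          hub≢a (inj₁ eq) eq′ = a≢h (≡-trans (sym eq′) eq)
          hub≢a (inj₂ eq) eq′ = a≢h′ (≡-trans (sym eq′) eq)
          hub≢c : K.v k ≡ h ⊎ K.v k ≡ h′ → K.v k ≢ c
          hub≢c (inj₁ eq) eq′ = c≢h (≡-trans (sym eq′) eq)
          hub≢c (inj₂ eq) eq′ = c≢h′ (≡-trans (sym eq′) eq)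
          many : ¬ length (K.M k) + length (K.M k) ≤ 2 + length (F ∷ map (tri a c) (Bk C))
          many le = 1+n+k≰n s (≤-trans (≤-reflexive (arith s)) (≤-trans
            (≤-reflexive (sym (cong₂ _+_ len len))) (≤-trans le (≤-reflexive
              (cong (3 +_) (≡-trans (length-map (tri a c) (Bk C)) (Blocked.Bk-length D)))))))
            where
            arith : ∀ s → (1 + s) + (3 + (2 + s)) ≡ (3 + s) + (3 + s)
            arith = solve-∀
          go : _ → _ → _ → ⊥
          -- The cap t excludes t + 1 common neighbours but not t, so the unreduced copy is used.
          go (yes w≡v) _ (yes hubs) = 1+n≰n (≤-trans (≤-reflexive (sym (Copy.M-length Cp)))
            (K-capped {n = n} (to-alert T) (Copy.toK Cp sub) (≡-trans (sym (proj₁ (proj₂ reduced))) w≡v) hubs))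
          go (yes w≡v) _ (no ne) = [ few _ (s≤s z≤n) , few₂ _ ≤-refl ]
            (QC.centre-same (F ∷ []) (at-v w≡v) w≡v (λ p → ne (inj₁ p)) (λ p → ne (inj₂ p)))
          go (no _) (yes w≡h) _ = [ few _ ≤-refl , few₂ _ (n≤1+n _) ]
            (QC.centre-hub _ (at-hub (hub≢a w≡h) (hub≢c w≡h)) w≡h)
          go (no w≢v) (no ne) _ = many (QC.centre-elsewhere _ anywhere w≢v (λ p → ne (inj₁ p)) (λ p → ne (inj₂ p)))

        mode : Mode
        mode = record
          { Calm = Calm ; Alert = Alert
          ; calm-next = λ {e} LB T → finish LB (Track-blue e T)
          ; respond = respond
          ; Base-ac = λ q x∉ eq → v∉ac x∉ (subst (v ∈ₜ_) eq (Q-centre q))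
          ; safe = safe-B
          ; safe-perpetual = λ L₁ LB D _ T P → safe-perpetual-B L₁ LB D T P }

        open Strategy mode public using (Inv; inv-safe; step)

        inv : Inv B⋆
        inv with Core-start Q (λ e∈ → all-Q (there e∈))
        ... | C , len , fr = Strategy.land mode L⋆ C (≡-trans len (cong suc (sym fr)))
                (≤-trans (≤-reflexive len) (s≤s z≤n))
                -- There are 2t + 1 red edges at this point, exactly the bound of `Alert`: defending
                -- starts just in time.
                (inj₂ (Track-≤ (≤-reflexive (≡-trans (cong (2 +_) B-length) (arith s))) (track-all L⋆) , all-Q (here refl)))
          where
          arith : ∀ s → 7 + (s + s) ≡ 1 + (3 + s + (3 + s))
          arith = solve-∀

-- From the invariants to the draw

module Draw (σ : Strategy) (legal : LegalStrategy σ) (Z : List Triple) (Zv : All ValidEdge Z) (Zu : Unique Z)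
            (Z<2 : length Z < 2) (s : ℕ) where
  open Game σ legal Z Zv Zu
  open Opening σ legal Z Zv Zu s
  open Machine σ legal Z Zv Zu using (first)
  open Target s

  MovesAt : ℕ → Play → ℕ → Triple → Set
  MovesAt r p n e = Σ ℕ λ i → (i < n) × (i % 2 ≡ r) × (p i ≡ e)

  NotBeaten : Set
  NotBeaten = Σ Play λ p → LegalPlay p × (∀ n → n % 2 ≡ length Z → p n ≡ σ (history p n)) ×
    (∀ n → Contains G (MovesAt (length Z) p n) → Contains G (MovesAt (1 ∸ length Z) p n))

  run : (Inv : List Triple → Set) → (∀ {B} → Legal B → Inv B → ¬ Contains G (_∈ red B)) →
        (∀ {B} → Legal B → Inv B → Σ Triple λ e → ValidEdge e × e ∉ cl B × (Inv (e ∷ B) ⊎ Contains G (_∈ e ∷ B))) →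
        ∀ {B} → Legal B → Inv B → NotBeaten
  run Inv safe step L I = play , play-legal , play-follows , opponent-not-first
    where open Run Z<2 G Inv safe step L I

  from-centre : ∀ {a b B₀} (S : Star (5 + (s + s)) a b B₀) → Centred.GoodCentre S a b → ¬ ¬ NotBeaten
  from-centre {a} {b} {B₀} S good lost = ¬¬-excluded-middle pick
    where
    open Star S using (xs; xs-length)
    open Centred S using (R; module FirstBlock)
    Dangerous : Set
    Dangerous = Σ ℕ λ x → x ∈ xs × (Σ Triple λ e → e ∈ R × a ∈ₜ e × x ∈ₜ e)
    some : ∀ {n} (L : List ℕ) → length L ≡ suc n → Σ ℕ (_∈ L)
    some (x ∷ _) _ = x , here refl
    go : ∀ x₁ (x₁∈ : x₁ ∈ xs) →
         (Σ Triple λ e → e ∈ R × a ∈ₜ e × x₁ ∈ₜ e) ⊎ (∀ {e x} → e ∈ R → x ∈ xs → a ∈ₜ e → ¬ x ∈ₜ e) → ⊥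
    go x₁ x₁∈ danger = ¬¬-excluded-middle {A = Doubled} λ
      { (yes doubled) → let open Defence doubled in lost (run Inv inv-safe step L⋆ inv)
      ; (no undoubled) → let open Race good undoubled danger in lost (run Inv inv-safe step L⋆ inv) }
      where open FirstBlock x₁ x₁∈
    -- If some x shares a red edge with a, it becomes x₁, so blue's first edge at c denies it to the
    -- opponent as a common neighbour of c. Otherwise any x will do.
    pick : Dec Dangerous → ⊥
    pick (yes (x , x∈ , D)) = go x x∈ (inj₁ D)
    pick (no none) with some xs xs-length
    ... | x , x∈ = go x x∈ (inj₂ λ e∈ x′∈ a∈ x′∈e → none (_ , x′∈ , _ , e∈ , a∈ , x′∈e))

  from-star : ∀ {a b B₀} → Star (5 + (s + s)) a b B₀ → ¬ ¬ NotBeaten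
  from-star {a} {b} {B₀} S lost = ¬¬-excluded-middle λ d → ¬¬-excluded-middle λ d′ →
    [ (λ good → from-centre S good lost) , (λ good → from-centre (swapStar S) good lost) ]
      (choose (later B₀) R′-length (later-split B₀) a≢b a∉first b∉first d d′)
    where
    open Star S
    open Centred S using (choose; R′-length)

  not-beaten : ¬ ¬ NotBeaten
  not-beaten = from-star (proj₂ (star (5 + (s + s))))

theorem4p2 : ∀ (t : ℕ) → 3 ≤ t → IsDraw (K2ts3 (suc t) (t ∸ 2))
theorem4p2 (suc (suc (suc s))) _ = first-player , second-player
  where
  first-player : ¬ P1HasWinningStrategy (K2ts3 (4 + s) (1 + s))
  first-player (σ , legal , wins) = Draw.not-beaten σ legal [] [] [] (s≤s z≤n) s λ (p , lp , follows , fine) →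
    let n , red , ¬blue = wins p lp follows in ¬blue (fine n red)

  second-player : ¬ P2HasWinningStrategy (K2ts3 (4 + s) (1 + s))
  second-player (τ , legal , wins) =
    Draw.not-beaten τ legal (runFrom 0 ∷ []) (runFrom-valid 0 ∷ []) ([] ∷ []) (s≤s (s≤s z≤n)) s λ (p , lp , follows , fine) →
      let n , blue , ¬red = wins p lp follows in ¬red (fine n blue)
theorem4p2 (suc zero) (s≤s ())
theorem4p2 (suc (suc zero)) (s≤s (s≤s ()))
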